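{- Let $k$ be a positive integer, $\mathbf{x}^{\pm}=(x_1,x_1^{ -1},\dots,x_k,x_k^{ -1})$ and $\mathbf{y}=(y_1,\dots,y_k)$. Then $$\sum_{\ell(\lambda)\le k}s_\lambda(\mathbf{x}^{\pm})\,s_\lambda(\mathbf{y})=\prod_{i,j=1}^{k}(1-x_jy_i)^{ -1}(1-x_j^{ -1}y_i)^{ -1}=\sum_{\ell(\lambda)\le k}\mathrm{sp}_\lambda(\mathbf{x}^{\pm})\,\mathrm{ss}_\lambda(\mathbf{y}),$$ where both sums are over all partitions $\lambda$ with at most $k$ rows (identities of formal power series in $y_1,\dots,y_k$ with coefficients Laurent polynomials in $x_1,\dots,x_k$).
   Context: Partitions are identified with Young diagrams in English notation; $\ell(\lambda)$ is the number of rows. $[\overline{k}]=\{1,\overline1,\dots,k,\overline k\}$ with the order $1<\overline1<2<\overline2<\cdots<k<\overline k$, and $x_{\overline j}:=x_j^{ -1}$. Schur polynomials: $s_\lambda(\mathbf{y})=\sum_T\prod_{m,n}y_{T(m,n)}$ over semistandard Young tableaux $T$ of shape $\lambda$ with entries in $\{1,\dots,k\}$ (rows weakly increasing, columns strictly increasing; $T(m,n)$ is the entry in row $m$, column $n$), and $s_\lambda(\mathbf{x}^{\pm})=\sum_T\prod_{m,n}x_{T(m,n)}$ over semistandard tableaux of shape $\lambda$ with entries in $[\overline k]$, i.e. the Schur polynomial in the $2k$ variables $x_1,x_1^{ -1},\dots,x_k,x_k^{ -1}$. Symplectic Schur function: a King tableau of shape $\lambda$ is a semistandard filling $T$ of $\lambda$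 by $[\overline k]$ such that all entries in row $i$ are $\ge i$ for every $i$; $\mathrm{KT}_k(\lambda)$ is the set of these, and $\mathrm{sp}_\lambda(\mathbf{x}^{\pm})=\sum_{T\in\mathrm{KT}_k(\lambda)}\prod_{m,n}x_{T(m,n)}$. SSOT function: a skew shape is a horizontal strip if it contains at most one box in each column. A $k$-semistandard oscillating tableau ($k$-SSOT) of final shape $\lambda$ is a finite sequence of partitions $S=(S^{1},S'^{2},S^{2},S'^{3},\dots,S'^{k},S^{k})$ such that, with $S'^{1}=\emptyset$: $S^{i}\supseteq S'^{i+1}$ and $S^i\setminus S'^{i+1}$ is a (possibly empty) horizontal strip for $1\le i\le k-1$; $S'^{i}\subseteq S^{i}$ and $S^i\setminus S'^i$ is a (possibly empty) horizontal strip for $1\le i\le k$; and $S^k=\lambda$. $\mathrm{SSOT}_k(\lambda)$ is the set of these. Step $i$ consists of deleting the boxes of $S^{i-1}\setminus S'^{i}$ (for $i\ge2$) and then adding the boxes of $S^i\setminus S'^i$. $S$ is identified with the multiset-valued tableau in which $i$ is recorded at a position $(l,m)$ once for each time that box is added or deleted in step $i$; $S(l,m)$ denotes the multiset at $(l,m)$. The weight is $\mathbf{y}^S=\prod_{l,m}\prod_{j\in S(l,m)}y_j$ (so the exponent of $y_i$ is the total number of boxes deleted and added in step $i$), and $\mathrm{ss}_\lambda(\mathbf{y})=\sum_{S\in\mathrm{SSOT}_k(\lambda)}\mathbf{y}^S$, a formal power series. -}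

module Defs where

open import Level using (0ℓ)
open import Algebra.Bundles.Raw using (RawRing)
import Algebra.Definitions.RawSemiring as RawSemiringOps
open import Data.Bool.Base using (if_then_else_)
open import Data.Fin.Base as Fin using (Fin; toℕ; remQuot)
import Data.Fin.Properties as Finₚ
open import Data.Integer.Base as ℤ using (ℤ; 0ℤ; 1ℤ; -1ℤ)
import Data.Integer.Properties as ℤₚ
open import Data.List.Base as List
  using (List; []; _∷_; _++_; map; foldr; concat; concatMap; filter; mapMaybe; length;
         upTo; allFin; zip; cartesianProduct; cartesianProductWith)
import Data.List.Properties as Listₚ
open import Data.List.Membership.Propositional using (_∈_; _∉_)
open import Data.List.Relation.Binary.Prefix.Heterogeneous using (Prefix)
open import Data.List.Relation.Binary.Prefix.Heterogeneous.Properties using (prefix?)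
open import Data.List.Relation.Unary.All using (All; []; all?)
open import Data.List.Relation.Unary.Linked using (Linked; []; linked?)
open import Data.List.Relation.Unary.Unique.Propositional using (Unique)
open import Data.Maybe.Base using (Maybe; just; nothing)
open import Data.Nat.Base as ℕ using (ℕ; zero; suc; _≤_; _<_; _≥_)
import Data.Nat.Properties as ℕₚ
open import Data.Product.Base using (Σ; ∃; _×_; _,_; proj₁; proj₂)
open import Data.Product.Properties using (≡-dec)
open import Data.Unit.Base using (⊤; tt)
open import Data.Vec.Base as Vec using (Vec; []; _∷_)
import Data.Vec.Properties as Vecₚ
open import Relation.Binary.Definitions using (DecidableEquality)
open import Relation.Binary.PropositionalEquality.Core using (_≡_; refl; cong)
open import Relation.Nullary.Decidable
  using (Dec; yes; no; does; ¬?; _×-dec_; map′)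

import Data.List.Membership.DecPropositional as DecMembership
import Data.List.Relation.Binary.Subset.DecPropositional as DecSubset
import Data.List.Relation.Unary.Unique.DecPropositional as DecUnique

choices : ∀ {A : Set} {n} → Vec (List A) n → List (Vec A n)
choices []         = [] ∷ []
choices (xs ∷ xss) = cartesianProductWith _∷_ xs (choices xss)

words : ∀ {A : Set} → ℕ → List A → List (List A)
words m letters = map Vec.toList (choices (Vec.replicate m letters))

------------------------------------------------------------------------
-- Partitions and Young diagrams

IsPartition : List ℕ → Set
IsPartition rows = Linked _≥_ rows × All (0 <_) rows

isPartition? : ∀ rows → Dec (IsPartition rows)
isPartition? rows = linked? ℕₚ._≥?_ rows ×-dec all? (0 ℕₚ.<?_) rows

-- The proof field is irrelevant, so partitions are equal iff their rows are.
record Partition : Set where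
  constructor mkPartition
  field
    rows         : List ℕ
    .isPartition : IsPartition rows

open Partition public using (rows)

_≟ₚ_ : DecidableEquality Partition
mkPartition r p ≟ₚ mkPartition s q =
  map′ (λ { refl → refl }) (cong rows) (Listₚ.≡-dec ℕₚ._≟_ r s)

∅ : Partition
∅ = mkPartition [] ([] , [])

ℓ : Partition → ℕ
ℓ μ = length (rows μ)

-- A box is a pair (row , column), both counted from 0.
Box : Set
Box = ℕ × ℕ

_≟ᵇ_ : DecidableEquality Box
_≟ᵇ_ = ≡-dec ℕₚ._≟_ ℕₚ._≟_

boxes : Partition → List Box
boxes μ = concatMap (λ (r , len) → map (r ,_) (upTo len)) (zip (upTo (ℓ μ)) (rows μ))

open DecMembership _≟ᵇ_ using (_∈?_)
open DecSubset _≟ᵇ_ using (_⊆_; _⊆?_)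

_∖_ : Partition → Partition → List Box
μ ∖ ν = filter (λ b → ¬? (b ∈? boxes ν)) (boxes μ)

-- The columns of the boxes of μ ∖ ν are pairwise distinct, i.e. no column contains two boxes.
HorizontalStrip : Partition → Partition → Set
HorizontalStrip μ ν = boxes ν ⊆ boxes μ × Unique (map proj₂ (μ ∖ ν))

horizontalStrip? : ∀ μ ν → Dec (HorizontalStrip μ ν)
horizontalStrip? μ ν = (boxes ν ⊆? boxes μ) ×-dec unique? (map proj₂ (μ ∖ ν))
  where open DecUnique ℕₚ._≟_ using (unique?)

-- All partitions whose diagram fits in an N × N square; in particular, all partitions with at
-- most N boxes.
partitionsIn : ℕ → List Partition
partitionsIn N = mapMaybe toPartition (concatMap (λ m → words m (upTo (suc N))) (upTo (suc N)))
  where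
  toPartition : List ℕ → Maybe Partition
  toPartition r with isPartition? r
  ... | yes p = just (mkPartition r p)
  ... | no _  = nothing

------------------------------------------------------------------------
-- Tableaux, stored as the list of their rows, with entries in Fin n

Tableau : ℕ → Set
Tableau n = List (List (Fin n))

-- Prefix Fin._>_ s r says that s is no longer than r and that each entry of s is larger than
-- the entry of r in the same column.
IsSSYT : ∀ {n} → Partition → Tableau n → Set
IsSSYT μ T = map length T ≡ rows μ
           × All (Linked Fin._≤_) T
           × Linked (λ r s → Prefix Fin._>_ s r) T

isSSYT? : ∀ {n} μ (T : Tableau n) → Dec (IsSSYT μ T)
isSSYT? μ T = Listₚ.≡-dec ℕₚ._≟_ (map length T) (rows μ)
  ×-dec all? (linked? Finₚ._≤?_) T
  ×-dec linked? (λ r s → prefix? (λ a b → b Finₚ.<? a) s r) T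

ssyts : (n : ℕ) → Partition → List (Tableau n)
ssyts n μ = filter (isSSYT? μ) (map Vec.toList (choices rowFillings))
  where
  rowFillings : Vec (List (List (Fin n))) (ℓ μ)
  rowFillings = Vec.map (λ m → words m (allFin n)) (Vec.fromList (rows μ))

-- The ordered alphabet 1 < 1̄ < 2 < 2̄ < ⋯ < k < k̄ is Fin (k * 2): the letters j+1 and its
-- barred version are combine j 0 and combine j 1, at positions 2j and 2j+1.
Barred : ℕ → Set
Barred k = Fin (k ℕ.* 2)

-- With rows counted from 0, the entries of row r must be at least the letter r+1.
KingFrom : ∀ {n} → ℕ → Tableau n → Set
KingFrom r []        = ⊤
KingFrom r (row ∷ T) = All (λ e → r ℕ.* 2 ≤ toℕ e) row × KingFrom (suc r) T

kingFrom? : ∀ {n} r (T : Tableau n) → Dec (KingFrom r T)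
kingFrom? r []            = yes tt
kingFrom? r (row ∷ T) = all? (λ e → r ℕ.* 2 ℕₚ.≤? toℕ e) row ×-dec kingFrom? (suc r) T

kingTableaux : (k : ℕ) → Partition → List (Tableau (k ℕ.* 2))
kingTableaux k μ = filter (kingFrom? 0) (ssyts (k ℕ.* 2) μ)

------------------------------------------------------------------------
-- Semistandard oscillating tableaux

-- The i-th entry is the pair (S′ⁱ , Sⁱ).
Steps : ℕ → Set
Steps k = Vec (Partition × Partition) k

StepsFrom : ∀ {k} → Partition → Steps k → Partition → Set
StepsFrom μ []            final = μ ≡ final
StepsFrom μ ((ν , ρ) ∷ S) final = HorizontalStrip μ ν × HorizontalStrip ρ ν × StepsFrom ρ S final

stepsFrom? : ∀ {k} μ (S : Steps k) final → Dec (StepsFrom μ S final)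
stepsFrom? μ []            final = μ ≟ₚ final
stepsFrom? μ ((ν , ρ) ∷ S) final =
  horizontalStrip? μ ν ×-dec horizontalStrip? ρ ν ×-dec stepsFrom? ρ S final

-- Putting S⁰ = ∅ forces S′¹ = ∅, since S′¹ is contained in S⁰.
IsSSOT : ∀ {k} → Partition → Steps k → Set
IsSSOT final S = StepsFrom ∅ S final

weightFrom : ∀ {k} → Partition → Steps k → Vec ℕ k
weightFrom μ []            = []
weightFrom μ ((ν , ρ) ∷ S) = length (μ ∖ ν) ℕ.+ length (ρ ∖ ν) ∷ weightFrom ρ S

weight : ∀ {k} → Steps k → Vec ℕ k
weight = weightFrom ∅

-- All SSOTs of final shape μ whose partitions fit in an N × N square.
ssotsIn : (k N : ℕ) → Partition → List (Steps k)
ssotsIn k N μ = filter (λ S → stepsFrom? ∅ S μ) (choices (Vec.replicate k pairs))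
  where
  pairs : List (Partition × Partition)
  pairs = cartesianProduct (partitionsIn N) (partitionsIn N)

------------------------------------------------------------------------
-- Finite sums and products in a ring

module ListOps (R : RawRing 0ℓ 0ℓ) where
  open RawRing R

  ∑ : ∀ {A : Set} → List A → (A → Carrier) → Carrier
  ∑ xs f = foldr _+_ 0# (map f xs)

  ∏ : ∀ {A : Set} → List A → (A → Carrier) → Carrier
  ∏ xs f = foldr _*_ 1# (map f xs)

-- The Schur polynomial of μ in the n variables z, in this order.
schur : (R : RawRing 0ℓ 0ℓ) → ∀ {n} → (Fin n → RawRing.Carrier R) → Partition → RawRing.Carrier R
schur R {n} z μ = ∑ (ssyts n μ) (λ T → ∏ (concat T) z)
  where open ListOps R

------------------------------------------------------------------------
-- Laurent polynomials over ℤ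

unit : ∀ {A : Set} {k} → A → A → Fin k → Vec A k
unit o e i = Vec.replicate _ o Vec.[ i ]≔ e

-- A list of terms (coefficient , exponent vector); an exponent vector may occur repeatedly.
Terms : ℕ → Set
Terms k = List (ℤ × Vec ℤ k)

coeff : ∀ {k} → Terms k → Vec ℤ k → ℤ
coeff []            e = 0ℤ
coeff ((c , d) ∷ p) e = (if does (Vecₚ.≡-dec ℤₚ._≟_ d e) then c else 0ℤ) ℤ.+ coeff p e

Laurent : ℕ → RawRing 0ℓ 0ℓ
Laurent k = record
  { Carrier = Terms k
  ; _≈_     = λ p q → ∀ e → coeff p e ≡ coeff q e
  ; _+_     = _++_
  ; _*_     = cartesianProductWith (λ (c , d) (c′ , d′) → c ℤ.* c′ , Vec.zipWith ℤ._+_ d d′)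
  ; -_      = map (λ (c , d) → ℤ.- c , d)
  ; 0#      = []
  ; 1#      = (1ℤ , Vec.replicate k 0ℤ) ∷ []
  }

-- x i and x⁻¹ i stand for the variable with index i+1 and its inverse.
x : ∀ {k} → Fin k → Terms k
x i = (1ℤ , unit 0ℤ 1ℤ i) ∷ []

x⁻¹ : ∀ {k} → Fin k → Terms k
x⁻¹ i = (1ℤ , unit 0ℤ -1ℤ i) ∷ []

x± : ∀ {k} → Barred k → Terms k
x± {k} e with remQuot {k} 2 e
... | i , Fin.zero  = x i
... | i , Fin.suc _ = x⁻¹ i

------------------------------------------------------------------------
-- Formal power series in k variables over a ring

-- All pairs (β , γ) with β + γ = α.
splits : ∀ {k} → Vec ℕ k → List (Vec ℕ k × Vec ℕ k)
splits []      = ([] , []) ∷ []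
splits (a ∷ α) =
  cartesianProductWith (λ b (β , γ) → b ∷ β , a ℕ.∸ b ∷ γ) (upTo (suc a)) (splits α)

module PowerSeries (R : RawRing 0ℓ 0ℓ) (k : ℕ) where
  private module R = RawRing R
  open ListOps R using (∑)

  Series : Set
  Series = Vec ℕ k → R.Carrier

  monomial : R.Carrier → Vec ℕ k → Series
  monomial c β α = if does (Vecₚ.≡-dec ℕₚ._≟_ β α) then c else R.0#

  const : R.Carrier → Series
  const c = monomial c (Vec.replicate k 0)

  var : Fin k → Series
  var i = monomial R.1# (unit 0 1 i)

  ring : RawRing 0ℓ 0ℓ
  ring = record
    { Carrier = Series
    ; _≈_     = λ f g → ∀ α → f α R.≈ g α
    ; _+_     = λ f g α → f α R.+ g α
    ; _*_     = λ f g α → ∑ (splits α) (λ (β , γ) → f β R.* g γ)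
    ; -_      = λ f α → R.- f α
    ; 0#      = λ _ → R.0#
    ; 1#      = const R.1#
    }

  open RawRing ring public using (_≈_; _+_; _*_; -_; 0#; 1#)
  open RawSemiringOps (RawRing.rawSemiring ring) public using (_^_; product)

  infixl 6 _-_
  _-_ : Series → Series → Series
  f - g = f + - g

  -- The multiplicative inverse ∑ₙ (1 - f)ⁿ of a series f with constant term 1.  Since 1 - f has
  -- no constant term, (1 - f)ⁿ has no terms of total degree less than n, so only n ≤ |α|
  -- contributes to the coefficient of y^α.
  infix 9 _⁻¹
  _⁻¹ : Series → Series
  (f ⁻¹) α = ∑ (upTo (suc (Vec.sum α))) (λ n → ((1# - f) ^ n) α)

  -- Summation of a possibly infinite family: each coefficient is nonzero for only finitely many
  -- members of the family, and these add up to the coefficient of the sum.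
  HasSum : {I : Set} → (I → Series) → Series → Set
  HasSum {I} f s = ∀ α → ∃ λ (is : List I) →
    Unique is × (∀ i → i ∉ is → f i α R.≈ R.0#) × ∑ is (λ i → f i α) R.≈ s α

------------------------------------------------------------------------
-- The functions in the identities, as power series in y over Laurent polynomials in x

module Functions (k : ℕ) where
  open PowerSeries (Laurent k) k public

  y : Fin k → Series
  y = var

  s[y] : Partition → Series
  s[y] = schur ring y

  s[x±] : Partition → Terms k
  s[x±] = schur (Laurent k) (x± {k})

  sp[x±] : Partition → Terms k
  sp[x±] μ = ∑ (kingTableaux k μ) (λ T → ∏ (concat T) (x± {k}))
    where open ListOps (Laurent k)

  -- Every box of a partition in an SSOT of weight α was added at some step, so these partitions
  -- have at most |α| boxes and ssotsIn k |α| μ contains all SSOTs contributing to y^α.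
  ss[y] : Partition → Series
  ss[y] μ α = ∑ (ssotsIn k (Vec.sum α) μ) (λ S → monomial 1L (weight S) α)
    where
    open ListOps (Laurent k)
    open RawRing (Laurent k) using () renaming (1# to 1L)

  AtMostRows : Set
  AtMostRows = Σ Partition (λ μ → ℓ μ ≤ k)

{-# OPTIONS --safe #-}

-- The coefficient of y^α in the kernel is ∏ᵢ h_{αᵢ}(x^±).  Both expansions therefore follow, one variable yᵢ
-- at a time, from a Pieri rule: h_d(x^±) s_μ is the sum of the s_λ over the horizontal strips λ ∖ μ of size d,
-- and h_d(x^±) sp_μ is the sum of the sp_λ over all ways to delete a horizontal strip from μ and then add
-- another one, of total size d.
--
-- Each Pieri rule is proved by induction on the x-variables.  Removing the largest letters from the tableaux
-- reduces it to a local identity between weighted chains of interlacing shapes.  For s_μ this is the local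
-- rule of RSK.  For sp_μ the row bound of King tableaux obstructs that bijection: RSK and Bender–Knuth moves
-- identify the two sides with one set of chains from which two different subsets are removed, and adding a
-- box to the bottom rows of two of the shapes is a bijection between these subsets.  It preserves the weight
-- because the variables come in pairs x, x⁻¹.
module Submission where

open import Defs
open import Data.Nat.Base using (ℕ; NonZero; suc)
open import Algebra.Bundles using (CommutativeRing; CommutativeMonoid)
open import Algebra.Bundles.Raw using (RawRing)
open import Data.Bool.Base using (true; false; if_then_else_)
open import Data.Empty using (⊥-elim; ⊥)
open import Data.Fin.Base as Fin using (Fin; toℕ; fromℕ<; combine)
import Data.Fin.Properties as Finₚ
open import Data.Integer.Base as ℤ using (ℤ; 0ℤ; 1ℤ; -1ℤ)
import Data.Integer.Properties as ℤₚ
open import Data.List.Base as List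
  using (List; []; _∷_; _++_; map; foldr; concatMap; filter; upTo; cartesianProductWith; length; replicate;
      concat; zip; applyUpTo; allFin; mapMaybe; cartesianProduct)
import Data.List.Membership.DecPropositional as DecMembership
open import Data.List.Membership.Propositional using (_∈_; find; lose; _∉_)
import Data.List.Membership.Propositional.Properties as ∈ₚ
open import Data.List.Membership.Propositional.Properties.WithK using (unique∧set⇒bag)
import Data.List.Properties as Listₚ
open import Data.List.Relation.Binary.BagAndSetEquality using (∼bag⇒↭)
open import Data.List.Relation.Binary.Permutation.Propositional using (_↭_)
import Data.List.Relation.Binary.Permutation.Propositional.Properties as ↭ₚ
import Data.List.Relation.Unary.All as All
import Data.List.Relation.Unary.All.Properties as Allₚ
open import Data.List.Relation.Unary.Any using (here; there)
open import Data.List.Relation.Unary.Unique.Propositional using (Unique)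
import Data.List.Relation.Unary.Unique.Propositional.Properties as Uniqueₚ
open import Data.Maybe.Base using (Maybe; just; nothing)
import Data.Nat.ListAction as ListSum
import Data.Nat.Properties as ℕₚ
open import Data.Nat.Tactic.RingSolver using (solve-∀)
open import Data.Product.Base using (_×_; _,_; proj₁; proj₂; Σ-syntax; ∃; Σ)
open import Data.Sum.Base using (inj₁; inj₂)
open import Data.Unit.Base using (⊤; tt)
open import Data.Vec.Base as Vec using (Vec; []; _∷_)
import Data.Vec.Properties as Vecₚ
open import Function.Base using (_∘_; id; _$_)
open import Function.Bundles using (mk⇔)
open import Level using (0ℓ)
open import Relation.Binary.Definitions using (tri<; tri≈; tri>)
open import Relation.Binary.PropositionalEquality as ≡
  using (_≡_; _≢_; refl; sym; trans; cong; subst; cong₂; subst₂)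
open import Relation.Nullary using (yes; no; ¬?; Dec; _×-dec_; ¬_; does; recompute)
open import Relation.Nullary.Decidable using (map′; dec-true; dec-false)
open import Relation.Unary using (Decidable)

-- In a King tableau the letters of pair `j` fit only into the first `j` rows, so removing a pair
-- must also remove a row. With all shapes written in the same number of rows, the left side of the
-- symplectic rule then contains a shape with an empty bottom row, while on the right the growth
-- step must not push a box below the last row. These two boundary conditions do not correspond
-- under the bijections. Carried to the common chains around two shapes `ν` and `ρ`, the first says
-- that a box cannot be added at the bottom of both, the second that a box cannot be taken from the
-- bottom of both. Hence the excluded chains are matched rather than the two sides, and the sums
-- agree by cancellation in the ring. The shift keeps the degree because `ρ` gains the box that the
-- strip deleted from `μ` loses. On the Schur side the obstacle does not arise: a chain with fewer
-- steps than rows leaves the bottom row empty, and that row takes whatever growth pushes down.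

-- Enumerated predicates and bijective comparison of finite sums

module FiniteSums where

  open All using (All; []; _∷_)
  open import Data.List.Relation.Unary.AllPairs using ([]; _∷_)

  unique-map : ∀ {A B : Set} (f : A → B) {xs} → (∀ {a b} → a ∈ xs → b ∈ xs → f a ≡ f b → a ≡ b) →
               Unique xs → Unique (map f xs)
  unique-map f inj []         = []
  unique-map f inj (x∉ ∷ xs!) =
    Allₚ.map⁺ (All.tabulate λ b∈ eq → All.lookup x∉ b∈ (inj (here refl) (there b∈) eq))
    ∷ unique-map f (λ a∈ b∈ → inj (there a∈) (there b∈)) xs!

  -- Any two enumerations of a predicate are permutations of each other, so a sum over one depends
  -- on the predicate alone.
  record Enumeration {A : Set} (P : A → Set) : Set where
    field
      elements : List A
      unique   : Unique elements
      sound    : ∀ {a} → a ∈ elements → P a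
      complete : ∀ {a} → P a → a ∈ elements

  open Enumeration

  infix 4 _≅_
  -- The maps are total on the ambient types and inverse to each other only on the predicates. This
  -- keeps membership proofs out of the elements, so that the equations compare data alone.
  record _≅_ {A B : Set} (P : A → Set) (Q : B → Set) : Set where
    field
      to      : A → B
      from    : B → A
      to-∈    : ∀ {a} → P a → Q (to a)
      from-∈  : ∀ {b} → Q b → P (from b)
      from∘to : ∀ {a} → P a → from (to a) ≡ a
      to∘from : ∀ {b} → Q b → to (from b) ≡ b

  ≅-trans : ∀ {A B C : Set} {P : A → Set} {Q : B → Set} {R : C → Set} → P ≅ Q → Q ≅ R → P ≅ R
  ≅-trans i j = record
    { to      = J.to ∘ I.to
    ; from    = I.from ∘ J.from
    ; to-∈    = J.to-∈ ∘ I.to-∈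
    ; from-∈  = I.from-∈ ∘ J.from-∈
    ; from∘to = λ p → trans (cong I.from (J.from∘to (I.to-∈ p))) (I.from∘to p)
    ; to∘from = λ r → trans (cong J.to (I.to∘from (J.from-∈ r))) (J.to∘from r)
    }
    where module I = _≅_ i
          module J = _≅_ j

  ⇔⇒≅ : ∀ {A : Set} {P Q : A → Set} → (∀ {a} → P a → Q a) → (∀ {a} → Q a → P a) → P ≅ Q
  ⇔⇒≅ f g = record { to = id ; from = id ; to-∈ = f ; from-∈ = g ; from∘to = λ _ → refl ; to∘from = λ _ →
      refl }

  transport : ∀ {A B : Set} {P : A → Set} {Q : B → Set} → P ≅ Q → Enumeration P → Enumeration Q
  transport {Q = Q} i e = record
    { elements = map to (elements e)
    ; unique   = unique-map to
        (λ a∈ b∈ eq → trans (sym (from∘to (sound e a∈))) (trans (cong from eq) (from∘to (sound e b∈))))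
        (unique e)
    ; sound    = λ b∈ → let (a , a∈ , b≡) = ∈ₚ.∈-map⁻ to b∈ in subst Q (sym b≡) (to-∈ (sound e a∈))
    ; complete = λ q → subst (_∈ _) (to∘from q) (∈ₚ.∈-map⁺ to (complete e (from-∈ q)))
    }
    where open _≅_ i

  filterEnum : ∀ {A : Set} {P : A → Set} (xs : List A) → Unique xs → Decidable P →
               (∀ {a} → P a → a ∈ xs) → Enumeration P
  filterEnum xs xs! P? P⊆xs = record
    { elements = filter P? xs
    ; unique   = Uniqueₚ.filter⁺ P? xs!
    ; sound    = λ a∈ → proj₂ (∈ₚ.∈-filter⁻ P? {xs = xs} a∈)
    ; complete = λ p → ∈ₚ.∈-filter⁺ P? (P⊆xs p) p
    }

  restrict : ∀ {A : Set} {P Q : A → Set} → Enumeration P → Decidable Q → Enumeration (λ a → P a × Q a)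
  restrict e Q? = record
    { elements = filter Q? (elements e)
    ; unique   = Uniqueₚ.filter⁺ Q? (unique e)
    ; sound    = λ a∈ → let (a∈e , q) = ∈ₚ.∈-filter⁻ Q? {xs = elements e} a∈ in sound e a∈e , q
    ; complete = λ (p , q) → ∈ₚ.∈-filter⁺ Q? (complete e p) q
    }

  unique-↭ : ∀ {A : Set} {xs ys : List A} → Unique xs → Unique ys →
             (∀ {a} → a ∈ xs → a ∈ ys) → (∀ {a} → a ∈ ys → a ∈ xs) → xs ↭ ys
  unique-↭ xs! ys! ⊆ ⊇ = ∼bag⇒↭ (unique∧set⇒bag xs! ys! (mk⇔ ⊆ ⊇))

  elements-↭ : ∀ {A : Set} {P : A → Set} (e e′ : Enumeration P) → elements e ↭ elements e′
  elements-↭ e e′ = unique-↭ (unique e) (unique e′) (complete e′ ∘ sound e) (complete e ∘ sound e′)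

  unique-concatMap : ∀ {A B : Set} (f : A → List B) {xs} → Unique xs → (∀ a → Unique (f a)) →
                     (∀ {a a′ b} → b ∈ f a → b ∈ f a′ → a ≡ a′) → Unique (concatMap f xs)
  unique-concatMap f []         f! disjoint = []
  unique-concatMap f (x∉ ∷ xs!) f! disjoint = Uniqueₚ.++⁺ (f! _) (unique-concatMap f xs! f! disjoint)
    λ (v∈ , w∈) → let (_ , a∈ , v∈a) = find (∈ₚ.∈-concatMap⁻ f w∈) in All.lookup x∉ a∈ (disjoint v∈ v∈a)

  infixr 4 _⊗_
  -- The fibres are enumerated over every `a`, so that no proof of `P a` enters the data.
  _⊗_ : ∀ {A B : Set} {P : A → Set} {Q : A → B → Set} → Enumeration P → (∀ a → Enumeration (Q a)) →
        Enumeration (λ (a , b) → P a × Q a b)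
  _⊗_ {P = P} {Q} e e′ = record
    { elements = concatMap (λ a → map (a ,_) (elements (e′ a))) (elements e)
    ; unique   = unique-concatMap _ (unique e) (λ a → Uniqueₚ.map⁺ (cong proj₂) (unique (e′ a))) λ {a} {a′}
        b∈ b∈′ →
        let (_ , _ , eq) = ∈ₚ.∈-map⁻ (a ,_) b∈
            (_ , _ , eq′) = ∈ₚ.∈-map⁻ (a′ ,_) b∈′
        in cong proj₁ (trans (sym eq) eq′)
    ; sound    = λ {ab} ab∈ →
        let (a , a∈ , ab∈a) = find (∈ₚ.∈-concatMap⁻ (λ a → map (a ,_) (elements (e′ a))) {elements e} ab∈)
            (b , b∈ , ab≡) = ∈ₚ.∈-map⁻ (a ,_) ab∈a
        in subst (λ (a , b) → P a × Q a b) (sym ab≡) (sound e a∈ , sound (e′ a) b∈)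
    ; complete = λ {(a , b)} (p , q) →
        ∈ₚ.∈-concatMap⁺ (λ a → map (a ,_) (elements (e′ a)))
          (lose (complete e p) (∈ₚ.∈-map⁺ (a ,_) (complete (e′ a) q)))
    }

  module Sums (R : CommutativeRing 0ℓ 0ℓ) where
    open CommutativeRing R renaming (refl to ≈-refl; sym to ≈-sym; trans to ≈-trans; reflexive to ≈-reflexive)
    open ListOps rawRing public
    open import Algebra.Properties.AbelianGroup +-abelianGroup using (∙-cancelˡ)
    open import Algebra.Properties.CommutativeSemigroup +-commutativeSemigroup using () renaming
        (x∙yz≈y∙xz to x+yz≈y+xz)
    open import Relation.Binary.Reasoning.Setoid setoid

    ∑-cong : ∀ {A : Set} (xs : List A) {f g : A → Carrier} → (∀ {a} → a ∈ xs → f a ≈ g a) → ∑ xs f ≈ ∑ xs g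
    ∑-cong []       f≈g = ≈-refl
    ∑-cong (x ∷ xs) f≈g = +-cong (f≈g (here refl)) (∑-cong xs (f≈g ∘ there))

    ∑-zero : ∀ {A : Set} (xs : List A) {f : A → Carrier} → (∀ {a} → a ∈ xs → f a ≈ 0#) → ∑ xs f ≈ 0#
    ∑-zero []       f≈0 = ≈-refl
    ∑-zero (x ∷ xs) f≈0 = ≈-trans (+-cong (f≈0 (here refl)) (∑-zero xs (f≈0 ∘ there))) (+-identityˡ 0#)

    ∑-↭ : ∀ {A : Set} {xs ys : List A} (f : A → Carrier) → xs ↭ ys → ∑ xs f ≈ ∑ ys f
    ∑-↭ f _↭_.refl         = ≈-refl
    ∑-↭ f (_↭_.prep x p)   = +-congˡ (∑-↭ f p)
    ∑-↭ f (_↭_.swap x y p) = ≈-trans (x+yz≈y+xz _ _ _) (+-congˡ (+-congˡ (∑-↭ f p)))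
    ∑-↭ f (_↭_.trans p q)  = ≈-trans (∑-↭ f p) (∑-↭ f q)

    ∑-map : ∀ {A B : Set} (h : A → B) (xs : List A) (f : B → Carrier) → ∑ (map h xs) f ≡ ∑ xs (f ∘ h)
    ∑-map h xs f = cong (foldr _+_ 0#) (sym (Listₚ.map-∘ xs))

    ∑-++ : ∀ {A : Set} (xs ys : List A) (f : A → Carrier) → ∑ (xs ++ ys) f ≈ ∑ xs f + ∑ ys f
    ∑-++ []       ys f = ≈-sym (+-identityˡ _)
    ∑-++ (x ∷ xs) ys f = ≈-trans (+-congˡ (∑-++ xs ys f)) (≈-sym (+-assoc _ _ _))

    ∑-concatMap : ∀ {A B : Set} (h : A → List B) (xs : List A) (f : B → Carrier) →
                  ∑ (concatMap h xs) f ≈ ∑ xs (λ a → ∑ (h a) f)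
    ∑-concatMap h []       f = ≈-refl
    ∑-concatMap h (x ∷ xs) f = ≈-trans (∑-++ (h x) (concatMap h xs) f) (+-congˡ (∑-concatMap h xs f))

    ∑-*ˡ : ∀ {A : Set} (xs : List A) (c : Carrier) (f : A → Carrier) → c * ∑ xs f ≈ ∑ xs (λ a → c * f a)
    ∑-*ˡ []       c f = zeroʳ c
    ∑-*ˡ (x ∷ xs) c f = ≈-trans (distribˡ c _ _) (+-congˡ (∑-*ˡ xs c f))

    ∑-*ʳ : ∀ {A : Set} (xs : List A) (c : Carrier) (f : A → Carrier) → ∑ xs f * c ≈ ∑ xs (λ a → f a * c)
    ∑-*ʳ xs c f = ≈-trans (*-comm _ c) (≈-trans (∑-*ˡ xs c f) (∑-cong xs λ _ → *-comm c _))

    ∑-single : ∀ {A : Set} {xs : List A} {a} (f : A → Carrier) → Unique xs → a ∈ xs →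
               (∀ {b} → b ∈ xs → b ≢ a → f b ≈ 0#) → ∑ xs f ≈ f a
    ∑-single f (x∉ ∷ xs!) (here refl) f≈0 = ≈-trans
      (+-congˡ (∑-zero _ λ b∈ → f≈0 (there b∈) λ { refl → All.lookup x∉ b∈ refl })) (+-identityʳ _)
    ∑-single f (x∉ ∷ xs!) (there a∈) f≈0 = ≈-trans
      (+-cong (f≈0 (here refl) (All.lookup x∉ a∈)) (∑-single f xs! a∈ (f≈0 ∘ there))) (+-identityˡ _)

    ∑-filter : ∀ {A : Set} {Q : A → Set} (Q? : Decidable Q) (xs : List A) (f : A → Carrier) →
               ∑ xs f ≈ ∑ (filter Q? xs) f + ∑ (filter (¬? ∘ Q?) xs) f
    ∑-filter Q? []       f = ≈-sym (+-identityˡ 0#)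
    ∑-filter Q? (x ∷ xs) f with Q? x
    ... | yes _ = ≈-trans (+-congˡ (∑-filter Q? xs f)) (≈-sym (+-assoc _ _ _))
    ... | no _  = ≈-trans (+-congˡ (∑-filter Q? xs f)) (x+yz≈y+xz _ _ _)

    ∑-≅ : ∀ {A B : Set} {P : A → Set} {Q : B → Set} (i : P ≅ Q) (e : Enumeration P) (e′ : Enumeration Q)
          {f : A → Carrier} {g : B → Carrier} → (∀ {a} → P a → f a ≈ g (_≅_.to i a)) →
          ∑ (elements e) f ≈ ∑ (elements e′) g
    ∑-≅ i e e′ {f} {g} f≈g = begin
      ∑ (elements e) f               ≈⟨ ∑-cong (elements e) (f≈g ∘ sound e) ⟩
      ∑ (elements e) (g ∘ to)        ≡⟨ ∑-map to (elements e) g ⟨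
      ∑ (elements (transport i e)) g ≈⟨ ∑-↭ g (elements-↭ (transport i e) e′) ⟩
      ∑ (elements e′) g              ∎
      where open _≅_ i

    ∑-⊗ : ∀ {A B : Set} {P : A → Set} {Q : A → B → Set} (e : Enumeration P) (e′ : ∀ a → Enumeration (Q a))
          (f : A × B → Carrier) →
          ∑ (elements (e ⊗ e′)) f ≈ ∑ (elements e) (λ a → ∑ (elements (e′ a)) (λ b → f (a , b)))
    ∑-⊗ e e′ f = ≈-trans (∑-concatMap _ (elements e) f)
      (∑-cong (elements e) λ {a} _ → ≈-reflexive (∑-map (a ,_) (elements (e′ a)) f))

    ∑-*-∑ : ∀ {A B : Set} (xs : List A) (ys : List B) (f : A → Carrier) (g : B → Carrier) →
            ∑ xs f * ∑ ys g ≈ ∑ xs (λ a → ∑ ys (λ b → f a * g b))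
    ∑-*-∑ xs ys f g = ≈-trans (∑-*ʳ xs (∑ ys g) f) (∑-cong xs λ _ → ∑-*ˡ ys _ g)

    -- Together with the equal sums over `B₁` and `B₂`, both sides make up the sum over `P`.
    -- Additive cancellation then suffices, and no bijection between the complements has to be
    -- exhibited.
    ∑-exchange : ∀ {A : Set} {P : A → Set} (e : Enumeration P) {B₁ B₂ : A → Set}
                 (B₁? : Decidable B₁) (B₂? : Decidable B₂) (f : A → Carrier) →
                 (i : (λ a → P a × B₁ a) ≅ (λ a → P a × B₂ a)) → (∀ {a} → P a × B₁ a → f a ≈ f (_≅_.to i a)) →
                 ∑ (elements (restrict e (¬? ∘ B₁?))) f ≈ ∑ (elements (restrict e (¬? ∘ B₂?))) f
    ∑-exchange e B₁? B₂? f i f≈ = ∙-cancelˡ (∑ (elements (restrict e B₁?)) f) _ _ (begin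
      ∑ (elements (restrict e B₁?)) f + ∑ (elements (restrict e (¬? ∘ B₁?))) f ≈⟨ ∑-filter B₁? (elements e)
        f ⟨
      ∑ (elements e) f                                                     ≈⟨ ∑-filter B₂? (elements e) f ⟩
      ∑ (elements (restrict e B₂?)) f + ∑ (elements (restrict e (¬? ∘ B₂?))) f
        ≈⟨ +-congʳ (∑-≅ i (restrict e B₁?) (restrict e B₂?) f≈) ⟨
      ∑ (elements (restrict e B₁?)) f + ∑ (elements (restrict e (¬? ∘ B₂?))) f ∎)

-- Interlacing shapes, RSK growth and Bender-Knuth moves

module Interlacing where

  open import Data.Nat.Base hiding (_/_)
  open FiniteSums

  head₀ : ∀ {n} → Vec ℕ n → ℕ
  head₀ []      = 0
  head₀ (a ∷ _) = a

  bottom : ∀ {n} → Vec ℕ (suc n) → ℕ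
  bottom (a ∷ [])        = a
  bottom (_ ∷ α@(_ ∷ _)) = bottom α

  mapBottom : (ℕ → ℕ) → ∀ {n} → Vec ℕ (suc n) → Vec ℕ (suc n)
  mapBottom f (a ∷ [])        = f a ∷ []
  mapBottom f (a ∷ α@(_ ∷ _)) = a ∷ mapBottom f α

  inc dec : ∀ {n} → Vec ℕ (suc n) → Vec ℕ (suc n)
  inc = mapBottom suc
  dec = mapBottom pred

  -- u ≥ γ₁ ≥ α₁ ≥ γ₂ ≥ α₂ ≥ ⋯
  data Interlace (u : ℕ) : ∀ {n} → Vec ℕ n → Vec ℕ n → Set where
    []   : Interlace u [] []
    cons : ∀ {n a g} {α γ : Vec ℕ n} → a ≤ g → g ≤ u → Interlace a α γ → Interlace u (a ∷ α) (g ∷ γ)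

  infix 4 _≺_
  -- A bound equal to the top row imposes nothing. What remains says that `γ` over `α` is a
  -- horizontal strip.
  _≺_ : ∀ {n} → Vec ℕ n → Vec ℕ n → Set
  α ≺ γ = Interlace (head₀ γ) α γ

  interlace? : ∀ u {n} (α γ : Vec ℕ n) → Dec (Interlace u α γ)
  interlace? u []      []      = yes []
  interlace? u (a ∷ α) (g ∷ γ) =
    map′ (λ (p , q , r) → cons p q r) (λ { (cons p q r) → p , q , r })
         (a ℕₚ.≤? g ×-dec g ℕₚ.≤? u ×-dec interlace? a α γ)

  _≺?_ : ∀ {n} (α γ : Vec ℕ n) → Dec (α ≺ γ)
  α ≺? γ = interlace? (head₀ γ) α γ

  rebound : ∀ {u w n} {α γ : Vec ℕ n} → Interlace u α γ → head₀ γ ≤ w → Interlace w α γ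
  rebound []           _  = []
  rebound (cons p _ r) ≤w = cons p ≤w r

  unbound : ∀ {u n} {α γ : Vec ℕ n} → Interlace u α γ → α ≺ γ
  unbound i = rebound i ℕₚ.≤-refl

  interlace-head : ∀ {u n} {α γ : Vec ℕ n} → Interlace u α γ → head₀ γ ≤ u
  interlace-head []           = z≤n
  interlace-head (cons _ q _) = q

  interlace-head′ : ∀ {u n} {α γ : Vec ℕ n} → Interlace u α γ → head₀ α ≤ head₀ γ
  interlace-head′ []           = z≤n
  interlace-head′ (cons p _ _) = p

  interlace-sum : ∀ {u n} {α γ : Vec ℕ n} → Interlace u α γ → Vec.sum α ≤ Vec.sum γ
  interlace-sum []           = z≤n
  interlace-sum (cons p _ r) = ℕₚ.+-mono-≤ p (interlace-sum r)

  interlace-bottom : ∀ {u n} {α γ : Vec ℕ (suc n)} → Interlace u α γ → bottom α ≤ bottom γ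
  interlace-bottom (cons p _ [])             = p
  interlace-bottom (cons _ _ r@(cons _ _ _)) = interlace-bottom r

  bottom-mapBottom : ∀ f {n} (α : Vec ℕ (suc n)) → bottom (mapBottom f α) ≡ f (bottom α)
  bottom-mapBottom f (a ∷ [])            = refl
  bottom-mapBottom f (a ∷ b ∷ [])        = refl
  bottom-mapBottom f (a ∷ α@(_ ∷ _ ∷ _)) = bottom-mapBottom f α

  sum-inc : ∀ {n} (α : Vec ℕ (suc n)) → Vec.sum (inc α) ≡ suc (Vec.sum α)
  sum-inc (a ∷ [])        = refl
  sum-inc (a ∷ α@(_ ∷ _)) = trans (cong (a +_) (sum-inc α)) (ℕₚ.+-suc a _)

  dec-inc : ∀ {n} (α : Vec ℕ (suc n)) → dec (inc α) ≡ α
  dec-inc (a ∷ [])            = refl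
  dec-inc (a ∷ b ∷ [])        = refl
  dec-inc (a ∷ α@(_ ∷ _ ∷ _)) = cong (a ∷_) (dec-inc α)

  inc-dec : ∀ {n} (α : Vec ℕ (suc n)) → 0 < bottom α → inc (dec α) ≡ α
  inc-dec (suc a ∷ [])        _ = refl
  inc-dec (a ∷ suc b ∷ [])    _ = refl
  inc-dec (a ∷ α@(_ ∷ _ ∷ _)) p = cong (a ∷_) (inc-dec α p)

  interlace-decʳ : ∀ {u n} {α γ : Vec ℕ (suc n)} → Interlace u α γ → bottom α < bottom γ → Interlace u α
      (dec γ)
  interlace-decʳ (cons p q [])                   (s≤s lt) = cons lt (ℕₚ.≤-trans (ℕₚ.n≤1+n _) q) []
  interlace-decʳ (cons p q r@(cons _ _ [])) lt = cons p q (interlace-decʳ r lt)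
  interlace-decʳ (cons p q r@(cons _ _ (cons _ _ _))) lt = cons p q (interlace-decʳ r lt)

  interlace-decˡ : ∀ {u n} {α γ : Vec ℕ (suc n)} → Interlace u α γ → Interlace u (dec α) γ
  interlace-decˡ (cons p q [])                        = cons (ℕₚ.≤-trans ℕₚ.pred[n]≤n p) q []
  interlace-decˡ (cons p q r@(cons _ _ []))           = cons p q (interlace-decˡ r)
  interlace-decˡ (cons p q r@(cons _ _ (cons _ _ _))) = cons p q (interlace-decˡ r)

  interlace-incˡ : ∀ {u n} {α γ : Vec ℕ (suc n)} → Interlace u α γ → bottom α < bottom γ → Interlace u
      (inc α) γ
  interlace-incˡ (cons p q [])                        lt = cons lt q []
  interlace-incˡ (cons p q r@(cons _ _ []))           lt = cons p q (interlace-incˡ r lt)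
  interlace-incˡ (cons p q r@(cons _ _ (cons _ _ _))) lt = cons p q (interlace-incˡ r lt)

  ⊔+⊓ : ∀ a b → a ⊔ b + a ⊓ b ≡ a + b
  ⊔+⊓ zero    b       = ℕₚ.+-identityʳ b
  ⊔+⊓ (suc a) zero    = refl
  ⊔+⊓ (suc a) (suc b) = cong suc (trans (ℕₚ.+-suc _ _) (trans (cong suc (⊔+⊓ a b)) (sym (ℕₚ.+-suc a b))))

  -- The growth rule of RSK: the reflection of δᵢ in the interval [αᵢ₊₁ ⊔ βᵢ₊₁ , αᵢ ⊓ βᵢ] is row i+1 of the
  -- new shape, and c is the free excess of its top row.
  grow : ∀ {n} → ℕ → (α β δ : Vec ℕ n) → Vec ℕ n
  grow c []      []      []      = []
  grow c (a ∷ α) (b ∷ β) (d ∷ δ) = (a ⊔ b) + c ∷ grow (a ⊓ b ∸ d) α β δ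

  -- The top row of `grow` is the maximum plus `c`, so this recovers `c`. Applied to the rows below,
  -- it recovers the offset `a ⊓ b ∸ d` handed down by the row above.
  excess : ∀ {n} → (α β γ : Vec ℕ n) → ℕ
  excess []      []      []      = 0
  excess (a ∷ _) (b ∷ _) (g ∷ _) = g ∸ (a ⊔ b)

  shrink : ∀ {n} → (α β γ : Vec ℕ n) → Vec ℕ n
  shrink []      []      []      = []
  shrink (a ∷ α) (b ∷ β) (g ∷ γ) = a ⊓ b ∸ excess α β γ ∷ shrink α β γ

  -- No excess is left below the bottom row.
  Closed : ∀ {n} → ℕ → (α β δ : Vec ℕ n) → Set
  Closed c []      []      []      = c ≡ 0
  Closed c (a ∷ α) (b ∷ β) (d ∷ δ) = Closed (a ⊓ b ∸ d) α β δ

  -- With at least one row, the excess that leaves the shape is the offset `a ⊓ b ∸ d` of its bottom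
  -- row.
  closed⁺ : ∀ c {n} (α β δ : Vec ℕ (suc n)) → bottom δ ≡ bottom α ⊓ bottom β → Closed c α β δ
  closed⁺ c (a ∷ [])        (b ∷ [])        (d ∷ [])        refl = ℕₚ.n∸n≡0 (a ⊓ b)
  closed⁺ c (a ∷ α@(_ ∷ _)) (b ∷ β@(_ ∷ _)) (d ∷ δ@(_ ∷ _)) eq   = closed⁺ (a ⊓ b ∸ d) α β δ eq

  closed⁻ : ∀ {u w} c {n} {α β δ : Vec ℕ (suc n)} → Interlace u δ α → Interlace w δ β →
            Closed c α β δ → bottom δ ≡ bottom α ⊓ bottom β
  closed⁻ c (cons p _ []) (cons q _ []) eq = ℕₚ.≤-antisym (ℕₚ.⊓-glb p q) (ℕₚ.m∸n≡0⇒m≤n eq)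
  closed⁻ c {α = a ∷ _} {b ∷ _} {d ∷ _} (cons _ _ i@(cons _ _ _)) (cons _ _ j@(cons _ _ _)) cl = closed⁻
      (a ⊓ b ∸ d) i j cl

  -- In the recursion `d` is the row of `δ` above and `c` its offset, so `d + c` is the minimum of
  -- the rows of `α` and `β` above. Both current rows are at most `d`, hence the new row is at most
  -- `d + c` and respects both bounds.
  grow-interlace : ∀ {u w d c n} {α β δ : Vec ℕ n} → d + c ≤ u → d + c ≤ w →
                   Interlace d δ α → Interlace d δ β →
                   Interlace u α (grow c α β δ) × Interlace w β (grow c α β δ)
  grow-interlace ≤u ≤w [] [] = [] , []
  grow-interlace {c = c} {α = a ∷ α} {b ∷ β} {d ∷ δ} ≤u ≤w (cons p q i) (cons p′ q′ j) =
    let d≤ = ℕₚ.⊓-glb p p′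
        ≡m = ℕₚ.m+[n∸m]≡n d≤
        (r , s) = grow-interlace (ℕₚ.≤-trans (ℕₚ.≤-reflexive ≡m) (ℕₚ.m⊓n≤m a b))
                                 (ℕₚ.≤-trans (ℕₚ.≤-reflexive ≡m) (ℕₚ.m⊓n≤n a b)) i j
        g≤ = ℕₚ.+-monoˡ-≤ c (ℕₚ.⊔-lub q q′)
    in cons (ℕₚ.≤-trans (ℕₚ.m≤m⊔n a b) (ℕₚ.m≤m+n _ c)) (ℕₚ.≤-trans g≤ ≤u) r
     , cons (ℕₚ.≤-trans (ℕₚ.m≤n⊔m a b) (ℕₚ.m≤m+n _ c)) (ℕₚ.≤-trans g≤ ≤w) s

  excess-grow : ∀ c {n} (α β δ : Vec ℕ n) → Closed c α β δ → excess α β (grow c α β δ) ≡ c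
  excess-grow c []      []      []      cl = sym cl
  excess-grow c (a ∷ α) (b ∷ β) (d ∷ δ) cl = ℕₚ.m+n∸m≡n (a ⊔ b) c

  shrink-grow : ∀ {u w} c {n} {α β δ : Vec ℕ n} → Interlace u δ α → Interlace w δ β → Closed c α β δ →
                shrink α β (grow c α β δ) ≡ δ
  shrink-grow c []                               []             cl = refl
  shrink-grow c {α = a ∷ α} {b ∷ β} {d ∷ δ} (cons p q i) (cons p′ q′ j) cl = cong₂ _∷_
    (trans (cong (a ⊓ b ∸_) (excess-grow _ α β δ cl)) (ℕₚ.m∸[m∸n]≡n (ℕₚ.⊓-glb p p′)))
    (shrink-grow _ i j cl)

  excess≤ : ∀ {u w n} {α β γ : Vec ℕ n} → Interlace u α γ → Interlace w β γ → excess α β γ ≤ u ⊓ w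
  excess≤ []                               []                       = z≤n
  excess≤ (cons {a = a} {g} _ q _) (cons {a = b} _ q′ _) = ℕₚ.≤-trans (ℕₚ.m∸n≤m g (a ⊔ b)) (ℕₚ.⊓-glb q q′)

  grow-shrink : ∀ {u w n} {α β γ : Vec ℕ n} → Interlace u α γ → Interlace w β γ →
                grow (excess α β γ) α β (shrink α β γ) ≡ γ
  grow-shrink [] [] = refl
  grow-shrink {α = a ∷ α} {b ∷ β} {g ∷ γ} (cons p q i) (cons p′ q′ j) = cong₂ _∷_
    (ℕₚ.m+[n∸m]≡n (ℕₚ.⊔-lub p p′))
    (trans (cong (λ c → grow c α β (shrink α β γ)) (ℕₚ.m∸[m∸n]≡n (excess≤ i j)))
           (grow-shrink i j))

  closed-shrink : ∀ {u w n} {α β γ : Vec ℕ n} → Interlace u α γ → Interlace w β γ →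
                  Closed (excess α β γ) α β (shrink α β γ)
  closed-shrink [] [] = refl
  closed-shrink {α = a ∷ α} {b ∷ β} {g ∷ γ} (cons p q i) (cons p′ q′ j) =
    subst (λ c → Closed c α β (shrink α β γ))
      (sym (ℕₚ.m∸[m∸n]≡n (excess≤ i j))) (closed-shrink i j)

  shrink-interlace : ∀ {u w d n} {α β γ : Vec ℕ n} → head₀ α ≤ d → head₀ β ≤ d →
                     Interlace u α γ → Interlace w β γ →
                     Interlace d (shrink α β γ) α × Interlace d (shrink α β γ) β
  shrink-interlace α≤ β≤ [] [] = [] , []
  shrink-interlace {α = a ∷ α} {b ∷ β} {g ∷ γ} α≤ β≤ (cons p q i) (cons p′ q′ j) =
    let (r , s) = shrink-interlace (≤d i j (ℕₚ.m≤m⊔n _ _)) (≤d i j (ℕₚ.m≤n⊔m (head₀ α) _)) i j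
        d≤ = ℕₚ.m∸n≤m (a ⊓ b) (excess α β γ)
    in cons (ℕₚ.≤-trans d≤ (ℕₚ.m⊓n≤m a b)) α≤ r , cons (ℕₚ.≤-trans d≤ (ℕₚ.m⊓n≤n a b)) β≤ s
    where
    -- Reflection exchanges the ends of the interval: the next row `g` of `γ` is at most `a ⊓ b`, so
    -- the reflected row is at least `a′ ⊔ b′`.
    ≤d : ∀ {n} {α β γ : Vec ℕ n} {x} → Interlace a α γ → Interlace b β γ → x ≤ head₀ α ⊔ head₀ β →
         x ≤ a ⊓ b ∸ excess α β γ
    ≤d []           []             x≤ = ℕₚ.≤-trans x≤ z≤n
    ≤d {α = a′ ∷ _} {b′ ∷ _} {g ∷ _} (cons p q _) (cons p′ q′ _) x≤ = ℕₚ.≤-trans x≤ (begin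
      a′ ⊔ b′                    ≡⟨ ℕₚ.m∸[m∸n]≡n {g} {a′ ⊔ b′} (ℕₚ.⊔-lub p p′) ⟨
      g ∸ (g ∸ (a′ ⊔ b′))        ≤⟨ ℕₚ.∸-monoˡ-≤ (g ∸ (a′ ⊔ b′)) (ℕₚ.⊓-glb q q′) ⟩
      a ⊓ b ∸ (g ∸ (a′ ⊔ b′))    ∎)
      where open ℕₚ.≤-Reasoning

  -- In each row maximum and minimum add up to the sum, and the offset handed to the next row
  -- together with `d` is the minimum. `Closed` says that nothing is handed out of the last row.
  sum-grow : ∀ {u w} c {n} {α β δ : Vec ℕ n} → Interlace u δ α → Interlace w δ β → Closed c α β δ →
             Vec.sum (grow c α β δ) + Vec.sum δ ≡ Vec.sum α + Vec.sum β + c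
  sum-grow c [] [] refl = refl
  sum-grow c {α = a ∷ α} {b ∷ β} {d ∷ δ} (cons p q i) (cons p′ q′ j) cl = begin
    a ⊔ b + c + G + (d + D)      ≡⟨ regroup (a ⊔ b) c G d D ⟩
    a ⊔ b + c + d + (G + D)      ≡⟨ cong (a ⊔ b + c + d +_) (sum-grow _ i j cl) ⟩
    a ⊔ b + c + d + (A + B + (a ⊓ b ∸ d))      ≡⟨ regroup₂ (a ⊔ b) c d A B (a ⊓ b ∸ d) ⟩
    (a ⊔ b + (d + (a ⊓ b ∸ d))) + (A + B + c)  ≡⟨ cong (λ m → a ⊔ b + m + (A + B + c))
        (ℕₚ.m+[n∸m]≡n (ℕₚ.⊓-glb p p′)) ⟩
    (a ⊔ b + a ⊓ b) + (A + B + c)  ≡⟨ cong (_+ (A + B + c)) (⊔+⊓ a b) ⟩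
    (a + b) + (A + B + c)        ≡⟨ regroup₃ a b A B c ⟩
    a + A + (b + B) + c          ∎
    where
    open ≡.≡-Reasoning
    G = Vec.sum (grow (a ⊓ b ∸ d) α β δ)
    D = Vec.sum δ
    A = Vec.sum α
    B = Vec.sum β
    regroup : ∀ m c G d D → m + c + G + (d + D) ≡ m + c + d + (G + D)
    regroup = solve-∀
    regroup₂ : ∀ m c d A B e → m + c + d + (A + B + e) ≡ (m + (d + e)) + (A + B + c)
    regroup₂ = solve-∀
    regroup₃ : ∀ a b A B c → (a + b) + (A + B + c) ≡ a + A + (b + B) + c
    regroup₃ = solve-∀

  -- One square of a growth diagram: for fixed neighbours `α` and `β`, the lower corner and a number
  -- are traded for the upper corner. `Closed` marks the inputs that create no further row.
  growth : ∀ {n} (α β : Vec ℕ n) →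
           (λ (c , δ) → δ ≺ α × δ ≺ β × Closed c α β δ) ≅ (λ γ → α ≺ γ × β ≺ γ)
  growth α β = record
    { to      = λ (c , δ) → grow c α β δ
    ; from    = λ γ → excess α β γ , shrink α β γ
    ; to-∈    = λ {(c , δ)} (i , j , _) →
        let (r , s) = grow-interlace {d = head₀ α ⊔ head₀ β} {c} ℕₚ.≤-refl ℕₚ.≤-refl
                        (rebound i (ℕₚ.m≤m⊔n _ _)) (rebound j (ℕₚ.m≤n⊔m (head₀ α) _))
        in unbound r , unbound s
    ; from-∈  = λ (i , j) →
        let (r , s) = shrink-interlace (ℕₚ.m≤m⊔n (head₀ α) (head₀ β)) (ℕₚ.m≤n⊔m (head₀ α) _) i j
        in unbound r , unbound s , closed-shrink i j
    ; from∘to = λ {(c , δ)} (i , j , cl) → cong₂ _,_ (excess-grow c α β δ cl) (shrink-grow c i j cl)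
    ; to∘from = λ (i , j) → grow-shrink i j
    }

  -- Since `α` ends in an empty row, the new bottom row is that of `β` moved up by `c`, and `c` also
  -- moves `d` to `u ⊓ w`. So one more box fits below `u ⊓ w` exactly when one more box of `β` fits
  -- below `d`. This needs the equation for `d + c`, where `grow-interlace` gets by with
  -- inequalities.
  grow-bottom : ∀ {u w d c n} {α β δ : Vec ℕ (suc n)} → d + c ≡ u ⊓ w → Interlace d δ α → Interlace d δ β →
                bottom α ≡ 0 → Interlace d δ (inc β) →
                Interlace u α (inc (grow c α β δ)) × Interlace w β (inc (grow c α β δ))
  grow-bottom {u} {w} {d} {c} {α = a ∷ []} {b ∷ []} {e ∷ []} d+c≡ (cons p q []) (cons p′ q′ []) refl
      (cons _ b<d []) =
    cons z≤n (ℕₚ.≤-trans ≤u⊓w (ℕₚ.m⊓n≤m u w)) [] ,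
    cons (ℕₚ.≤-trans (ℕₚ.m≤m+n b c) (ℕₚ.n≤1+n _)) (ℕₚ.≤-trans ≤u⊓w (ℕₚ.m⊓n≤n u w)) []
    where
    ≤u⊓w : suc (b + c) ≤ u ⊓ w
    ≤u⊓w = subst (suc b + c ≤_) d+c≡ (ℕₚ.+-monoˡ-≤ c b<d)
  grow-bottom {u} {w} {d} {c} {α = a ∷ _ ∷ _} {b ∷ _ ∷ _} {e ∷ _ ∷ _} d+c≡
              (cons p q i) (cons p′ q′ j) α≡0 (cons _ _ k) =
    let (r , s) = grow-bottom (ℕₚ.m+[n∸m]≡n (ℕₚ.⊓-glb p p′)) i j α≡0 k
        g≤ = ℕₚ.≤-trans (ℕₚ.+-monoˡ-≤ c (ℕₚ.⊔-lub q q′)) (ℕₚ.≤-reflexive d+c≡)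
    in cons (ℕₚ.≤-trans (ℕₚ.m≤m⊔n a b) (ℕₚ.m≤m+n _ c)) (ℕₚ.≤-trans g≤ (ℕₚ.m⊓n≤m u w)) r
     , cons (ℕₚ.≤-trans (ℕₚ.m≤n⊔m a b) (ℕₚ.m≤m+n _ c)) (ℕₚ.≤-trans g≤ (ℕₚ.m⊓n≤n u w)) s

  grow-bottom⁻ : ∀ {u w d c n} {α β δ : Vec ℕ (suc n)} → d + c ≡ u ⊓ w → Interlace d δ α → Interlace d δ β →
                 bottom α ≡ 0 → Interlace u α (inc (grow c α β δ)) → Interlace w β (inc (grow c α β δ)) →
                 Interlace d δ (inc β)
  grow-bottom⁻ {c = c} {α = a ∷ []} {b ∷ []} {e ∷ []} d+c≡ (cons p q []) (cons p′ q′ []) refl (cons _ ≤u [])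
      (cons _ ≤w []) =
    cons (ℕₚ.≤-trans p z≤n) (ℕₚ.+-cancelʳ-≤ c _ _ (ℕₚ.≤-trans (ℕₚ.⊓-glb ≤u ≤w) (ℕₚ.≤-reflexive (sym d+c≡))))
        []
  grow-bottom⁻ {α = a ∷ _ ∷ _} {b ∷ _ ∷ _} {e ∷ _ ∷ _} d+c≡
               (cons p q i) (cons p′ q′ j) α≡0 (cons _ _ k) (cons _ _ l) =
    cons p′ q′ (grow-bottom⁻ (ℕₚ.m+[n∸m]≡n (ℕₚ.⊓-glb p p′)) i j α≡0 k l)

  -- The Bender–Knuth involution: every row of τ is reflected in the interval [l , h] of the values that
  -- σ and ν allow, by t ↦ l + h ∸ t.
  toggle : ∀ {n} → ℕ → (σ τ ν : Vec ℕ n) → Vec ℕ n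
  toggle u []      []      []      = []
  toggle u (s ∷ σ) (t ∷ τ) (v ∷ ν) = (s ⊔ head₀ ν + v ⊓ u) ∸ t ∷ toggle s σ τ ν

  reflect-≥ : ∀ {l h t} → t ≤ h → l ≤ l + h ∸ t
  reflect-≥ {l} {h} {t} t≤h = ℕₚ.≤-trans (ℕₚ.m≤m+n l (h ∸ t)) (ℕₚ.≤-reflexive (sym (ℕₚ.+-∸-assoc l t≤h)))

  reflect-≤ : ∀ {l h t} → l ≤ t → l + h ∸ t ≤ h
  reflect-≤ {l} {h} {t} l≤t = ℕₚ.m≤n+o⇒m∸n≤o (l + h) t (ℕₚ.+-monoˡ-≤ h l≤t)

  toggle-interlace : ∀ {u w y n} {σ τ ν : Vec ℕ n} → head₀ ν ≤ y → Interlace u σ τ → Interlace w τ ν →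
                     Interlace u σ (toggle u σ τ ν) × Interlace y (toggle u σ τ ν) ν
  toggle-interlace ν≤ [] [] = [] , []
  toggle-interlace {u} {σ = s ∷ σ} {t ∷ τ} {v ∷ ν} ν≤ (cons p q i) (cons p′ q′ j) =
    let lo≤ = reflect-≥ (ℕₚ.⊓-glb p′ q)
        ≤hi = reflect-≤ (ℕₚ.⊔-lub p (interlace-head j))
        (r , k) = toggle-interlace (ℕₚ.≤-trans (ℕₚ.m≤n⊔m s (head₀ ν)) lo≤) i j
    in cons (ℕₚ.≤-trans (ℕₚ.m≤m⊔n s (head₀ ν)) lo≤) (ℕₚ.≤-trans ≤hi (ℕₚ.m⊓n≤n v u)) r
     , cons (ℕₚ.≤-trans ≤hi (ℕₚ.m⊓n≤m v u)) ν≤ k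

  toggle-involutive : ∀ {u w n} {σ τ ν : Vec ℕ n} → Interlace u σ τ → Interlace w τ ν →
                      toggle u σ (toggle u σ τ ν) ν ≡ τ
  toggle-involutive [] [] = refl
  toggle-involutive {u} {σ = s ∷ σ} {t ∷ τ} {v ∷ ν} (cons p q i) (cons p′ q′ j) = cong₂ _∷_
    (ℕₚ.m∸[m∸n]≡n (ℕₚ.≤-trans (ℕₚ.⊓-glb p′ q) (ℕₚ.m≤n+m _ (s ⊔ head₀ ν))))
    (toggle-involutive i j)

  -- The interval ends pair up across rows: the lower end of a row and the upper end of the next are
  -- maximum and minimum of the same two numbers. The terms with `head₀ ν` are what the telescoping
  -- leaves at the top.
  sum-toggle : ∀ {u w n} {σ τ ν : Vec ℕ n} → Interlace u σ τ → Interlace w τ ν →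
               Vec.sum τ + Vec.sum (toggle u σ τ ν) + head₀ ν ≡ Vec.sum σ + Vec.sum ν + head₀ ν ⊓ u
  sum-toggle [] [] = refl
  sum-toggle {u} {σ = s ∷ σ} {t ∷ τ} {v ∷ ν} (cons p q i) (cons p′ q′ j) =
    ℕₚ.+-cancelʳ-≡ (head₀ ν) _ _ (begin
    t + T + (L + H ∸ t + T′) + v + h    ≡⟨ regroup t T (L + H ∸ t) T′ v h ⟩
    (t + (L + H ∸ t)) + (T + T′ + h) + v
      ≡⟨ cong₂ (λ m n → m + n + v) (ℕₚ.m+[n∸m]≡n (ℕₚ.≤-trans (ℕₚ.⊓-glb p′ q) (ℕₚ.m≤n+m _ L)))
        (sum-toggle i j) ⟩
    (L + H) + (S + V + h ⊓ s) + v      ≡⟨ regroup₂ L H S V (h ⊓ s) v ⟩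
    (L + h ⊓ s) + H + S + V + v        ≡⟨ cong (λ m → m + H + S + V + v)
        (trans (cong (L +_) (ℕₚ.⊓-comm h s)) (⊔+⊓ s h)) ⟩
    (s + h) + H + S + V + v            ≡⟨ regroup₃ s h H S V v ⟩
    s + S + (v + V) + H + h            ∎)
    where
    open ≡.≡-Reasoning
    h = head₀ ν
    L = s ⊔ h
    H = v ⊓ u
    T = Vec.sum τ
    T′ = Vec.sum (toggle s σ τ ν)
    S = Vec.sum σ
    V = Vec.sum ν
    regroup : ∀ t T r T′ v h → t + T + (r + T′) + v + h ≡ (t + r) + (T + T′ + h) + v
    regroup = solve-∀
    regroup₂ : ∀ L H S V m v → (L + H) + (S + V + m) + v ≡ (L + m) + H + S + V + v
    regroup₂ = solve-∀
    regroup₃ : ∀ s h H S V v → (s + h) + H + S + V + v ≡ s + S + (v + V) + H + h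
    regroup₃ = solve-∀

  -- In the bottom row the lower end of the interval is the row of `σ` itself. Being above the lower
  -- end is reflected to being below the upper end, which is room for one more box under both upper
  -- constraints.
  toggle-bottom : ∀ {u w n} {σ τ ν : Vec ℕ (suc n)} → Interlace u σ τ → Interlace w τ ν → bottom σ < bottom
      τ →
                  bottom (toggle u σ τ ν) < bottom ν × Interlace u σ (inc (toggle u σ τ ν))
  toggle-bottom {u} {σ = s ∷ []} {t ∷ []} {v ∷ []} (cons p q []) (cons p′ q′ []) s<t =
    ℕₚ.≤-trans <hi (ℕₚ.m⊓n≤m v u) ,
    cons (ℕₚ.≤-trans (ℕₚ.m≤m⊔n s 0) (ℕₚ.m≤n⇒m≤1+n (reflect-≥ (ℕₚ.⊓-glb p′ q))))
        (ℕₚ.≤-trans <hi (ℕₚ.m⊓n≤n v u)) []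
    where
    <hi : s ⊔ 0 + v ⊓ u ∸ t < v ⊓ u
    <hi = ℕₚ.<-≤-trans (ℕₚ.∸-monoʳ-< (ℕₚ.≤-<-trans (ℕₚ.≤-reflexive (ℕₚ.⊔-identityʳ s)) s<t)
                         (ℕₚ.≤-trans (ℕₚ.⊓-glb p′ q) (ℕₚ.m≤n+m _ _)))
            (ℕₚ.≤-reflexive (ℕₚ.m+n∸m≡n (s ⊔ 0) (v ⊓ u)))
  toggle-bottom {u} {σ = s ∷ _ ∷ _} {t ∷ _ ∷ _} {v ∷ ν@(_ ∷ _)} (cons p q i) (cons p′ q′ j) s<t =
    let (r , k) = toggle-bottom i j s<t
    in r , cons (ℕₚ.≤-trans (ℕₚ.m≤m⊔n s (head₀ ν)) (reflect-≥ (ℕₚ.⊓-glb p′ q)))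
                (ℕₚ.≤-trans (reflect-≤ (ℕₚ.⊔-lub p (interlace-head j))) (ℕₚ.m⊓n≤n v u)) k

  toggle-bottom⁻ : ∀ {u w n} {σ τ ν : Vec ℕ (suc n)} → Interlace u σ τ → Interlace w τ ν →
                   bottom (toggle u σ τ ν) < bottom ν → Interlace u σ (inc (toggle u σ τ ν)) → bottom σ <
                       bottom τ
  toggle-bottom⁻ {u} {σ = s ∷ []} {t ∷ []} {v ∷ []} (cons p q []) (cons p′ q′ []) <v (cons _ <u []) =
    ℕₚ.≰⇒> λ t≤s → ℕₚ.<⇒≱ (ℕₚ.⊓-glb <v <u)
      (ℕₚ.≤-trans (ℕₚ.≤-reflexive (sym (ℕₚ.m+n∸m≡n (s ⊔ 0) (v ⊓ u))))
                  (ℕₚ.∸-monoʳ-≤ (s ⊔ 0 + v ⊓ u) (ℕₚ.≤-trans t≤s (ℕₚ.m≤m⊔n s 0))))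
  toggle-bottom⁻ {σ = s ∷ _ ∷ _} {t ∷ _ ∷ _} {v ∷ _ ∷ _} (cons p q i) (cons p′ q′ j) <v (cons _ _ k) =
    toggle-bottom⁻ i j <v k

  inc-head : ∀ {n} (α : Vec ℕ (suc n)) → head₀ α ≤ head₀ (inc α)
  inc-head (a ∷ [])    = ℕₚ.n≤1+n a
  inc-head (a ∷ _ ∷ _) = ℕₚ.≤-refl

  grow-raise : ∀ c {n} {α β δ : Vec ℕ (suc n)} → bottom α ≡ 0 → δ ≺ α → δ ≺ β → δ ≺ inc β →
               α ≺ inc (grow c α β δ) × β ≺ inc (grow c α β δ)
  grow-raise c {α = α} {β} α₀ i j k =
    -- There is no row above the top one, so a bound large enough for all the shapes acts as one.
    -- Taking `u` and `w` both equal to `d + c` gives the required equation.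
    let d = head₀ α ⊔ head₀ (inc β)
        ≤d = ℕₚ.m≤n⊔m (head₀ α) (head₀ (inc β))
        (r , s) = grow-bottom {d + c} {d + c} {d} {c} (sym (ℕₚ.⊓-idem (d + c)))
                    (rebound i (ℕₚ.m≤m⊔n _ _)) (rebound j (ℕₚ.≤-trans (inc-head β) ≤d)) α₀ (rebound k ≤d)
    in unbound r , unbound s

  grow-raise⁻ : ∀ c {n} {α β δ : Vec ℕ (suc n)} → bottom α ≡ 0 → δ ≺ α → δ ≺ β →
                α ≺ inc (grow c α β δ) → β ≺ inc (grow c α β δ) → δ ≺ inc β
  grow-raise⁻ c {α = α} {β} {δ} α₀ i j k l =
    let g = head₀ (inc (grow c α β δ))
        d = head₀ α ⊔ head₀ β ⊔ g
        ≤d = ℕₚ.m≤m⊔n (head₀ α ⊔ head₀ β) g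
        g≤ = ℕₚ.≤-trans (ℕₚ.m≤n⊔m (head₀ α ⊔ head₀ β) g) (ℕₚ.m≤m+n d c)
    in unbound (grow-bottom⁻ {d + c} {d + c} {d} {c} (sym (ℕₚ.⊓-idem (d + c)))
         (rebound i (ℕₚ.≤-trans (ℕₚ.m≤m⊔n _ _) ≤d)) (rebound j (ℕₚ.≤-trans (ℕₚ.m≤n⊔m (head₀ α) _) ≤d))
         α₀ (rebound k g≤) (rebound l g≤))

  -- The top row has no row of `σ` above it; the bound `head₀ ν` leaves `ν` as the only upper
  -- constraint there.
  flip : ∀ {n} (σ τ ν : Vec ℕ n) → Vec ℕ n
  flip σ τ ν = toggle (head₀ ν) σ τ ν

  flip-≺ : ∀ {n} {σ τ ν : Vec ℕ n} → σ ≺ τ → τ ≺ ν → σ ≺ flip σ τ ν × flip σ τ ν ≺ ν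
  flip-≺ i j = let (r , s) = toggle-interlace ℕₚ.≤-refl (rebound i (interlace-head′ j)) j in unbound r , s

  flip-involutive : ∀ {n} {σ τ ν : Vec ℕ n} → σ ≺ τ → τ ≺ ν → flip σ (flip σ τ ν) ν ≡ τ
  flip-involutive i j = toggle-involutive (rebound i (interlace-head′ j)) j

  sum-flip : ∀ {n} {σ τ ν : Vec ℕ n} → σ ≺ τ → τ ≺ ν → Vec.sum τ + Vec.sum (flip σ τ ν) ≡ Vec.sum σ
      + Vec.sum ν
  sum-flip {σ = σ} {τ} {ν} i j = ℕₚ.+-cancelʳ-≡ (head₀ ν) _ _
    (trans (sum-toggle (rebound i (interlace-head′ j)) j)
        (cong (Vec.sum σ + Vec.sum ν +_) (ℕₚ.⊓-idem (head₀ ν))))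

  flip-raise : ∀ {n} {σ τ ν : Vec ℕ (suc n)} → σ ≺ τ → τ ≺ ν → bottom σ < bottom τ →
               bottom (flip σ τ ν) < bottom ν × σ ≺ inc (flip σ τ ν)
  flip-raise i j lt = let (r , s) = toggle-bottom (rebound i (interlace-head′ j)) j lt in r , unbound s

  flip-raise⁻ : ∀ {n} {σ τ ν : Vec ℕ (suc n)} → σ ≺ τ → τ ≺ ν →
                bottom (flip σ τ ν) < bottom ν → σ ≺ inc (flip σ τ ν) → bottom σ < bottom τ
  flip-raise⁻ i j lt k = toggle-bottom⁻ (rebound i (interlace-head′ j)) j lt
    (rebound k (interlace-head′ (interlace-incˡ (proj₂ (flip-≺ i j)) lt)))

-- The local bijections behind the two Pieri rules

module LocalIdentities where

  open import Data.List.Relation.Unary.All using ([])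
  open import Data.List.Relation.Unary.AllPairs using ([]; _∷_)
  open import Data.Nat.Base hiding (_/_)
  open import Data.Vec.Relation.Binary.Pointwise.Inductive using (Pointwise; []; _∷_)
  import Data.Vec.Relation.Unary.All as VAll
  open FiniteSums
  open Interlacing
  open Enumeration

  choices-unique : ∀ {A : Set} {n} {xss : Vec (List A) n} → VAll.All Unique xss → Unique (choices xss)
  choices-unique VAll.[]             = [] ∷ []
  choices-unique (xs! VAll.∷ xss!) = Uniqueₚ.cartesianProductWith⁺ _∷_ Vecₚ.∷-injective xs!
      (choices-unique xss!)

  ∈-choices⁺ : ∀ {A : Set} {n} {v : Vec A n} {xss} → Pointwise _∈_ v xss → v ∈ choices xss
  ∈-choices⁺ []          = here refl
  ∈-choices⁺ (a∈ ∷ v∈) = ∈ₚ.∈-cartesianProductWith⁺ _∷_ a∈ (∈-choices⁺ v∈)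

  all-replicate : ∀ {A : Set} {P : A → Set} n {a} → P a → VAll.All P (Vec.replicate n a)
  all-replicate zero    p = VAll.[]
  all-replicate (suc n) p = p VAll.∷ all-replicate n p

  bounded∈ : ∀ {N n} (v : Vec ℕ n) → Vec.sum v ≤ N → Pointwise _∈_ v (Vec.replicate n (upTo (suc N)))
  bounded∈ []      _  = []
  bounded∈ (a ∷ v) ≤N = ∈ₚ.∈-upTo⁺ (s≤s (ℕₚ.≤-trans (ℕₚ.m≤m+n a _) ≤N)) ∷ bounded∈ v
      (ℕₚ.≤-trans (ℕₚ.m≤n+m _ a) ≤N)

  boundedSum : ∀ {n} {P : Vec ℕ n → Set} → Decidable P → ∀ N → (∀ {v} → P v → Vec.sum v ≤ N) → Enumeration P
  boundedSum {n} P? N ≤N =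
    filterEnum (choices (Vec.replicate n (upTo (suc N))))
        (choices-unique (all-replicate n (Uniqueₚ.upTo⁺ (suc N)))) P?
      (λ {v} p → ∈-choices⁺ (bounded∈ v (≤N p)))

  ≤-enum : ∀ n → Enumeration (_≤ n)
  ≤-enum n = filterEnum (upTo (suc n)) (Uniqueₚ.upTo⁺ (suc n)) (ℕₚ._≤? n) (∈ₚ.∈-upTo⁺ ∘ s≤s)

  antidiagonal : ∀ n → Enumeration (λ (a , b) → a + b ≡ n)
  antidiagonal n = record
    { elements = map (λ a → a , n ∸ a) (upTo (suc n))
    ; unique   = Uniqueₚ.map⁺ (cong proj₁) (Uniqueₚ.upTo⁺ (suc n))
    ; sound    = λ ab∈ → let (a , a∈ , eq) = ∈ₚ.∈-map⁻ (λ a → a , n ∸ a) ab∈ in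
        trans (cong (λ (a , b) → a + b) eq) (ℕₚ.m+[n∸m]≡n (ℕₚ.≤-pred (∈ₚ.∈-upTo⁻ a∈)))
    ; complete = λ { {(a , b)} refl →
        subst (λ c → (a , c) ∈ map (λ a′ → a′ , a + b ∸ a′) (upTo (suc (a + b)))) (ℕₚ.m+n∸m≡n a b)
            (∈ₚ.∈-map⁺ (λ a → a , n ∸ a) (∈ₚ.∈-upTo⁺ (s≤s (ℕₚ.m≤m+n a b)))) }
    }

  ∣_∣ : ∀ {n} → Vec ℕ n → ℕ
  ∣_∣ = Vec.sum

  below : ∀ {n} (μ : Vec ℕ n) → Enumeration (_≺ μ)
  below μ = boundedSum (_≺? μ) ∣ μ ∣ interlace-sum

  above : ∀ {n} d (μ : Vec ℕ n) → Enumeration (λ ρ → μ ≺ ρ × ∣ ρ ∣ ∸ ∣ μ ∣ ≡ d)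
  above d μ = boundedSum (λ ρ → (μ ≺? ρ) ×-dec (∣ ρ ∣ ∸ ∣ μ ∣ ℕₚ.≟ d)) (∣ μ ∣ + d)
    λ {ρ} → λ { (_ , refl) → ℕₚ.m≤n+m∸n ∣ ρ ∣ ∣ μ ∣ }

  downUp : ∀ {n} d (μ : Vec ℕ n) →
           Enumeration (λ (ν , ρ) → ν ≺ μ × ν ≺ ρ × (∣ μ ∣ ∸ ∣ ν ∣) + (∣ ρ ∣ ∸ ∣ ν ∣) ≡ d)
  downUp d μ = below μ ⊗ λ ν →
    boundedSum (λ ρ → (ν ≺? ρ) ×-dec ((∣ μ ∣ ∸ ∣ ν ∣) + (∣ ρ ∣ ∸ ∣ ν ∣) ℕₚ.≟ d)) (∣ ν ∣ + d)
      λ {ρ} → λ { (_ , refl) → ℕₚ.≤-trans (ℕₚ.m≤n+m∸n ∣ ρ ∣ ∣ ν ∣) (ℕₚ.+-monoʳ-≤ ∣ ν ∣ (ℕₚ.m≤n+m _ _)) }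

  ext : ∀ {n} → Vec ℕ n → Vec ℕ (suc n)
  ext []      = 0 ∷ []
  ext (a ∷ α) = a ∷ ext α

  unext : ∀ {n} → Vec ℕ (suc n) → Vec ℕ n
  unext (a ∷ [])        = []
  unext (a ∷ α@(_ ∷ _)) = a ∷ unext α

  sum-ext : ∀ {n} (α : Vec ℕ n) → ∣ ext α ∣ ≡ ∣ α ∣
  sum-ext []      = refl
  sum-ext (a ∷ α) = cong (a +_) (sum-ext α)

  bottom-ext : ∀ {n} (α : Vec ℕ n) → bottom (ext α) ≡ 0
  bottom-ext []          = refl
  bottom-ext (a ∷ [])    = refl
  bottom-ext (a ∷ b ∷ α) = bottom-ext (b ∷ α)

  unext-ext : ∀ {n} (α : Vec ℕ n) → unext (ext α) ≡ α
  unext-ext []          = refl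
  unext-ext (a ∷ [])    = refl
  unext-ext (a ∷ b ∷ α) = cong (a ∷_) (unext-ext (b ∷ α))

  ext-unext : ∀ {n} (α : Vec ℕ (suc n)) → bottom α ≡ 0 → ext (unext α) ≡ α
  ext-unext (a ∷ [])        refl = refl
  ext-unext (a ∷ α@(_ ∷ _)) eq   = cong (a ∷_) (ext-unext α eq)

  interlace-ext⁺ : ∀ {u n} {α γ : Vec ℕ n} → Interlace u α γ → Interlace u (ext α) (ext γ)
  interlace-ext⁺ []           = cons z≤n z≤n []
  interlace-ext⁺ (cons p q r) = cons p q (interlace-ext⁺ r)

  interlace-ext⁻ : ∀ {u n} (α γ : Vec ℕ n) → Interlace u (ext α) (ext γ) → Interlace u α γ
  interlace-ext⁻ []      []      _            = []
  interlace-ext⁻ (a ∷ α) (g ∷ γ) (cons p q r) = cons p q (interlace-ext⁻ α γ r)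

  ≺-ext⁺ : ∀ {n} {α γ : Vec ℕ n} → α ≺ γ → ext α ≺ ext γ
  ≺-ext⁺ i = unbound (interlace-ext⁺ i)

  ≺-ext⁻ : ∀ {n} {α γ : Vec ℕ n} → ext α ≺ ext γ → α ≺ γ
  ≺-ext⁻ i = unbound (interlace-ext⁻ _ _ i)

  belowExt : ∀ {n} (ν : Vec ℕ (suc n)) → Enumeration (λ κ → ext κ ≺ ν)
  belowExt ν = boundedSum (λ κ → ext κ ≺? ν) ∣ ν ∣
      (λ {κ} i → ℕₚ.≤-trans (ℕₚ.≤-reflexive (sym (sum-ext κ))) (interlace-sum i))

  exchange : ∀ {w x y z} → w + x ≡ y + z → w ∸ y ≡ z ∸ x
  exchange {w} {x} {y} {z} eq = begin
    w ∸ y             ≡⟨ ℕₚ.[m+n]∸[m+o]≡n∸o x w y ⟨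
    x + w ∸ (x + y)   ≡⟨ cong₂ _∸_ (trans (ℕₚ.+-comm x w) eq) (ℕₚ.+-comm x y) ⟩
    y + z ∸ (y + x)   ≡⟨ ℕₚ.[m+n]∸[m+o]≡n∸o y z x ⟩
    z ∸ x             ∎
    where open ≡.≡-Reasoning

  exchange-+ : ∀ {a w x y z} → x ≤ z → w + x ≡ y + z + a → w ∸ y ≡ a + (z ∸ x)
  exchange-+ {a} {w} {x} {y} {z} x≤z eq = begin
    w ∸ y         ≡⟨ exchange {w} {x} {y} {a + z}
        (trans eq (trans (ℕₚ.+-assoc y z a) (cong (y +_) (ℕₚ.+-comm z a)))) ⟩
    a + z ∸ x     ≡⟨ ℕₚ.+-∸-assoc a x≤z ⟩
    a + (z ∸ x)   ∎
    where open ≡.≡-Reasoning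

  module SchurLocal {n} (d : ℕ) (μ : Vec ℕ (suc n)) (μ₀ : bottom μ ≡ 0) where

    -- `a` is the power of the largest variable taken from the complete homogeneous factor and `c`
    -- the degree left to the smaller variables. `κ` is `μ` without its largest letters, and `κ′`
    -- comes from the rule for `κ`.
    Left : (ℕ × ℕ) × Vec ℕ (suc n) × Vec ℕ (suc n) → Set
    Left ((a , c) , κ , κ′) = a + c ≡ d × κ ≺ μ × κ ≺ κ′ × ∣ κ′ ∣ ∸ ∣ κ ∣ ≡ c

    Right : Vec ℕ (suc n) × Vec ℕ (suc n) → Set
    Right (ρ , κ′) = (μ ≺ ρ × ∣ ρ ∣ ∸ ∣ μ ∣ ≡ d) × κ′ ≺ ρ

    -- The bottom rows of `μ` and `κ` are both empty, so the bottom row hands no offset on.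
    closed : ∀ a κ κ′ → κ ≺ μ → Closed a μ κ′ κ
    closed a κ κ′ i = closed⁺ a μ κ′ κ
      (trans (ℕₚ.n≤0⇒n≡0 (subst (bottom κ ≤_) μ₀ (interlace-bottom i))) (cong (_⊓ bottom κ′) (sym μ₀)))

    left≅right : Left ≅ Right
    left≅right = record
      { to      = λ ((a , c) , κ , κ′) → grow a μ κ′ κ , κ′
      ; from    = λ (ρ , κ′) → let κ = shrink μ κ′ ρ in (excess μ κ′ ρ , ∣ κ′ ∣ ∸ ∣ κ ∣) , κ , κ′
      ; to-∈    = λ { {((a , c) , κ , κ′)} (refl , i , j , refl) →
          let cl = closed a κ κ′ i
              (r , s) = _≅_.to-∈ (growth μ κ′) {a , κ} (i , j , cl)
          in (r , exchange-+ {y = ∣ μ ∣} (interlace-sum j) (sum-grow a i j cl)) , s }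
      ; from-∈  = λ { {(ρ , κ′)} ((i , refl) , j) →
          let (r , s , cl) = _≅_.from-∈ (growth μ κ′) {ρ} (i , j)
          in sym (trans (cong (λ ρ → ∣ ρ ∣ ∸ ∣ μ ∣) (sym (_≅_.to∘from (growth μ κ′) (i , j))))
                        (exchange-+ {y = ∣ μ ∣} (interlace-sum s) (sum-grow _ r s cl))) , r , s , refl }
      ; from∘to = λ { {((a , c) , κ , κ′)} (refl , i , j , refl) →
          cong (λ (a , κ) → (a , ∣ κ′ ∣ ∸ ∣ κ ∣) , κ , κ′)
              (_≅_.from∘to (growth μ κ′) {a , κ} (i , j , closed a κ κ′ i)) }
      ; to∘from = λ { {(ρ , κ′)} ((i , _) , j) → cong (_, κ′) (_≅_.to∘from (growth μ κ′) {ρ} (i , j)) }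
      }
    -- These are the exponents of the largest variable before and after; their equality is the size
    -- relation of the growth square.
    exponent : ∀ {a c κ κ′} → Left ((a , c) , κ , κ′) → a + (∣ μ ∣ ∸ ∣ κ ∣) ≡ ∣ grow a μ κ′ κ ∣ ∸ ∣ κ′ ∣
    exponent {a} {c} {κ} {κ′} (_ , i , j , _) = sym (exchange-+ {y = ∣ κ′ ∣} (interlace-sum i)
      (trans (sum-grow a i j (closed a κ κ′ i)) (cong (_+ a) (ℕₚ.+-comm ∣ μ ∣ ∣ κ′ ∣))))

  -- Two toggles and a growth step turn Left into the chains of Middle that are not Raisable; a growth step
  -- turns the chains of Middle that are not Lowerable into Right.  Adding a box to the bottom rows of both ν
  -- and ρ exchanges Raisable and Lowerable, and it preserves the weight because of x x⁻¹ = 1.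
  module KingLocal {n} (d : ℕ) (μ : Vec ℕ (suc n)) where

    -- `a` and `b` are the powers of `x` and `x⁻¹` from the complete homogeneous factor, and `c` is
    -- the degree in the smaller pairs. Removing the largest barred letters from `μ` leaves `ν`,
    -- removing the unbarred ones then leaves `κ`; `σ` and `κ′` come from the rule for `κ`.
    Left : (ℕ × ℕ) × (ℕ × ℕ) × (Vec ℕ (suc n) × Vec ℕ n) × Vec ℕ n × Vec ℕ n → Set
    Left ((e , c) , (a , b) , (ν , κ) , (σ , κ′)) =
      e + c ≡ d × a + b ≡ e × (ν ≺ μ × ext κ ≺ ν) × (σ ≺ κ × σ ≺ κ′ × (∣ κ ∣ ∸ ∣ σ ∣) + (∣ κ′ ∣ ∸ ∣ σ ∣) ≡ c)

    Right : (Vec ℕ (suc n) × Vec ℕ (suc n)) × Vec ℕ (suc n) × Vec ℕ n → Set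
    Right ((ν , ϕ) , (ρ , κ′)) =
      (ν ≺ μ × ν ≺ ϕ × (∣ μ ∣ ∸ ∣ ν ∣) + (∣ ϕ ∣ ∸ ∣ ν ∣) ≡ d) × (ρ ≺ ϕ × ext κ′ ≺ ρ)

    -- `b` is the excess for the last growth step, which produces the shape `ϕ` of `Right`.
    -- `Raisable` says that a box fits at the bottom of both `ν` and `ρ`, `Lowerable` that both can
    -- lose one there and still contain `τ`.
    Middle Raisable Lowerable : Vec ℕ (suc n) × Vec ℕ (suc n) × ℕ × Vec ℕ (suc n) × Vec ℕ n → Set
    Middle (ν , τ , b , ρ , κ′) =
      ν ≺ μ × τ ≺ ν × b ≤ d × (τ ≺ ρ × b + (∣ ρ ∣ ∸ ∣ τ ∣) + (∣ μ ∣ ∸ ∣ ν ∣) ≡ d) × ext κ′ ≺ ρ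
    Raisable (ν , τ , b , ρ , κ′) = (ext κ′ ≺ inc ρ × τ ≺ inc ρ) × (τ ≺ inc ν × inc ν ≺ μ)
    Lowerable (ν , τ , b , ρ , κ′) = bottom τ < bottom ρ × bottom τ < bottom ν

    raisable? : Decidable Raisable
    raisable? (ν , τ , b , ρ , κ′) =
      ((ext κ′ ≺? inc ρ) ×-dec (τ ≺? inc ρ)) ×-dec ((τ ≺? inc ν) ×-dec (inc ν ≺? μ))

    lowerable? : Decidable Lowerable
    lowerable? (ν , τ , b , ρ , κ′) = (bottom τ ℕₚ.<? bottom ρ) ×-dec (bottom τ ℕₚ.<? bottom ν)

    middle : Enumeration Middle
    middle = below μ ⊗ λ ν → below ν ⊗ λ τ → ≤-enum d ⊗ λ b →
      boundedSum (λ ρ → (τ ≺? ρ) ×-dec (b + (∣ ρ ∣ ∸ ∣ τ ∣) + (∣ μ ∣ ∸ ∣ ν ∣) ℕₚ.≟ d)) (∣ τ ∣ + d)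
        (λ {ρ} → λ { (_ , refl) → ℕₚ.≤-trans (ℕₚ.m≤n+m∸n ∣ ρ ∣ ∣ τ ∣)
                   (ℕₚ.+-monoʳ-≤ ∣ τ ∣ (ℕₚ.≤-trans (ℕₚ.m≤n+m _ b) (ℕₚ.m≤m+n _ _))) })
      ⊗ belowExt

    -- The degree survives because the strip of `ρ` over `τ` gains a box and the strip of `μ` over
    -- `ν` loses one.
    shift : (λ t → Middle t × Raisable t) ≅ (λ t → Middle t × Lowerable t)
    shift = record
      { to      = λ (ν , τ , b , ρ , κ′) → inc ν , τ , b , inc ρ , κ′
      ; from    = λ (ν , τ , b , ρ , κ′) → dec ν , τ , b , dec ρ , κ′
      ; to-∈    = λ { {(ν , τ , b , ρ , κ′)} ((i , j , b≤ , (k , deg) , l) , (l′ , k′) , (j′ , i′)) →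
          (i′ , j′ , b≤ , (k′ , trans (sym (degree b ν ρ (interlace-sum k)
              (subst (_≤ ∣ μ ∣) (sum-inc ν) (interlace-sum i′)))) deg) , l′) ,
          (ℕₚ.≤-<-trans (interlace-bottom k) (lower ρ) , ℕₚ.≤-<-trans (interlace-bottom j) (lower ν)) }
      ; from-∈  = λ { {(ν , τ , b , ρ , κ′)} ((i , j , b≤ , (k , deg) , l) , (τ<ρ , τ<ν)) →
          let ν≡ = inc-dec ν (ℕₚ.≤-<-trans z≤n τ<ν)
              ρ≡ = inc-dec ρ (ℕₚ.≤-<-trans z≤n τ<ρ)
              ∣ν∣≡ = trans (sym (sum-inc (dec ν))) (cong ∣_∣ ν≡)
              ∣ρ∣≡ = trans (sym (sum-inc (dec ρ))) (cong ∣_∣ ρ≡)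
              k′ = unbound (interlace-decʳ k τ<ρ)
              -- `ext κ′` ends in an empty row, so a nonempty bottom row of `ρ` may lose a box
              -- without uncovering it.
              κ′<ρ = ℕₚ.≤-<-trans (ℕₚ.≤-reflexive (bottom-ext κ′)) (ℕₚ.≤-<-trans z≤n τ<ρ)
          in (unbound (interlace-decˡ i) , unbound (interlace-decʳ j τ<ν) , b≤ ,
              (k′ , trans (degree b (dec ν) (dec ρ) (interlace-sum k′)
                  (subst (_≤ ∣ μ ∣) (sym ∣ν∣≡) (interlace-sum i)))
                          (trans (cong₂ (λ ρ ν → b + (∣ ρ ∣ ∸ ∣ τ ∣) + (∣ μ ∣ ∸ ∣ ν ∣)) ρ≡ ν≡) deg)) ,
              unbound (interlace-decʳ l κ′<ρ)) ,
             (subst (ext κ′ ≺_) (sym ρ≡) l , subst (τ ≺_) (sym ρ≡) k) ,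
             (subst (τ ≺_) (sym ν≡) j , subst (_≺ μ) (sym ν≡) i) }
      ; from∘to = λ { {(ν , τ , b , ρ , κ′)} _ → cong₂ (λ ν ρ → ν , τ , b , ρ , κ′) (dec-inc ν) (dec-inc ρ) }
      ; to∘from = λ { {(ν , τ , b , ρ , κ′)} (_ , (τ<ρ , τ<ν)) →
          cong₂ (λ ν ρ → ν , τ , b , ρ , κ′) (inc-dec ν (ℕₚ.≤-<-trans z≤n τ<ν))
              (inc-dec ρ (ℕₚ.≤-<-trans z≤n τ<ρ)) }
      }
      where
      lower : (ρ : Vec ℕ (suc n)) → bottom ρ < bottom (inc ρ)
      lower ρ = ℕₚ.≤-reflexive (sym (bottom-mapBottom suc ρ))
      degree : ∀ b (ν ρ : Vec ℕ (suc n)) {t m} → t ≤ ∣ ρ ∣ → suc ∣ ν ∣ ≤ m →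
               b + (∣ ρ ∣ ∸ t) + (m ∸ ∣ ν ∣) ≡ b + (∣ inc ρ ∣ ∸ t) + (m ∸ ∣ inc ν ∣)
      degree b ν ρ {t} {m} t≤ ν< rewrite sum-inc ν | sum-inc ρ = begin
        b + (∣ ρ ∣ ∸ t) + (m ∸ ∣ ν ∣)             ≡⟨ cong (b + (∣ ρ ∣ ∸ t) +_) (ℕₚ.+-∸-assoc 1 ν<) ⟩
        b + (∣ ρ ∣ ∸ t) + suc (m ∸ suc ∣ ν ∣)     ≡⟨ regroup b (∣ ρ ∣ ∸ t) (m ∸ suc ∣ ν ∣) ⟩
        b + suc (∣ ρ ∣ ∸ t) + (m ∸ suc ∣ ν ∣)     ≡⟨ cong (λ x → b + x + (m ∸ suc ∣ ν ∣))
            (ℕₚ.+-∸-assoc 1 t≤) ⟨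
        b + (suc ∣ ρ ∣ ∸ t) + (m ∸ suc ∣ ν ∣)     ∎
        where
        open ≡.≡-Reasoning
        regroup : ∀ b x y → b + x + suc y ≡ b + suc x + y
        regroup = solve-∀

    Shape : Set
    Shape = Vec ℕ (suc n)

    Chain : Shape × Shape × Shape × Vec ℕ n → Set
    Chain (ν , τ , σ , κ′) = ν ≺ μ × τ ≺ ν × σ ≺ τ × σ ≺ ext κ′

    -- The chains before the flips, after flipping `κ`, and after flipping `ν` as well. The middle
    -- clause is the empty bottom row of `κ` as seen at each stage, and the first strip in the
    -- degree moves up the chain with each flip.
    C₀ C₁ C₂ : (Shape × Shape × Shape × Vec ℕ n) × ℕ × ℕ → Set
    C₀ (t@(ν , κ , σ , κ′) , a , b) =
      Chain t × bottom κ ≡ 0 × a + b + ((∣ κ ∣ ∸ ∣ σ ∣) + (∣ ext κ′ ∣ ∸ ∣ σ ∣)) ≡ d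
    C₁ (t@(ν , τ , σ , κ′) , a , b) =
      Chain t × ¬ (bottom τ < bottom ν × σ ≺ inc τ) × a + b + ((∣ ν ∣ ∸ ∣ τ ∣) + (∣ ext κ′ ∣ ∸ ∣ σ ∣)) ≡ d
    C₂ (t@(ν , τ , σ , κ′) , a , b) =
      Chain t × ¬ ((τ ≺ inc ν × inc ν ≺ μ) × σ ≺ inc τ) × a + b + ((∣ μ ∣ ∸ ∣ ν ∣) + (∣ ext κ′ ∣ ∸ ∣ σ ∣)) ≡ d

    bottom-σ : ∀ {σ : Shape} {κ′ : Vec ℕ n} → σ ≺ ext κ′ → bottom σ ≡ 0
    bottom-σ {σ} {κ′} i = ℕₚ.n≤0⇒n≡0 (subst (bottom σ ≤_) (bottom-ext κ′) (interlace-bottom i))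

    left≅C₀ : Left ≅ C₀
    left≅C₀ = record
      { to      = λ ((e , c) , (a , b) , (ν , κ) , (σ , κ′)) → (ν , ext κ , ext σ , κ′) , a , b
      ; from    = λ ((ν , κ , σ , κ′) , a , b) →
          (a + b , (∣ κ ∣ ∸ ∣ σ ∣) + (∣ ext κ′ ∣ ∸ ∣ σ ∣)) , (a , b) , (ν , unext κ) , (unext σ , κ′)
      ; to-∈    = λ { {(_ , (a , b) , (ν , κ) , (σ , κ′))} (refl , refl , (i , j) , k , l , refl) →
          (i , j , ≺-ext⁺ k , ≺-ext⁺ l) , bottom-ext κ , cong (a + b +_) (sums κ σ κ′) }
      ; from-∈  = λ { {((ν , κ , σ , κ′) , a , b)} ((i , j , k , l) , κ₀ , refl) →
          let σ₀ = bottom-σ {σ} {κ′} l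
              κ≡ = ext-unext κ κ₀
              σ≡ = ext-unext σ σ₀
          in refl , refl , (i , subst (_≺ ν) (sym κ≡) j) , ≺-ext⁻ (subst₂ _≺_ (sym σ≡) (sym κ≡) k) ,
             ≺-ext⁻ (subst (_≺ ext κ′) (sym σ≡) l) ,
             trans (sym (sums (unext κ) (unext σ) κ′))
                   (cong₂ (λ κ σ → (∣ κ ∣ ∸ ∣ σ ∣) + (∣ ext κ′ ∣ ∸ ∣ σ ∣)) κ≡ σ≡) }
      ; from∘to = λ { {(_ , (a , b) , (ν , κ) , (σ , κ′))} (refl , refl , (i , j) , k , l , refl) →
          trans (cong (λ c → (a + b , c) , (a , b) , (ν , unext (ext κ)) , (unext (ext σ) , κ′))
              (sums κ σ κ′))
                (cong₂ (λ κ₁ σ₁ → (a + b , (∣ κ ∣ ∸ ∣ σ ∣) + (∣ κ′ ∣ ∸ ∣ σ ∣)) , (a , b) , (ν , κ₁) ,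
                    (σ₁ , κ′))
                       (unext-ext κ) (unext-ext σ)) }
      ; to∘from = λ { {((ν , κ , σ , κ′) , a , b)} ((i , j , k , l) , κ₀ , refl) →
          cong₂ (λ κ σ → (ν , κ , σ , κ′) , a , b) (ext-unext κ κ₀) (ext-unext σ (bottom-σ {σ} {κ′} l)) }
      }
      where
      sums : ∀ (κ σ κ′ : Vec ℕ n) →
             (∣ ext κ ∣ ∸ ∣ ext σ ∣) + (∣ ext κ′ ∣ ∸ ∣ ext σ ∣) ≡ (∣ κ ∣ ∸ ∣ σ ∣) + (∣ κ′ ∣ ∸ ∣ σ ∣)
      sums κ σ κ′ rewrite sum-ext κ | sum-ext σ | sum-ext κ′ = refl

    private
      -- A flip exchanges the sizes of the two strips, as the Bender-Knuth involution exchanges the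
      -- multiplicities of two adjacent letters.
      flip-sizes : ∀ {σ τ ν : Shape} → σ ≺ τ → τ ≺ ν → ∣ τ ∣ ∸ ∣ σ ∣ ≡ ∣ ν ∣ ∸ ∣ flip σ τ ν ∣
      flip-sizes {σ} {τ} i j = exchange {∣ τ ∣} {y = ∣ σ ∣} (sum-flip i j)

      flip-sizes′ : ∀ {σ τ ν : Shape} → σ ≺ τ → τ ≺ ν → ∣ ν ∣ ∸ ∣ τ ∣ ≡ ∣ flip σ τ ν ∣ ∸ ∣ σ ∣
      flip-sizes′ {σ} {τ} {ν} i j = sym (exchange {∣ flip σ τ ν ∣} {y = ∣ σ ∣}
        (trans (ℕₚ.+-comm ∣ flip σ τ ν ∣ ∣ τ ∣) (sum-flip i j)))

    -- `σ` ends in an empty row, so an empty bottom row of `κ` is one at the lower end of its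
    -- interval. The flip moves it to the upper end, where no further box fits.
    C₀≅C₁ : C₀ ≅ C₁
    C₀≅C₁ = record
      { to      = step
      ; from    = step
      ; to-∈    = λ { {((ν , κ , σ , κ′) , a , b)} ((i , j , k , l) , κ₀ , deg) →
          let (r , s) = flip-≺ k j in
          (i , s , r , l) ,
          (λ (p , q) → ℕₚ.n≮0 (subst (bottom σ <_) κ₀ (flip-raise⁻ k j p q))) ,
          trans (cong (λ m → a + b + (m + (∣ ext κ′ ∣ ∸ ∣ σ ∣))) (sym (flip-sizes k j))) deg }
      ; from-∈  = λ { {((ν , τ , σ , κ′) , a , b)} ((i , j , k , l) , stuck , deg) →
          let (r , s) = flip-≺ k j
              τ≡ = flip-involutive k j
          in (i , s , r , l) ,
             ℕₚ.n≤0⇒n≡0 (ℕₚ.≮⇒≥ λ κ>0 → stuck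
               (subst (λ τ → bottom τ < bottom ν × σ ≺ inc τ) τ≡
                 (flip-raise r s (subst (_< bottom (flip σ τ ν)) (sym (bottom-σ {σ} {κ′} l)) κ>0)))) ,
             trans (cong (λ m → a + b + (m + (∣ ext κ′ ∣ ∸ ∣ σ ∣))) (sym (flip-sizes′ k j))) deg }
      ; from∘to = λ { {((ν , κ , σ , κ′) , a , b)} ((i , j , k , l) , _) →
          cong (λ κ → (ν , κ , σ , κ′) , a , b) (flip-involutive k j) }
      ; to∘from = λ { {((ν , κ , σ , κ′) , a , b)} ((i , j , k , l) , _) →
          cong (λ κ → (ν , κ , σ , κ′) , a , b) (flip-involutive k j) }
      }
      where
      step : (Shape × Shape × Shape × Vec ℕ n) × ℕ × ℕ → (Shape × Shape × Shape × Vec ℕ n) × ℕ × ℕ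
      step ((ν , κ , σ , κ′) , a , b) = (ν , flip σ κ ν , σ , κ′) , a , b

    -- The clause `σ ≺ inc τ` does not involve `ν` and stays. By `flip-raise` the clause
    -- `bottom τ < bottom ν` becomes room for a box at the bottom of the flipped `ν`.
    C₁≅C₂ : C₁ ≅ C₂
    C₁≅C₂ = record
      { to      = step
      ; from    = step
      ; to-∈    = λ { {((ν , τ , σ , κ′) , a , b)} ((i , j , k , l) , stuck , deg) →
          let (r , s) = flip-≺ j i in
          (s , r , k , l) ,
          (λ ((p , q) , k′) → stuck (flip-raise⁻ j i (raise-bottom (flip τ ν μ) q) p , k′)) ,
          trans (cong (λ m → a + b + (m + (∣ ext κ′ ∣ ∸ ∣ σ ∣))) (sym (flip-sizes j i))) deg }
      ; from-∈  = λ { {((ν , τ , σ , κ′) , a , b)} ((i , j , k , l) , stuck , deg) →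
          let (r , s) = flip-≺ j i
              ν≡ = flip-involutive j i
          in (s , r , k , l) ,
             (λ (p , q) → let (t , w) = flip-raise r s p in
                stuck ((subst (λ ν → τ ≺ inc ν) ν≡ w ,
                        interlace-incˡ i (subst (λ ν → bottom ν < bottom μ) ν≡ t)) , q)) ,
             trans (cong (λ m → a + b + (m + (∣ ext κ′ ∣ ∸ ∣ σ ∣))) (sym (flip-sizes′ j i))) deg }
      ; from∘to = λ { {((ν , κ , σ , κ′) , a , b)} ((i , j , k , l) , _) →
          cong (λ ν → (ν , κ , σ , κ′) , a , b) (flip-involutive j i) }
      ; to∘from = λ { {((ν , κ , σ , κ′) , a , b)} ((i , j , k , l) , _) →
          cong (λ ν → (ν , κ , σ , κ′) , a , b) (flip-involutive j i) }
      }
      where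
      step : (Shape × Shape × Shape × Vec ℕ n) × ℕ × ℕ → (Shape × Shape × Shape × Vec ℕ n) × ℕ × ℕ
      step ((ν , τ , σ , κ′) , a , b) = (flip τ ν μ , τ , σ , κ′) , a , b
      raise-bottom : ∀ (ν : Shape) → inc ν ≺ μ → bottom ν < bottom μ
      raise-bottom ν i = subst (_≤ bottom μ) (bottom-mapBottom suc ν) (interlace-bottom i)

    closed : ∀ a {τ σ : Shape} (κ′ : Vec ℕ n) → σ ≺ ext κ′ → Closed a (ext κ′) τ σ
    closed a {τ} {σ} κ′ i = closed⁺ a (ext κ′) τ σ
      (trans (bottom-σ {σ} {κ′} i) (cong (_⊓ bottom τ) (sym (bottom-ext κ′))))

    -- Growth trades `σ` and `a` for `ρ`; it is closed because `ext κ′` ends in an empty row. By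
    -- `grow-raise`, `σ ≺ inc τ` becomes room for a box at the bottom of `ρ`.
    C₂≅middle : C₂ ≅ (λ t → Middle t × ¬ Raisable t)
    C₂≅middle = record
      { to      = λ ((ν , τ , σ , κ′) , a , b) → ν , τ , b , grow a (ext κ′) τ σ , κ′
      ; from    = λ (ν , τ , b , ρ , κ′) →
          (ν , τ , shrink (ext κ′) τ ρ , κ′) , excess (ext κ′) τ ρ , b
      ; to-∈    = λ { {((ν , τ , σ , κ′) , a , b)} ((i , j , k , l) , stuck , deg) →
          let cl = closed a κ′ l
              (r , s) = _≅_.to-∈ (growth (ext κ′) τ) {a , σ} (l , k , cl)
          in (i , j , ≤d {a} deg , (s , trans (degree {ν} b k l cl) deg) , r) ,
             (λ ((p , q) , t) → stuck (t , grow-raise⁻ a (bottom-ext κ′) l k p q)) }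
      ; from-∈  = λ { {(ν , τ , b , ρ , κ′)} ((i , j , b≤ , (k , deg) , l) , stuck) →
          let (r , s , cl) = _≅_.from-∈ (growth (ext κ′) τ) {ρ} (l , k)
              ρ≡ = _≅_.to∘from (growth (ext κ′) τ) {ρ} (l , k)
          in (i , j , s , r) ,
             (λ (p , q) → stuck (subst (λ ρ → ext κ′ ≺ inc ρ × τ ≺ inc ρ) ρ≡
                (grow-raise (excess (ext κ′) τ ρ) (bottom-ext κ′) r s q) , p)) ,
             trans (sym (degree {ν} b s r cl))
               (trans (cong (λ ρ → b + (∣ ρ ∣ ∸ ∣ τ ∣) + (∣ μ ∣ ∸ ∣ ν ∣)) ρ≡) deg) }
      ; from∘to = λ { {((ν , τ , σ , κ′) , a , b)} ((i , j , k , l) , _) →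
          cong (λ (a , σ) → (ν , τ , σ , κ′) , a , b) (_≅_.from∘to (growth (ext κ′) τ) {a , σ}
              (l , k , closed a κ′ l)) }
      ; to∘from = λ { {(ν , τ , b , ρ , κ′)} ((i , j , b≤ , (k , deg) , l) , _) →
          cong (λ ρ → ν , τ , b , ρ , κ′) (_≅_.to∘from (growth (ext κ′) τ) {ρ} (l , k)) }
      }
      where
      ≤d : ∀ {a b m} → a + b + m ≡ d → b ≤ d
      ≤d {a} {b} {m} eq = ℕₚ.≤-trans (ℕₚ.m≤n+m b a) (ℕₚ.≤-trans (ℕₚ.m≤m+n _ m) (ℕₚ.≤-reflexive eq))
      regroup : ∀ a b m s → b + (a + s) + m ≡ a + b + (m + s)
      regroup = solve-∀
      degree : ∀ {ν τ σ κ′ a} b → σ ≺ τ → σ ≺ ext κ′ → Closed a (ext κ′) τ σ →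
               b + (∣ grow a (ext κ′) τ σ ∣ ∸ ∣ τ ∣) + (∣ μ ∣ ∸ ∣ ν ∣) ≡ a + b
                   + ((∣ μ ∣ ∸ ∣ ν ∣) + (∣ ext κ′ ∣ ∸ ∣ σ ∣))
      degree {ν} {τ} {σ} {κ′} {a} b k l cl = trans
        (cong (λ m → b + m + (∣ μ ∣ ∸ ∣ ν ∣)) (exchange-+ {y = ∣ τ ∣} (interlace-sum l)
          (trans (sum-grow a l k cl) (cong (_+ a) (ℕₚ.+-comm ∣ ext κ′ ∣ ∣ τ ∣)))))
        (regroup a b (∣ μ ∣ ∸ ∣ ν ∣) (∣ ext κ′ ∣ ∸ ∣ σ ∣))

    left≅middle : Left ≅ (λ t → Middle t × ¬ Raisable t)
    left≅middle = ≅-trans left≅C₀ (≅-trans C₀≅C₁ (≅-trans C₁≅C₂ C₂≅middle))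

    -- The exponents of `x` and `x⁻¹`. Growing `ϕ` turns the second into the size of the strip of
    -- `ϕ` over `ρ`.
    exponent : Shape × Shape × ℕ × Shape × Vec ℕ n → ℕ × ℕ
    exponent (ν , τ , b , ρ , κ′) = ∣ ρ ∣ ∸ ∣ κ′ ∣ , b + (∣ ν ∣ ∸ ∣ τ ∣)

    left-exponent : ∀ {e c a b ν κ σ κ′} → Left ((e , c) , (a , b) , (ν , κ) , (σ , κ′)) →
      (a + (∣ ν ∣ ∸ ∣ κ ∣) , b + (∣ μ ∣ ∸ ∣ ν ∣)) ≡ exponent
          (_≅_.to left≅middle ((e , c) , (a , b) , (ν , κ) , (σ , κ′)))
    left-exponent {a = a} {b} {ν} {κ} {σ} {κ′} (refl , refl , (i , j) , k , l , refl) =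
      let k′ = ≺-ext⁺ k
          l′ = ≺-ext⁺ l
          (r , s) = flip-≺ k′ j
      in cong₂ _,_
        (trans (cong (λ m → a + (∣ ν ∣ ∸ m)) (sym (sum-ext κ)))
          (trans (cong (a +_) (flip-sizes′ k′ j))
            (trans (sym (exchange-+ {y = ∣ ext κ′ ∣} (interlace-sum r) (sum-grow a l′ r (closed a κ′ l′))))
              (cong (∣ grow a (ext κ′) (flip (ext σ) (ext κ) ν) (ext σ) ∣ ∸_) (sum-ext κ′)))))
        (cong (b +_) (flip-sizes′ s i))

    shift-exponent : ∀ {t} → Middle t × Raisable t →
      let (p , q) = exponent t in (suc p , suc q) ≡ exponent (_≅_.to shift t)
    shift-exponent {ν , τ , b , ρ , κ′} ((i , j , b≤ , (k , deg) , l) , _) = cong₂ _,_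
      (sym (trans (cong (_∸ ∣ κ′ ∣) (sum-inc ρ)) (ℕₚ.+-∸-assoc 1
          (subst (_≤ ∣ ρ ∣) (sum-ext κ′) (interlace-sum l)))))
      (sym (trans (cong (λ m → b + (m ∸ ∣ τ ∣)) (sum-inc ν))
        (trans (cong (b +_) (ℕₚ.+-∸-assoc 1 (interlace-sum j))) (ℕₚ.+-suc b _))))

    -- As `τ` lies below both shapes, failing to be `Lowerable` means that its bottom row attains
    -- the minimum of theirs. This is the condition for growing `ϕ` without a new row.
    closed′ : ∀ {ν τ ρ : Shape} b → τ ≺ ρ → τ ≺ ν → ¬ (bottom τ < bottom ρ × bottom τ < bottom ν) → Closed b
        ρ ν τ
    closed′ {ν} {τ} {ρ} b k j stuck = closed⁺ b ρ ν τ (ℕₚ.≤-antisym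
      (ℕₚ.⊓-glb (interlace-bottom k) (interlace-bottom j))
      (ℕₚ.≮⇒≥ λ lt → stuck (ℕₚ.<-≤-trans lt (ℕₚ.m⊓n≤m _ _) , ℕₚ.<-≤-trans lt (ℕₚ.m⊓n≤n (bottom ρ) _))))

    middle≅right : (λ t → Middle t × ¬ Lowerable t) ≅ Right
    middle≅right = record
      { to      = λ (ν , τ , b , ρ , κ′) → (ν , grow b ρ ν τ) , (ρ , κ′)
      ; from    = λ ((ν , ϕ) , (ρ , κ′)) → ν , shrink ρ ν ϕ , excess ρ ν ϕ , ρ , κ′
      ; to-∈    = λ { {(ν , τ , b , ρ , κ′)} ((i , j , b≤ , (k , deg) , l) , stuck) →
          let cl = closed′ b k j stuck
              (r , s) = _≅_.to-∈ (growth ρ ν) {b , τ} (k , j , cl)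
          in (i , s , trans (degree k j cl) deg) , r , l }
      ; from-∈  = λ { {((ν , ϕ) , (ρ , κ′))} ((i , j , deg) , k , l) →
          let (r , s , cl) = _≅_.from-∈ (growth ρ ν) {ϕ} (k , j)
              ϕ≡ = _≅_.to∘from (growth ρ ν) {ϕ} (k , j)
              deg′ = trans (sym (degree r s cl)) (trans (cong (λ ϕ → (∣ μ ∣ ∸ ∣ ν ∣) + (∣ ϕ ∣ ∸ ∣ ν ∣)) ϕ≡)
                  deg)
              b = excess ρ ν ϕ
          in (i , s , ℕₚ.≤-trans (ℕₚ.≤-trans (ℕₚ.m≤m+n b _) (ℕₚ.m≤m+n _ _)) (ℕₚ.≤-reflexive deg′) ,
                  (r , deg′) , l) ,
             λ (p , q) → ℕₚ.<⇒≱ (ℕₚ.⊓-glb p q) (ℕₚ.≤-reflexive (sym (closed⁻ b r s cl))) }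
      ; from∘to = λ { {(ν , τ , b , ρ , κ′)} ((i , j , b≤ , (k , deg) , l) , stuck) →
          cong (λ (b , τ) → ν , τ , b , ρ , κ′) (_≅_.from∘to (growth ρ ν) {b , τ}
              (k , j , closed′ b k j stuck)) }
      ; to∘from = λ { {((ν , ϕ) , (ρ , κ′))} ((i , j , deg) , k , l) →
          cong (λ ϕ → (ν , ϕ) , (ρ , κ′)) (_≅_.to∘from (growth ρ ν) {ϕ} (k , j)) }
      }
      where
      regroup : ∀ m b r → m + (b + r) ≡ b + r + m
      regroup = solve-∀
      degree : ∀ {ν τ ρ b} → τ ≺ ρ → τ ≺ ν → Closed b ρ ν τ →
               (∣ μ ∣ ∸ ∣ ν ∣) + (∣ grow b ρ ν τ ∣ ∸ ∣ ν ∣) ≡ b + (∣ ρ ∣ ∸ ∣ τ ∣) + (∣ μ ∣ ∸ ∣ ν ∣)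
      degree {ν} {τ} {ρ} {b} k j cl = trans
        (cong ((∣ μ ∣ ∸ ∣ ν ∣) +_) (exchange-+ {y = ∣ ν ∣} (interlace-sum k)
          (trans (sum-grow b k j cl) (cong (_+ b) (ℕₚ.+-comm ∣ ρ ∣ ∣ ν ∣)))))
        (regroup (∣ μ ∣ ∸ ∣ ν ∣) b _)

    right-exponent : ∀ {t@(ν , τ , b , ρ , κ′) : Shape × Shape × ℕ × Shape × Vec ℕ n} → Middle t × ¬
        Lowerable t →
      exponent t ≡ (∣ ρ ∣ ∸ ∣ κ′ ∣ , ∣ grow b ρ ν τ ∣ ∸ ∣ ρ ∣)
    right-exponent {ν , τ , b , ρ , κ′} ((i , j , b≤ , (k , deg) , l) , stuck) =
      cong (∣ ρ ∣ ∸ ∣ κ′ ∣ ,_)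
        (sym (exchange-+ {y = ∣ ρ ∣} (interlace-sum j) (sum-grow b k j (closed′ b k j stuck))))

-- Pieri rules by induction on the variables

module PieriRules where

  open import Data.Nat.Base using (ℕ; zero; suc; _∸_; _≤_; z≤n; s≤s) renaming (_+_ to _ℕ+_)
  open FiniteSums
  open Interlacing
  open LocalIdentities
  open Enumeration

  sum≡0-unique : ∀ {n} {α β : Vec ℕ n} → ∣ α ∣ ≡ 0 → ∣ β ∣ ≡ 0 → α ≡ β
  sum≡0-unique {α = []}       {[]}       _ _ = refl
  sum≡0-unique {α = zero ∷ _} {zero ∷ _} p q = cong (0 ∷_) (sum≡0-unique p q)

  ≺-refl : ∀ {n} {α : Vec ℕ n} → ∣ α ∣ ≡ 0 → α ≺ α
  ≺-refl {α = []}       _ = []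
  ≺-refl {α = zero ∷ α} p = cons z≤n z≤n (rebound (≺-refl p) (ℕₚ.≤-reflexive (head≡0 α p)))
    where
    head≡0 : ∀ {n} (α : Vec ℕ n) → ∣ α ∣ ≡ 0 → head₀ α ≡ 0
    head≡0 []         _ = refl
    head≡0 (zero ∷ _) _ = refl

  module Pieri (R : CommutativeRing 0ℓ 0ℓ) where
    open CommutativeRing R renaming (refl to ≈-refl; sym to ≈-sym; trans to ≈-trans; reflexive to ≈-reflexive)
    open Sums R
    open import Algebra.Properties.Monoid.Mult *-monoid using () renaming (×-homo-+ to ^-homo-*)
    open import Algebra.Properties.CommutativeSemigroup *-commutativeSemigroup using (interchange)
    open import Algebra.Definitions.RawSemiring (RawRing.rawSemiring rawRing) public using (_^_)
    open import Relation.Binary.Reasoning.Setoid setoid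

    -- Sequences stand for power series in one variable: `δ` is the series 1 and `_⋆_` the product.
    δ : ℕ → Carrier
    δ zero    = 1#
    δ (suc _) = 0#

    infixr 7 _⋆_
    _⋆_ : (ℕ → Carrier) → (ℕ → Carrier) → ℕ → Carrier
    (f ⋆ g) n = ∑ (elements (antidiagonal n)) (λ (a , b) → f a * g b)

    -- Once the induction hypothesis has expanded each product of terms, this collects everything
    -- into one sum over triples, to which a bijection applies.
    ∑-flatten : ∀ {A B C : Set} {P : A → Set} {Q : B → Set} {S : A → B → C → Set} (e : Enumeration P)
      (e′ : Enumeration Q)
                (e″ : ∀ a b → Enumeration (S a b)) (f : A → Carrier) (g : B → Carrier)
                    (h : A → B → C → Carrier) →
                (∀ {a b} → P a → Q b → f a * g b ≈ ∑ (elements (e″ a b)) (h a b)) →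
                ∑ (elements e) f * ∑ (elements e′) g ≈
                ∑ (elements (e ⊗ λ a → e′ ⊗ e″ a)) (λ (a , b , c) → h a b c)
    ∑-flatten e e′ e″ f g h fg≈ = begin
      ∑ (elements e) f * ∑ (elements e′) g  ≈⟨ ∑-*-∑ (elements e) (elements e′) f g ⟩
      ∑ (elements e) (λ a → ∑ (elements e′) (λ b → f a * g b))
        ≈⟨ ∑-cong (elements e) (λ a∈ → ∑-cong (elements e′) (λ b∈ → fg≈ (sound e a∈) (sound e′ b∈))) ⟩
      ∑ (elements e) (λ a → ∑ (elements e′) (λ b → ∑ (elements (e″ a b)) (h a b)))
        ≈⟨ ∑-cong (elements e) (λ {a} _ → ∑-⊗ e′ (e″ a) (λ (b , c) → h a b c)) ⟨
      ∑ (elements e) (λ a → ∑ (elements (e′ ⊗ e″ a)) (λ (b , c) → h a b c))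
        ≈⟨ ∑-⊗ e (λ a → e′ ⊗ e″ a) _ ⟨
      ∑ (elements (e ⊗ λ a → e′ ⊗ e″ a)) (λ (a , b , c) → h a b c) ∎

    -- Chains ∅ ≺ ⋯ ≺ μ with m steps, where w l s is the weight of an l-th step of size s.
    chains : (ℕ → ℕ → Carrier) → ∀ {n} → ℕ → Vec ℕ n → Carrier
    chains w zero    μ = δ ∣ μ ∣
    chains w (suc m) μ = ∑ (elements (below μ)) (λ κ → w m (∣ μ ∣ ∸ ∣ κ ∣) * chains w m κ)

    geometric : (ℕ → Carrier) → ℕ → ℕ → Carrier
    geometric z l s = z l ^ s

    -- The complete homogeneous symmetric polynomials in the first `m` variables, as a sequence in
    -- the degree.
    hom : (ℕ → Carrier) → ℕ → ℕ → Carrier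
    hom z zero    = δ
    hom z (suc m) = geometric z m ⋆ hom z m

    -- A horizontal strip opens at most one new row. The empty bottom row provides it, so vectors of
    -- a fixed length lose no term of the rule.
    pieri : ∀ z m {n} d (μ : Vec ℕ (suc n)) → bottom μ ≡ 0 →
            hom z m d * chains (geometric z) m μ ≈ ∑ (elements (above d μ)) (chains (geometric z) m)
    pieri z zero zero μ μ₀ = ≈-trans (*-identityˡ _) (base ∣ μ ∣ refl)
      where
      base : ∀ s → ∣ μ ∣ ≡ s → δ s ≈ ∑ (elements (above 0 μ)) (δ ∘ ∣_∣)
      base zero eq = ≈-trans (≈-reflexive (sym (cong δ eq)))
        (≈-sym (∑-single (δ ∘ ∣_∣) (unique (above 0 μ))
          (complete (above 0 μ) (≺-refl eq , ℕₚ.n∸n≡0 ∣ μ ∣)) λ {ρ} ρ∈ ρ≢μ → ⊥-elim (ρ≢μ (sum≡0-unique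
            (trans (sym (cong (∣ ρ ∣ ∸_) eq)) (proj₂ (sound (above 0 μ) ρ∈))) eq))))
      base (suc s) eq = ≈-sym (∑-zero (elements (above 0 μ)) λ {ρ} ρ∈ →
        ≈-reflexive (δ≡0 (subst (_≤ ∣ ρ ∣) eq (interlace-sum (proj₁ (sound (above 0 μ) ρ∈))))))
        where
        δ≡0 : ∀ {m n} → suc m ≤ n → δ n ≡ 0#
        δ≡0 (s≤s _) = refl
    pieri z zero (suc d) μ μ₀ = ≈-trans (zeroˡ _) (≈-sym (∑-zero (elements (above (suc d) μ)) λ {ρ} ρ∈ →
      ≈-reflexive (δ≡0 ∣ ρ ∣ {∣ μ ∣} (proj₂ (sound (above (suc d) μ) ρ∈)))))
      where
      δ≡0 : ∀ m {n} → m ∸ n ≡ suc d → δ m ≡ 0#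
      δ≡0 zero    {zero}  ()
      δ≡0 zero    {suc n} ()
      δ≡0 (suc m) _ = refl
    pieri z (suc m) d μ μ₀ = begin
      hom z (suc m) d * chains w (suc m) μ
        ≈⟨ ∑-flatten (antidiagonal d) (below μ) (λ (a , c) κ → above c κ) _ _
             (λ (a , c) κ κ′ → z m ^ (a ℕ+ (∣ μ ∣ ∸ ∣ κ ∣)) * chains w m κ′) (λ {(a , c)} {κ} p k → begin
               z m ^ a * hom z m c * (z m ^ (∣ μ ∣ ∸ ∣ κ ∣) * chains w m κ) ≈⟨ interchange _ _ _ _ ⟩
               z m ^ a * z m ^ (∣ μ ∣ ∸ ∣ κ ∣) * (hom z m c * chains w m κ)
                 ≈⟨ *-cong (≈-sym (^-homo-* (z m) a _)) (pieri z m c κ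
                      (ℕₚ.n≤0⇒n≡0 (ℕₚ.≤-trans (interlace-bottom k) (ℕₚ.≤-reflexive μ₀)))) ⟩
               z m ^ (a ℕ+ (∣ μ ∣ ∸ ∣ κ ∣)) * ∑ (elements (above c κ)) (chains w m) ≈⟨ ∑-*ˡ
                   (elements (above c κ)) _ _ ⟩
               _ ∎) ⟩
      ∑ (elements (antidiagonal d ⊗ λ (a , c) → below μ ⊗ above c))
        (λ ((a , c) , κ , κ′) → z m ^ (a ℕ+ (∣ μ ∣ ∸ ∣ κ ∣)) * chains w m κ′)
        ≈⟨ ∑-≅ left≅right (antidiagonal d ⊗ λ (a , c) → below μ ⊗ above c) (above d μ ⊗ below)
             (λ p → *-congʳ (≈-reflexive (cong (z m ^_) (exponent p)))) ⟩
      ∑ (elements (above d μ ⊗ below)) (λ (ρ , κ′) → z m ^ (∣ ρ ∣ ∸ ∣ κ′ ∣) * chains w m κ′)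
        ≈⟨ ∑-⊗ (above d μ) below _ ⟩
      ∑ (elements (above d μ)) (chains w (suc m)) ∎
      where
      w = geometric z
      open SchurLocal d μ μ₀

    module King (X X⁻¹ : ℕ → Carrier) (XX⁻¹≈1 : ∀ j → X j * X⁻¹ j ≈ 1#) where

      branches : ∀ {n} (μ : Vec ℕ (suc n)) → Enumeration (λ (ν , κ) → ν ≺ μ × ext κ ≺ ν)
      branches μ = below μ ⊗ belowExt

      -- The row bound of King tableaux is carried by the length of the vector: removing both
      -- letters of the largest pair has to leave a shape with one row fewer.
      symplectic : ∀ j → Vec ℕ j → Carrier
      symplectic zero    _ = 1#
      symplectic (suc j) μ = ∑ (elements (branches μ)) (λ (ν , κ) →
        X j ^ (∣ ν ∣ ∸ ∣ κ ∣) * X⁻¹ j ^ (∣ μ ∣ ∸ ∣ ν ∣) * symplectic j κ)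

      -- The complete homogeneous polynomials in `j` pairs of variables, grouped so that the
      -- recursion runs parallel to that of `symplectic`.
      hom± : ℕ → ℕ → Carrier
      hom± zero    = δ
      hom± (suc j) = (geometric X j ⋆ geometric X⁻¹ j) ⋆ hom± j

      -- Unlike `pieri`, this covers shapes that occupy all `j` rows; the vector length confines the
      -- added strip to those rows.
      pieri± : ∀ j d (μ : Vec ℕ j) →
               hom± j d * symplectic j μ ≈ ∑ (elements (downUp d μ)) (symplectic j ∘ proj₂)
      pieri± zero d [] = ≈-trans (*-identityʳ _) (lemma d)
        where
        lemma : ∀ d → δ d ≈ ∑ (elements (downUp d [])) (λ _ → 1#)
        lemma zero    = ≈-sym (∑-single (λ _ → 1#) (unique (downUp 0 []))
            (complete (downUp 0 []) {[] , []} ([] , [] , refl))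
                          λ { {[] , []} _ ≢ → ⊥-elim (≢ refl) })
        lemma (suc d) = ≈-sym (∑-zero (elements (downUp (suc d) [])) {λ _ → 1#}
            λ { {[] , []} ∈ → ⊥-elim (case (proj₂ (proj₂ (sound (downUp (suc d) []) ∈)))) })
          where
          case : ¬ (0 ≡ suc d)
          case ()
      pieri± (suc j) d μ = begin
        hom± (suc j) d * symplectic (suc j) μ
          ≈⟨ *-congʳ (∑-cong (elements (antidiagonal d)) λ {(e , c)} _ → ∑-*ʳ (elements (antidiagonal e)) _
            _) ⟩
        ∑ (elements (antidiagonal d)) (λ (e , c) →
          ∑ (elements (antidiagonal e)) (λ (a , b) → X j ^ a * X⁻¹ j ^ b * hom± j c)) * symplectic (suc j) μ
          ≈⟨ ∑-*ʳ (elements (antidiagonal d)) _ _ ⟩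
        ∑ (elements (antidiagonal d)) (λ (e , c) →
          ∑ (elements (antidiagonal e)) (λ (a , b) → X j ^ a * X⁻¹ j ^ b * hom± j c) * symplectic (suc j) μ)
          ≈⟨ ∑-cong (elements (antidiagonal d)) (λ {(e , c)} _ →
               ∑-flatten (antidiagonal e) (branches μ) (λ _ (ν , κ) → downUp c κ) _ _
                 (λ (a , b) (ν , κ) (σ , κ′) → wt (a ℕ+ (∣ ν ∣ ∸ ∣ κ ∣) , b ℕ+ (∣ μ ∣ ∸ ∣ ν ∣)) κ′)
                 (λ {(a , b)} {(ν , κ)} _ _ → begin
                   X j ^ a * X⁻¹ j ^ b * hom± j c * (X j ^ p ν κ * X⁻¹ j ^ q ν * symplectic j κ)
                     ≈⟨ interchange _ _ _ _ ⟩
                   X j ^ a * X⁻¹ j ^ b * (X j ^ p ν κ * X⁻¹ j ^ q ν) * (hom± j c * symplectic j κ)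
                     ≈⟨ *-cong (≈-trans (interchange _ _ _ _) (≈-sym
                       (*-cong (^-homo-* (X j) a _) (^-homo-* (X⁻¹ j) b _))))
                               (pieri± j c κ) ⟩
                   X j ^ (a ℕ+ p ν κ) * X⁻¹ j ^ (b ℕ+ q ν) * ∑ (elements (downUp c κ)) (symplectic j ∘ proj₂)
                     ≈⟨ ∑-*ˡ (elements (downUp c κ)) _ _ ⟩
                   _ ∎)) ⟩
        ∑ (elements (antidiagonal d)) (λ (e , c) → ∑ (elements (left′ (e , c))) (λ t → f ((e , c) , t)))
          ≈⟨ ∑-⊗ (antidiagonal d) left′ f ⟨
        ∑ (elements (antidiagonal d ⊗ left′)) f
          ≈⟨ ∑-≅ left≅middle (antidiagonal d ⊗ left′) (restrict middle (¬? ∘ raisable?)) {f} {g}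
               (λ {t@(_ , _ , _ , _ , κ′)} l → ≈-reflexive (cong (λ pq → wt pq κ′) (left-exponent l))) ⟩
        ∑ (elements (restrict middle (¬? ∘ raisable?))) g
          -- The two families are compared through their complements in `Middle`. Raising multiplies
          -- a weight by `X j * X⁻¹ j`.
          ≈⟨ ∑-exchange {P = Middle} middle {Raisable} {Lowerable} raisable? lowerable? g shift
            (λ {t@(_ , _ , _ , _ , κ′)} m →
               ≈-trans (cancel (exponent t) κ′) (≈-reflexive
                   (cong (λ pq → wt pq κ′) (shift-exponent {t} m)))) ⟩
        ∑ (elements (restrict middle (¬? ∘ lowerable?))) g
          ≈⟨ ∑-≅ middle≅right (restrict middle (¬? ∘ lowerable?)) (downUp d μ ⊗ (branches ∘ proj₂)) {g} {h}
               (λ {t@(_ , _ , _ , _ , κ′)} m → ≈-reflexive (cong (λ pq → wt pq κ′) (right-exponent m))) ⟩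
        ∑ (elements (downUp d μ ⊗ (branches ∘ proj₂))) h
          ≈⟨ ∑-⊗ (downUp d μ) (branches ∘ proj₂) h ⟩
        ∑ (elements (downUp d μ)) (symplectic (suc j) ∘ proj₂) ∎
        where
        open KingLocal d μ
        p : Vec ℕ (suc j) → Vec ℕ j → ℕ
        p ν κ = ∣ ν ∣ ∸ ∣ κ ∣
        q : Vec ℕ (suc j) → ℕ
        q ν = ∣ μ ∣ ∸ ∣ ν ∣
        wt : ℕ × ℕ → Vec ℕ j → Carrier
        wt (p , q) κ′ = X j ^ p * X⁻¹ j ^ q * symplectic j κ′
        left′ = λ (ec : ℕ × ℕ) → antidiagonal (proj₁ ec) ⊗ λ _ → branches μ ⊗ λ νκ → downUp (proj₂ ec)
            (proj₂ νκ)
        f : (ℕ × ℕ) × (ℕ × ℕ) × (Vec ℕ (suc j) × Vec ℕ j) × Vec ℕ j × Vec ℕ j → Carrier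
        f (_ , (a , b) , (ν , κ) , (σ , κ′)) = wt (a ℕ+ p ν κ , b ℕ+ q ν) κ′
        g : Shape × Shape × ℕ × Shape × Vec ℕ j → Carrier
        g t@(_ , _ , _ , _ , κ′) = wt (exponent t) κ′
        h : (Vec ℕ (suc j) × Vec ℕ (suc j)) × Vec ℕ (suc j) × Vec ℕ j → Carrier
        h ((ν , ϕ) , (ρ , κ′)) = wt (∣ ρ ∣ ∸ ∣ κ′ ∣ , ∣ ϕ ∣ ∸ ∣ ρ ∣) κ′
        cancel : ∀ pq κ′ → wt pq κ′ ≈ wt (suc (proj₁ pq) , suc (proj₂ pq)) κ′
        cancel (p , q) κ′ = *-congʳ (≈-sym (≈-trans (interchange _ _ _ _)
            (≈-trans (*-congʳ (XX⁻¹≈1 j)) (*-identityˡ _))))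

-- Laurent polynomials as a commutative ring

module LaurentPolynomials where

  open import Data.Nat.Base using (ℕ; zero; suc)
  open import Algebra.Properties.CommutativeSemigroup ℤₚ.+-commutativeSemigroup using () renaming
      (x∙yz≈y∙xz to ℤ-swap)

  module _ {k : ℕ} where
    private
      module L = RawRing (Laurent k)
      infixl 6 _⊕_ _⊖_

    _⊕_ _⊖_ : Vec ℤ k → Vec ℤ k → Vec ℤ k
    _⊕_ = Vec.zipWith ℤ._+_
    e ⊖ d = Vec.zipWith ℤ._-_ e d

    _⊙_ : ℤ × Vec ℤ k → ℤ × Vec ℤ k → ℤ × Vec ℤ k
    (c , d) ⊙ (c′ , d′) = c ℤ.* c′ , d ⊕ d′

    ⊙-comm : ∀ s t → s ⊙ t ≡ t ⊙ s
    ⊙-comm (c , d) (c′ , d′) = cong₂ _,_ (ℤₚ.*-comm c c′) (Vecₚ.zipWith-comm ℤₚ.+-comm d d′)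

    ⊙-assoc : ∀ s t u → (s ⊙ t) ⊙ u ≡ s ⊙ (t ⊙ u)
    ⊙-assoc (c , d) (c′ , d′) (c″ , d″) = cong₂ _,_ (ℤₚ.*-assoc c c′ c″)
        (Vecₚ.zipWith-assoc ℤₚ.+-assoc d d′ d″)

    coeff-++ : ∀ (p q : Terms k) e → coeff (p ++ q) e ≡ coeff p e ℤ.+ coeff q e
    coeff-++ []            q e = sym (ℤₚ.+-identityˡ _)
    coeff-++ ((c , d) ∷ p) q e = trans (cong (ℤ._+_ m) (coeff-++ p q e))
        (sym (ℤₚ.+-assoc m (coeff p e) (coeff q e)))
      where
      m : ℤ
      m = if does (Vecₚ.≡-dec ℤₚ._≟_ d e) then c else 0ℤ

    coeff-neg : ∀ (p : Terms k) e → coeff (L.- p) e ≡ ℤ.- coeff p e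
    coeff-neg []            e = refl
    coeff-neg ((c , d) ∷ p) e with does (Vecₚ.≡-dec ℤₚ._≟_ d e)
    ... | true  = trans (cong (ℤ._+_ (ℤ.- c)) (coeff-neg p e)) (sym (ℤₚ.neg-distrib-+ c (coeff p e)))
    ... | false = trans (cong (ℤ._+_ 0ℤ) (coeff-neg p e)) (sym (ℤₚ.neg-distrib-+ 0ℤ (coeff p e)))

    ⊕⇒⊖ : ∀ {n} (d d′ e : Vec ℤ n) → Vec.zipWith ℤ._+_ d d′ ≡ e → d′ ≡ Vec.zipWith ℤ._-_ e d
    ⊕⇒⊖ []      []       []      _    = refl
    ⊕⇒⊖ (a ∷ d) (b ∷ d′) (c ∷ e) refl = cong₂ _∷_
      (sym (trans (cong (ℤ._- a) (ℤₚ.+-comm a b)) (trans (ℤₚ.+-assoc b a (ℤ.- a))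
          (trans (cong (ℤ._+_ b) (ℤₚ.+-inverseʳ a)) (ℤₚ.+-identityʳ b)))))
      (⊕⇒⊖ d d′ _ refl)

    ⊖⇒⊕ : ∀ {n} (d d′ e : Vec ℤ n) → d′ ≡ Vec.zipWith ℤ._-_ e d → Vec.zipWith ℤ._+_ d d′ ≡ e
    ⊖⇒⊕ []      []       []      _    = refl
    ⊖⇒⊕ (a ∷ d) (b ∷ d′) (c ∷ e) refl = cong₂ _∷_
      (trans (ℤ-swap a c (ℤ.- a)) (trans (cong (ℤ._+_ c) (ℤₚ.+-inverseʳ a)) (ℤₚ.+-identityʳ c)))
      (⊖⇒⊕ d d′ _ refl)

    -- Multiplication by a monomial translates exponents, which is invertible, so each coefficient
    -- comes from a single coefficient of `q`. Hence the product, although defined on lists,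
    -- respects equality of coefficients.
    coeff-map : ∀ c d (q : Terms k) e → coeff (map ((c , d) ⊙_) q) e ≡ c ℤ.* coeff q (e ⊖ d)
    coeff-map c d []             e = sym (ℤₚ.*-zeroʳ c)
    coeff-map c d ((c′ , d′) ∷ q) e = trans (cong₂ ℤ._+_ term (coeff-map c d q e))
        (sym (ℤₚ.*-distribˡ-+ c _ _))
      where
      term : (if does (Vecₚ.≡-dec ℤₚ._≟_ (d ⊕ d′) e) then c ℤ.* c′ else 0ℤ) ≡
             c ℤ.* (if does (Vecₚ.≡-dec ℤₚ._≟_ d′ (e ⊖ d)) then c′ else 0ℤ)
      term with Vecₚ.≡-dec ℤₚ._≟_ (d ⊕ d′) e | Vecₚ.≡-dec ℤₚ._≟_ d′ (e ⊖ d)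
      ... | yes _ | yes _ = refl
      ... | no _  | no _  = sym (ℤₚ.*-zeroʳ c)
      ... | yes p | no ¬q with () ← ¬q (⊕⇒⊖ d d′ e p)
      ... | no ¬p | yes q with () ← ¬p (⊖⇒⊕ d d′ e q)

    -- The product recurses on its left factor; this is the same recursion on the right factor. It
    -- reorders terms, so it is stated for coefficients, and commutativity follows from it.
    coeff-*-∷ : ∀ (q : Terms k) t p e → coeff (q L.* (t ∷ p)) e ≡ coeff (map (t ⊙_) q) e ℤ.+ coeff (q L.* p) e
    coeff-*-∷ []      t p e = refl
    coeff-*-∷ (s ∷ q) t p e = begin
      coeff (s ⊙ t ∷ map (s ⊙_) p ++ q L.* (t ∷ p)) e
        ≡⟨ cong (ℤ._+_ [st]) (coeff-++ (map (s ⊙_) p) (q L.* (t ∷ p)) e) ⟩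
      [st] ℤ.+ (coeff (map (s ⊙_) p) e ℤ.+ coeff (q L.* (t ∷ p)) e)
        ≡⟨ cong (λ z → [st] ℤ.+ (coeff (map (s ⊙_) p) e ℤ.+ z)) (coeff-*-∷ q t p e) ⟩
      [st] ℤ.+ (coeff (map (s ⊙_) p) e ℤ.+ (coeff (map (t ⊙_) q) e ℤ.+ coeff (q L.* p) e))
        ≡⟨ cong (ℤ._+_ [st]) (ℤ-swap (coeff (map (s ⊙_) p) e) (coeff (map (t ⊙_) q) e) _) ⟩
      [st] ℤ.+ (coeff (map (t ⊙_) q) e ℤ.+ (coeff (map (s ⊙_) p) e ℤ.+ coeff (q L.* p) e))
        ≡⟨ cong (λ z → [st] ℤ.+ (coeff (map (t ⊙_) q) e ℤ.+ z)) (coeff-++ (map (s ⊙_) p) (q L.* p) e) ⟨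
      [st] ℤ.+ (coeff (map (t ⊙_) q) e ℤ.+ coeff (map (s ⊙_) p ++ q L.* p) e)
        ≡⟨ ℤₚ.+-assoc [st] (coeff (map (t ⊙_) q) e) _ ⟨
      [st] ℤ.+ coeff (map (t ⊙_) q) e ℤ.+ coeff (map (s ⊙_) p ++ q L.* p) e
        ≡⟨ cong (λ z → z ℤ.+ coeff (map (t ⊙_) q) e ℤ.+ coeff (map (s ⊙_) p ++ q L.* p) e)
             (cong (λ u → if does (Vecₚ.≡-dec ℤₚ._≟_ (proj₂ u) e) then proj₁ u else 0ℤ) (⊙-comm s t)) ⟩
      coeff (t ⊙ s ∷ map (t ⊙_) q) e ℤ.+ coeff (map (s ⊙_) p ++ q L.* p) e ∎
      where
      open ≡.≡-Reasoning
      [st] : ℤ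
      [st] = if does (Vecₚ.≡-dec ℤₚ._≟_ (proj₂ (s ⊙ t)) e) then proj₁ (s ⊙ t) else 0ℤ

    *ᴸ-comm : ∀ p q → p L.* q L.≈ q L.* p
    *ᴸ-comm []      q e = sym (coeff-[] q)
      where
      coeff-[] : ∀ q → coeff (q L.* []) e ≡ 0ℤ
      coeff-[] []      = refl
      coeff-[] (_ ∷ q) = coeff-[] q
    *ᴸ-comm (t ∷ p) q e = trans (coeff-++ (map (t ⊙_) q) (p L.* q) e)
      (trans (cong (ℤ._+_ (coeff (map (t ⊙_) q) e)) (*ᴸ-comm p q e)) (sym (coeff-*-∷ q t p e)))

    *ᴸ-congˡ : ∀ p {q r} → q L.≈ r → p L.* q L.≈ p L.* r
    *ᴸ-congˡ []            q≈r e = refl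
    *ᴸ-congˡ ((c , d) ∷ p) {q} {r} q≈r e = begin
      coeff (map ((c , d) ⊙_) q ++ p L.* q) e       ≡⟨ coeff-++ (map ((c , d) ⊙_) q) _ e ⟩
      coeff (map ((c , d) ⊙_) q) e ℤ.+ coeff (p L.* q) e
        ≡⟨ cong₂ ℤ._+_ (trans (coeff-map c d q e) (trans (cong (ℤ._*_ c) (q≈r (e ⊖ d)))
          (sym (coeff-map c d r e))))
                       (*ᴸ-congˡ p q≈r e) ⟩
      coeff (map ((c , d) ⊙_) r) e ℤ.+ coeff (p L.* r) e ≡⟨ coeff-++ (map ((c , d) ⊙_) r) _ e ⟨
      coeff (map ((c , d) ⊙_) r ++ p L.* r) e       ∎
      where open ≡.≡-Reasoning

    -- Equal coefficients do not give lists of equal structure, so the left factor cannot be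
    -- replaced by recursion. Commutativity moves it to the right, where `*ᴸ-congˡ` applies.
    *ᴸ-cong : ∀ {p p′ q q′} → p L.≈ p′ → q L.≈ q′ → p L.* q L.≈ p′ L.* q′
    *ᴸ-cong {p} {p′} {q} {q′} p≈ q≈ e = trans (*ᴸ-congˡ p q≈ e)
      (trans (*ᴸ-comm p q′ e) (trans (*ᴸ-congˡ q′ p≈ e) (*ᴸ-comm q′ p′ e)))

    *ᴸ-distribʳ : ∀ r p q → (p ++ q) L.* r ≡ p L.* r ++ q L.* r
    *ᴸ-distribʳ r []      q = refl
    *ᴸ-distribʳ r (t ∷ p) q = trans (cong (map (t ⊙_) r ++_) (*ᴸ-distribʳ r p q))
        (sym (Listₚ.++-assoc (map (t ⊙_) r) _ _))

    map-⊙ : ∀ t q r → map (t ⊙_) q L.* r ≡ map (t ⊙_) (q L.* r)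
    map-⊙ t []      r = refl
    map-⊙ t (s ∷ q) r = trans (cong₂ _++_ (trans (Listₚ.map-cong (⊙-assoc t s) r) (Listₚ.map-∘ r))
        (map-⊙ t q r))
      (sym (Listₚ.map-++ (t ⊙_) (map (s ⊙_) r) (q L.* r)))

    *ᴸ-assoc : ∀ p q r → (p L.* q) L.* r ≡ p L.* (q L.* r)
    *ᴸ-assoc []      q r = refl
    *ᴸ-assoc (t ∷ p) q r = trans (*ᴸ-distribʳ r (map (t ⊙_) q) (p L.* q))
        (cong₂ _++_ (map-⊙ t q r) (*ᴸ-assoc p q r))

    *ᴸ-identityˡ : ∀ p → L.1# L.* p ≡ p
    *ᴸ-identityˡ p = trans (Listₚ.++-identityʳ _)
      (trans (Listₚ.map-cong (λ (c , d) → cong₂ _,_ (ℤₚ.*-identityˡ c)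
          (Vecₚ.zipWith-identityˡ ℤₚ.+-identityˡ d)) p) (Listₚ.map-id p))

    laurentRing : CommutativeRing 0ℓ 0ℓ
    laurentRing = record
      { Carrier = L.Carrier ; _≈_ = L._≈_ ; _+_ = L._+_ ; _*_ = L._*_ ; -_ = L.-_ ; 0# = L.0# ; 1# = L.1#
      ; isCommutativeRing = record
        { isRing = record
          { +-isAbelianGroup = record
            { isGroup = record
              { isMonoid = record
                { isSemigroup = record
                  { isMagma = record
                    { isEquivalence = record
                      { refl = λ e → refl ; sym = λ p e → sym (p e) ; trans = λ p q e → trans (p e) (q e) }
                    ; ∙-cong = λ {p} {p′} {q} {q′} p≈ q≈ e →
                        trans (coeff-++ p q e) (trans (cong₂ ℤ._+_ (p≈ e) (q≈ e)) (sym (coeff-++ p′ q′ e)))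
                    }
                  ; assoc = λ p q r e → cong (λ p → coeff p e) (Listₚ.++-assoc p q r)
                  }
                ; identity = (λ p e → refl) , (λ p e → cong (λ p → coeff p e) (Listₚ.++-identityʳ p))
                }
              ; inverse = (λ p e → trans (coeff-++ (L.- p) p e)
                            (trans (cong (ℤ._+ coeff p e) (coeff-neg p e)) (ℤₚ.+-inverseˡ (coeff p e))))
                        , (λ p e → trans (coeff-++ p (L.- p) e)
                            (trans (cong (ℤ._+_ (coeff p e)) (coeff-neg p e)) (ℤₚ.+-inverseʳ (coeff p e))))
              ; ⁻¹-cong = λ {p} {q} p≈q e → trans (coeff-neg p e)
                  (trans (cong ℤ.-_ (p≈q e)) (sym (coeff-neg q e)))
              }
            ; comm = λ p q e → trans (coeff-++ p q e) (trans (ℤₚ.+-comm (coeff p e) _) (sym (coeff-++ q p e)))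
            }
          ; *-cong = λ {p} {p′} {q} {q′} → *ᴸ-cong {p} {p′} {q} {q′}
          ; *-assoc = λ p q r e → cong (λ p → coeff p e) (*ᴸ-assoc p q r)
          ; *-identity = (λ p e → cong (λ p → coeff p e) (*ᴸ-identityˡ p))
                       , (λ p e → trans (*ᴸ-comm p L.1# e) (cong (λ p → coeff p e) (*ᴸ-identityˡ p)))
          ; distrib = (λ p q r e → trans (*ᴸ-comm p (q ++ r) e)
              (trans (cong (λ p → coeff p e) (*ᴸ-distribʳ p q r))
                         (trans (coeff-++ (q L.* p) (r L.* p) e) (trans
                             (cong₂ ℤ._+_ (*ᴸ-comm q p e) (*ᴸ-comm r p e))
                           (sym (coeff-++ (p L.* q) (p L.* r) e))))))
                    , (λ r p q e → cong (λ p → coeff p e) (*ᴸ-distribʳ r p q))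
          }
        ; *-comm = *ᴸ-comm
        }
      }

    x*x⁻¹ : ∀ (i : Fin k) → x i L.* x⁻¹ i ≡ L.1#
    x*x⁻¹ i = cong (λ d → (1ℤ , d) ∷ []) (units i)
      where
      zeros : ∀ n → Vec.zipWith ℤ._+_ (Vec.replicate n 0ℤ) (Vec.replicate n 0ℤ) ≡ Vec.replicate n 0ℤ
      zeros zero    = refl
      zeros (suc n) = cong (0ℤ ∷_) (zeros n)
      units : ∀ {n} (i : Fin n) → Vec.zipWith ℤ._+_ (unit 0ℤ 1ℤ i) (unit 0ℤ -1ℤ i) ≡ Vec.replicate n 0ℤ
      units {suc n} Fin.zero = cong (0ℤ ∷_) (zeros n)
      units (Fin.suc i) = cong (0ℤ ∷_) (units i)

-- Power series that factor variable by variable, and the kernel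

module SeparableSeries where

  open import Data.Nat.Base using (ℕ; zero; suc; _∸_; _≤_; z≤n; s≤s; _≡ᵇ_) renaming (_+_ to _ℕ+_)
  open FiniteSums
  open LocalIdentities
  open PieriRules
  open Enumeration

  module TopDown (M : CommutativeMonoid 0ℓ 0ℓ) where
    open CommutativeMonoid M renaming (refl to ≈-refl; sym to ≈-sym; trans to ≈-trans)
    open import Algebra.Definitions.RawMonoid rawMonoid using (sum)
    open import Algebra.Properties.CommutativeSemigroup commutativeSemigroup using (x∙yz≈y∙xz)

    -- Letters are removed from the largest down, whereas products over `Fin` start at the smallest
    -- index. `sum≈topDown` reconciles the two orders.
    topDown : (ℕ → Carrier) → ℕ → Carrier
    topDown f zero    = ε
    topDown f (suc m) = f m ∙ topDown f m

    topDown-suc : ∀ f m → topDown f (suc m) ≈ f 0 ∙ topDown (f ∘ suc) m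
    topDown-suc f zero    = ≈-refl
    topDown-suc f (suc m) = ≈-trans (∙-congˡ (topDown-suc f m)) (x∙yz≈y∙xz _ _ _)

    sum≈topDown : ∀ m f → sum {m} (f ∘ toℕ) ≈ topDown f m
    sum≈topDown zero    f = ≈-refl
    sum≈topDown (suc m) f = ≈-trans (∙-congˡ (sum≈topDown m (f ∘ suc))) (≈-sym (topDown-suc f m))

  module Separable (R : CommutativeRing 0ℓ 0ℓ) where
    open CommutativeRing R renaming (refl to ≈-refl; sym to ≈-sym; trans to ≈-trans; reflexive to ≈-reflexive)
    open Sums R
    open Pieri R
    open import Algebra.Properties.CommutativeSemigroup *-commutativeSemigroup using (interchange; x∙yz≈y∙xz)
    open import Relation.Binary.Reasoning.Setoid setoid

    infix 4 _≋_
    _≋_ : (ℕ → Carrier) → (ℕ → Carrier) → Set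
    f ≋ g = ∀ n → f n ≈ g n

    ⋆-cong : ∀ {f f′ g g′} → f ≋ f′ → g ≋ g′ → f ⋆ g ≋ f′ ⋆ g′
    ⋆-cong f≋ g≋ n = ∑-cong (elements (antidiagonal n)) λ {(a , b)} _ → *-cong (f≋ a) (g≋ b)

    ⋆-comm : ∀ f g → f ⋆ g ≋ g ⋆ f
    ⋆-comm f g n = ∑-≅ swap (antidiagonal n) (antidiagonal n) λ _ → *-comm _ _
      where
      swap : (λ (a , b) → a ℕ+ b ≡ n) ≅ (λ (a , b) → a ℕ+ b ≡ n)
      swap = record { to = λ (a , b) → b , a ; from = λ (a , b) → b , a
                    ; to-∈ = λ {(a , b)} p → trans (ℕₚ.+-comm b a) p ; from-∈ = λ {(a , b)} p → trans
                        (ℕₚ.+-comm b a) p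
                    ; from∘to = λ _ → refl ; to∘from = λ _ → refl }

    ⋆-assoc : ∀ f g h → (f ⋆ g) ⋆ h ≋ f ⋆ (g ⋆ h)
    ⋆-assoc f g h n = begin
      ∑ (elements (antidiagonal n)) (λ (e , c) → (f ⋆ g) e * h c)
        ≈⟨ ∑-cong (elements (antidiagonal n)) (λ {(e , c)} _ → ∑-*ʳ (elements (antidiagonal e)) (h c) _) ⟩
      ∑ (elements (antidiagonal n)) (λ (e , c) → ∑ (elements (antidiagonal e)) (λ (a , b) → f a * g b * h c))
        ≈⟨ ∑-⊗ (antidiagonal n) (antidiagonal ∘ proj₁) _ ⟨
      ∑ (elements (antidiagonal n ⊗ (antidiagonal ∘ proj₁))) (λ ((e , c) , (a , b)) → f a * g b * h c)
        ≈⟨ ∑-≅ reassoc (antidiagonal n ⊗ (antidiagonal ∘ proj₁)) (antidiagonal n ⊗ (antidiagonal ∘ proj₂))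
          (λ _ → *-assoc _ _ _) ⟩
      ∑ (elements (antidiagonal n ⊗ (antidiagonal ∘ proj₂))) (λ ((a , e) , (b , c)) → f a * (g b * h c))
        ≈⟨ ∑-⊗ (antidiagonal n) (antidiagonal ∘ proj₂) _ ⟩
      ∑ (elements (antidiagonal n)) (λ (a , e) → ∑ (elements (antidiagonal e))
        (λ (b , c) → f a * (g b * h c)))
        ≈⟨ ∑-cong (elements (antidiagonal n)) (λ {(a , e)} _ → ∑-*ˡ (elements (antidiagonal e)) (f a) _) ⟨
      ∑ (elements (antidiagonal n)) (λ (a , e) → f a * (g ⋆ h) e) ∎
      where
      reassoc : (λ ((e , c) , (a , b)) → e ℕ+ c ≡ n × a ℕ+ b ≡ e) ≅
          (λ ((a , e) , (b , c)) → a ℕ+ e ≡ n × b ℕ+ c ≡ e)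
      reassoc = record
        { to = λ ((e , c) , (a , b)) → (a , b ℕ+ c) , (b , c)
        ; from = λ ((a , e) , (b , c)) → (a ℕ+ b , c) , (a , b)
        ; to-∈ = λ { {((_ , c) , (a , b))} (refl , refl) → sym (ℕₚ.+-assoc a b c) , refl }
        ; from-∈ = λ { {((a , _) , (b , c))} (refl , refl) → ℕₚ.+-assoc a b c , refl }
        ; from∘to = λ { {((_ , c) , (a , b))} (refl , refl) → refl }
        ; to∘from = λ { {((a , _) , (b , c))} (refl , refl) → refl }
        }

    -- The one-variable monomial with coefficient `c` in degree `m`.
    spike : Carrier → ℕ → ℕ → Carrier
    spike c m n = if m ≡ᵇ n then c else 0#

    spike-≡ : ∀ c m → spike c m m ≈ c
    spike-≡ c zero    = ≈-refl
    spike-≡ c (suc m) = spike-≡ c m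

    spike-≢ : ∀ c {m n} → m ≢ n → spike c m n ≈ 0#
    spike-≢ c {zero}  {zero}  m≢n = ⊥-elim (m≢n refl)
    spike-≢ c {zero}  {suc n} _   = ≈-refl
    spike-≢ c {suc m} {zero}  _   = ≈-refl
    spike-≢ c {suc m} {suc n} m≢n = spike-≢ c (m≢n ∘ cong suc)

    spike-cong : ∀ {c d} m → c ≈ d → spike c m ≋ spike d m
    spike-cong m c≈d n with m ≡ᵇ n
    ... | true  = c≈d
    ... | false = ≈-refl

    δ≋spike : δ ≋ spike 1# 0
    δ≋spike zero    = ≈-refl
    δ≋spike (suc n) = ≈-refl

    spike-⋆ : ∀ c m d n → spike c m ⋆ spike d n ≋ spike (c * d) (m ℕ+ n)
    spike-⋆ c m d n l with m ℕ+ n ℕₚ.≟ l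
    ... | yes refl = ≈-trans
      (∑-single (λ (a , b) → spike c m a * spike d n b) (unique (antidiagonal (m ℕ+ n)))
          (complete (antidiagonal (m ℕ+ n)) {m , n} refl) zeros)
      (≈-trans (*-cong (spike-≡ c m) (spike-≡ d n)) (≈-sym (spike-≡ (c * d) (m ℕ+ n))))
      where
      zeros : ∀ {b} → b ∈ elements (antidiagonal (m ℕ+ n)) → b ≢ (m , n) → spike c m (proj₁ b) * spike d n
          (proj₂ b) ≈ 0#
      zeros {a , b} ab∈ ab≢ with m ℕₚ.≟ a
      ... | no m≢a = ≈-trans (*-congʳ (spike-≢ c m≢a)) (zeroˡ _)
      ... | yes refl = ⊥-elim (ab≢ (cong (m ,_) (ℕₚ.+-cancelˡ-≡ m b n (sound (antidiagonal (m ℕ+ n)) ab∈))))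
    ... | no m+n≢l = ≈-trans (∑-zero (elements (antidiagonal l)) zeros) (≈-sym (spike-≢ (c * d) m+n≢l))
      where
      zeros : ∀ {b} → b ∈ elements (antidiagonal l) → spike c m (proj₁ b) * spike d n (proj₂ b) ≈ 0#
      zeros {a , b} ab∈ with m ℕₚ.≟ a | n ℕₚ.≟ b
      ... | no m≢a   | _        = ≈-trans (*-congʳ (spike-≢ c m≢a)) (zeroˡ _)
      ... | yes _    | no n≢b   = ≈-trans (*-congˡ (spike-≢ d n≢b)) (zeroʳ _)
      ... | yes refl | yes refl = ⊥-elim (m+n≢l (sound (antidiagonal l) ab∈))

    ⋆-identityˡ : ∀ f → δ ⋆ f ≋ f
    ⋆-identityˡ f n = ≈-trans
      (∑-single (λ (a , b) → δ a * f b) (unique (antidiagonal n)) (complete (antidiagonal n) {0 , n} refl)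
        λ { {zero , b} ab∈ ab≢ → ⊥-elim (ab≢ (cong (0 ,_) (sound (antidiagonal n) ab∈))) ; {suc a , b} _ _ →
            zeroˡ _ })
      (*-identityˡ (f n))

    ⋆-commutativeMonoid : CommutativeMonoid 0ℓ 0ℓ
    ⋆-commutativeMonoid = record
      { Carrier = ℕ → Carrier ; _≈_ = _≋_ ; _∙_ = _⋆_ ; ε = δ
      ; isCommutativeMonoid = record
        { isMonoid = record
          { isSemigroup = record
            { isMagma = record
              { isEquivalence = record { refl = λ _ → ≈-refl ; sym = λ p n → ≈-sym (p n) ; trans = λ p q n →
                  ≈-trans (p n) (q n) }
              ; ∙-cong = ⋆-cong }
            ; assoc = ⋆-assoc }
          ; identity = ⋆-identityˡ , λ f n → ≈-trans (⋆-comm f δ n) (⋆-identityˡ f n) }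
        ; comm = ⋆-comm }
      }

    -- The coefficients of a product of series, the j-th of which involves the j-th variable only.
    separable : ∀ {k} → (Fin k → ℕ → Carrier) → Vec ℕ k → Carrier
    separable φ []      = 1#
    separable φ (a ∷ α) = φ Fin.zero a * separable (φ ∘ Fin.suc) α

    separable-cong : ∀ {k} {φ ψ : Fin k → ℕ → Carrier} → (∀ j → φ j ≋ ψ j) → ∀ α → separable φ α ≈ separable
        ψ α
    separable-cong φ≋ψ []      = ≈-refl
    separable-cong φ≋ψ (a ∷ α) = *-cong (φ≋ψ Fin.zero a) (separable-cong (φ≋ψ ∘ Fin.suc) α)

    ∑-product : ∀ {A B C : Set} (h : A → B → C) (xs : List A) (ys : List B) (f : C → Carrier) →
                ∑ (cartesianProductWith h xs ys) f ≈ ∑ xs (λ a → ∑ ys (λ b → f (h a b)))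
    ∑-product h []       ys f = ≈-refl
    ∑-product h (x ∷ xs) ys f = ≈-trans (∑-++ (map (h x) ys) _ f)
      (+-cong (≈-reflexive (∑-map (h x) ys f)) (∑-product h xs ys f))

    ∑-antidiagonal : ∀ n (f : ℕ × ℕ → Carrier) → ∑ (upTo (suc n)) (λ b → f (b , n ∸ b)) ≡ ∑
      (elements (antidiagonal n)) f
    ∑-antidiagonal n f = sym (∑-map (λ b → b , n ∸ b) (upTo (suc n)) f)

    -- An exponent vector splits independently in each coordinate, so the sum over splittings is a
    -- product of one-variable convolutions.
    splits-separable : ∀ {k} (φ ψ : Fin k → ℕ → Carrier) α →
      ∑ (splits α) (λ (β , γ) → separable φ β * separable ψ γ) ≈ separable (λ j → φ j ⋆ ψ j) α
    splits-separable φ ψ []      = ≈-trans (+-identityʳ _) (*-identityˡ 1#)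
    splits-separable φ ψ (a ∷ α) = begin
      ∑ (splits (a ∷ α)) (λ (β , γ) → separable φ β * separable ψ γ)
        ≈⟨ ∑-product _ (upTo (suc a)) (splits α) _ ⟩
      ∑ (upTo (suc a)) (λ b → ∑ (splits α) (λ (β , γ) →
        φ₀ b * separable φ₊ β * (ψ₀ (a ∸ b) * separable ψ₊ γ)))
        ≈⟨ ∑-cong (upTo (suc a)) (λ {b} _ → ≈-trans (∑-cong (splits α) (λ _ → interchange _ _ _ _))
          (≈-sym (∑-*ˡ (splits α) (φ₀ b * ψ₀ (a ∸ b)) _))) ⟩
      ∑ (upTo (suc a)) (λ b → φ₀ b * ψ₀ (a ∸ b) * ∑ (splits α) (λ (β , γ) → separable φ₊ β * separable ψ₊ γ))
        ≈⟨ ∑-*ʳ (upTo (suc a)) _ _ ⟨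
      ∑ (upTo (suc a)) (λ b → φ₀ b * ψ₀ (a ∸ b)) * ∑ (splits α) (λ (β , γ) → separable φ₊ β * separable ψ₊ γ)
        ≈⟨ *-cong (≈-reflexive (∑-antidiagonal a (λ (b , c) → φ₀ b * ψ₀ c))) (splits-separable φ₊ ψ₊ α) ⟩
      (φ₀ ⋆ ψ₀) a * separable (λ j → φ₊ j ⋆ ψ₊ j) α ∎
      where
      φ₀ = φ Fin.zero
      ψ₀ = ψ Fin.zero
      φ₊ = φ ∘ Fin.suc
      ψ₊ = ψ ∘ Fin.suc

    -- The factors of a series in the `i`-th variable alone: `f` there and the series 1 in every
    -- other variable.
    axis : ∀ {k} → Fin k → (ℕ → Carrier) → Fin k → ℕ → Carrier
    axis Fin.zero    f Fin.zero    = f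
    axis Fin.zero    f (Fin.suc _) = δ
    axis (Fin.suc _) f Fin.zero    = δ
    axis (Fin.suc i) f (Fin.suc j) = axis i f j

    axis-cong : ∀ {k} (i : Fin k) {f g} → f ≋ g → ∀ j → axis i f j ≋ axis i g j
    axis-cong Fin.zero    f≋g Fin.zero    = f≋g
    axis-cong Fin.zero    f≋g (Fin.suc j) _ = ≈-refl
    axis-cong (Fin.suc i) f≋g Fin.zero    _ = ≈-refl
    axis-cong (Fin.suc i) f≋g (Fin.suc j) = axis-cong i f≋g j

    axis-⋆ : ∀ {k} (i : Fin k) f g j → axis i f j ⋆ axis i g j ≋ axis i (f ⋆ g) j
    axis-⋆ Fin.zero    f g Fin.zero    _ = ≈-refl
    axis-⋆ Fin.zero    f g (Fin.suc j)   = ⋆-identityˡ δ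
    axis-⋆ (Fin.suc i) f g Fin.zero      = ⋆-identityˡ δ
    axis-⋆ (Fin.suc i) f g (Fin.suc j)   = axis-⋆ i f g j

    axis-δ : ∀ {k} (i : Fin k) j → axis i δ j ≡ δ
    axis-δ Fin.zero    Fin.zero    = refl
    axis-δ Fin.zero    (Fin.suc j) = refl
    axis-δ (Fin.suc i) Fin.zero    = refl
    axis-δ (Fin.suc i) (Fin.suc j) = axis-δ i j

    -- The last factor is the indicator that all exponents except the `i`-th vanish; it is the same
    -- for every `f` and can be pulled out of sums.
    separable-axis : ∀ {k} (i : Fin k) f α →
                     separable (axis i f) α ≈ f (Vec.lookup α i) * separable (axis i (λ _ → 1#)) α
    separable-axis Fin.zero    f (a ∷ α) = *-congˡ (≈-sym (*-identityˡ _))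
    separable-axis (Fin.suc i) f (a ∷ α) = ≈-trans (*-congˡ (separable-axis i f α)) (x∙yz≈y∙xz _ _ _)

    lookup≤sum : ∀ {k} (α : Vec ℕ k) i → Vec.lookup α i ≤ Vec.sum α
    lookup≤sum (a ∷ α) Fin.zero    = ℕₚ.m≤m+n a _
    lookup≤sum (a ∷ α) (Fin.suc i) = ℕₚ.≤-trans (lookup≤sum α i) (ℕₚ.m≤n+m _ a)

    module _ (k : ℕ) where
      open PowerSeries rawRing k using (Series; monomial; const; var; product) renaming
        (_≈_ to _≈ˢ_; _*_ to _*ˢ_; 1# to 1ˢ; _^_ to _^ˢ_; _-_ to _-ˢ_; _⁻¹ to _⁻¹ˢ)
      open import Algebra.Properties.AbelianGroup +-abelianGroup using (⁻¹-involutive; ⁻¹-∙-comm)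

      monomial-separable : ∀ {n} (β α : Vec ℕ n) →
        (if does (Vecₚ.≡-dec ℕₚ._≟_ β α) then 1# else 0#) ≈ separable (λ j → spike 1# (Vec.lookup β j)) α
      monomial-separable []      []      = ≈-refl
      monomial-separable (b ∷ β) (a ∷ α) with b ≡ᵇ a
      ... | true  = ≈-trans (monomial-separable β α) (≈-sym (*-identityˡ _))
      ... | false = ≈-sym (zeroˡ _)

      one-separable : 1ˢ ≈ˢ separable (λ _ → δ)
      one-separable α = ≈-trans (monomial-separable (Vec.replicate k 0) α)
        (separable-cong (λ j n → ≈-trans (≈-reflexive
            (cong (λ m → spike 1# m n) (Vecₚ.lookup-replicate j 0))) (≈-sym (δ≋spike n))) α)

      var-separable : ∀ i → var i ≈ˢ separable (axis i (spike 1# 1))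
      var-separable i α = ≈-trans (monomial-separable (unit 0 1 i) α) (separable-cong (lookup-unit i) α)
        where
        lookup-unit : ∀ {n} (i j : Fin n) → spike 1# (Vec.lookup (unit 0 1 i) j) ≋ axis i (spike 1# 1) j
        lookup-unit Fin.zero    Fin.zero    n = ≈-refl
        lookup-unit Fin.zero    (Fin.suc j) n =
          ≈-trans (≈-reflexive (cong (λ m → spike 1# m n) (Vecₚ.lookup-replicate j 0))) (≈-sym (δ≋spike n))
        lookup-unit (Fin.suc i) Fin.zero    n = ≈-sym (δ≋spike n)
        lookup-unit (Fin.suc i) (Fin.suc j) n = lookup-unit i j n

      *ˢ-separable : ∀ {F G φ ψ} → F ≈ˢ separable φ → G ≈ˢ separable ψ → F *ˢ G ≈ˢ separable (λ j → φ j ⋆ ψ j)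
      *ˢ-separable {φ = φ} {ψ} F≈ G≈ α = ≈-trans
        (∑-cong (splits α) (λ {(β , γ)} _ → *-cong (F≈ β) (G≈ γ))) (splits-separable φ ψ α)

      const-*ˢ : ∀ c F → const c *ˢ F ≈ˢ λ α → c * F α
      const-*ˢ c F α = shift α (λ α → F α)
        where
        shift : ∀ {n} (α : Vec ℕ n) (F : Vec ℕ n → Carrier) →
          ∑ (splits α) (λ (β , γ) → (if does (Vecₚ.≡-dec ℕₚ._≟_ (Vec.replicate n 0) β) then c else 0#) * F
            γ) ≈ c * F α
        shift []      F = +-identityʳ _
        shift {suc n} (a ∷ α) F = begin
          ∑ (splits (a ∷ α)) (λ (β , γ) → (if does (Vecₚ.≡-dec ℕₚ._≟_ (0 ∷ Vec.replicate n 0) β) then c else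
            0#) * F γ)
            ≈⟨ ∑-product _ (upTo (suc a)) (splits α) _ ⟩
          ∑ (upTo (suc a)) g
            ≈⟨ ∑-single g (Uniqueₚ.upTo⁺ (suc a)) (∈ₚ.∈-upTo⁺ {suc a} {0} (s≤s z≤n))
                 (λ { {zero} _ b≢0 → ⊥-elim (b≢0 refl) ; {suc b} _ _ → ∑-zero (splits α) (λ _ → zeroˡ _) }) ⟩
          g 0 ≈⟨ shift α (λ α → F (a ∷ α)) ⟩
          c * F (a ∷ α) ∎
          where
          g : ℕ → Carrier
          g b = ∑ (splits α) (λ (β , γ) →
            (if does (Vecₚ.≡-dec ℕₚ._≟_ (0 ∷ Vec.replicate n 0) (b ∷ β)) then c else 0#) * F (a ∸ b ∷ γ))

      -- The series being summed are the powers of `u`, and the `n`-th power is concentrated in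
      -- degree `n` of the `i`-th variable. So only `n` equal to the `i`-th exponent contributes,
      -- and it lies within the truncation because it is at most the total degree.
      geometric-separable : ∀ c i → (1ˢ -ˢ const c *ˢ var i) ⁻¹ˢ ≈ˢ separable (axis i (c ^_))
      geometric-separable c i α = begin
        ∑ (upTo (suc (Vec.sum α))) (λ n → ((1ˢ -ˢ (1ˢ -ˢ u)) ^ˢ n) α)
          ≈⟨ ∑-cong (upTo (suc (Vec.sum α))) (λ {n} _ → ≈-trans (power n α)
            (separable-axis i (spike (c ^ n) n) α)) ⟩
        ∑ (upTo (suc (Vec.sum α))) (λ n → spike (c ^ n) n αᵢ * rest) ≈⟨ ∑-*ʳ (upTo (suc (Vec.sum α))) rest _ ⟨
        ∑ (upTo (suc (Vec.sum α))) (λ n → spike (c ^ n) n αᵢ) * rest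
          ≈⟨ *-congʳ (≈-trans (∑-single (λ n → spike (c ^ n) n αᵢ) (Uniqueₚ.upTo⁺ _)
            (∈ₚ.∈-upTo⁺ (s≤s (lookup≤sum α i)))
               (λ {n} _ n≢ → spike-≢ (c ^ n) n≢)) (spike-≡ (c ^ αᵢ) αᵢ)) ⟩
        c ^ αᵢ * rest ≈⟨ separable-axis i (c ^_) α ⟨
        separable (axis i (c ^_)) α ∎
        where
        u = const c *ˢ var i
        αᵢ = Vec.lookup α i
        rest = separable (axis i (λ _ → 1#)) α
        double-negation : ∀ x y → x + - (x + - y) ≈ y
        double-negation x y = begin
          x + - (x + - y)      ≈⟨ +-congˡ (≈-sym (⁻¹-∙-comm x (- y))) ⟩
          x + (- x + - (- y))  ≈⟨ +-assoc x (- x) _ ⟨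
          x + - x + - (- y)    ≈⟨ +-cong (-‿inverseʳ x) (⁻¹-involutive y) ⟩
          0# + y               ≈⟨ +-identityˡ y ⟩
          y                    ∎
        u-separable : 1ˢ -ˢ (1ˢ -ˢ u) ≈ˢ separable (axis i (spike c 1))
        u-separable α = begin
          _ ≈⟨ double-negation (1ˢ α) (u α) ⟩
          u α ≈⟨ const-*ˢ c (var i) α ⟩
          c * var i α ≈⟨ *-congˡ (≈-trans (var-separable i α) (separable-axis i (spike 1# 1) α)) ⟩
          c * (spike 1# 1 (Vec.lookup α i) * _) ≈⟨ *-assoc _ _ _ ⟨
          c * spike 1# 1 (Vec.lookup α i) * _ ≈⟨ *-congʳ (scale (Vec.lookup α i)) ⟩
          spike c 1 (Vec.lookup α i) * _ ≈⟨ separable-axis i (spike c 1) α ⟨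
          separable (axis i (spike c 1)) α ∎
          where
          scale : ∀ n → c * spike 1# 1 n ≈ spike c 1 n
          scale n with 1 ≡ᵇ n
          ... | true  = *-identityʳ c
          ... | false = zeroʳ c
        power : ∀ n → (1ˢ -ˢ (1ˢ -ˢ u)) ^ˢ n ≈ˢ separable (axis i (spike (c ^ n) n))
        power zero α = ≈-trans (one-separable α)
          (separable-cong (λ j n → ≈-trans (≈-reflexive (cong (λ f → f n) (sym (axis-δ i j))))
              (axis-cong i δ≋spike j n)) α)
        power (suc n) α = ≈-trans (*ˢ-separable {φ = axis i (spike c 1)} {axis i (spike (c ^ n) n)}
            u-separable (power n) α)
          (separable-cong (λ j m → ≈-trans (axis-⋆ i (spike c 1) (spike (c ^ n) n) j m)
            (axis-cong i (spike-⋆ c 1 (c ^ n) n) j m)) α)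

      private
        module T = TopDown ⋆-commutativeMonoid
        open import Algebra.Definitions.RawMonoid (CommutativeMonoid.rawMonoid ⋆-commutativeMonoid) using ()
            renaming (sum to ⋆-product)

      product-separable : ∀ {n} (F : Fin n → Series) (φ : Fin n → Fin k → ℕ → Carrier) →
        (∀ i → F i ≈ˢ separable (φ i)) → product F ≈ˢ separable (λ j → ⋆-product (λ i → φ i j))
      product-separable {zero}  F φ F≈ = one-separable
      product-separable {suc n} F φ F≈ = *ˢ-separable {φ = φ Fin.zero} (F≈ Fin.zero)
        (product-separable (F ∘ Fin.suc) (φ ∘ Fin.suc) (F≈ ∘ Fin.suc))

      ⋆-product-axis : ∀ {n} (f : ℕ → Carrier) (j : Fin n) → ⋆-product (λ i → axis i f j) ≋ f
      ⋆-product-axis {suc n} f Fin.zero a =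
        ≈-trans (⋆-cong {f} (λ _ → ≈-refl) (units n) a) (≈-trans (⋆-comm f δ a) (⋆-identityˡ f a))
        where
        units : ∀ n → ⋆-product {n} (λ _ → δ) ≋ δ
        units zero    _ = ≈-refl
        units (suc n) a = ≈-trans (⋆-identityˡ _ a) (units n a)
      ⋆-product-axis {suc n} f (Fin.suc j) a = ≈-trans (⋆-identityˡ _ a) (⋆-product-axis f j a)

      ⋆-product-cong : ∀ {n} {φ ψ : Fin n → ℕ → Carrier} → (∀ i → φ i ≋ ψ i) → ⋆-product φ ≋ ⋆-product ψ
      ⋆-product-cong {zero}  φ≋ _ = ≈-refl
      ⋆-product-cong {suc n} φ≋ = ⋆-cong (φ≋ Fin.zero) (⋆-product-cong (φ≋ ∘ Fin.suc))

      axis-product : ∀ {n} (i : Fin k) (f : Fin n → ℕ → Carrier) j →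
                     ⋆-product (λ l → axis i (f l) j) ≋ axis i (⋆-product f) j
      axis-product {zero} i f j a = ≈-reflexive (cong (λ g → g a) (sym (axis-δ i j)))
      axis-product {suc n} i f j a = ≈-trans
        (⋆-cong {axis i (f Fin.zero) j} (λ _ → ≈-refl) (axis-product i (f ∘ Fin.suc) j) a)
        (axis-⋆ i (f Fin.zero) (⋆-product (f ∘ Fin.suc)) j a)

      -- The factor with index `i` involves only the `i`-th variable. In each coordinate the product
      -- over `i` therefore collapses to one factor, which has the same form for all coordinates.
      kernel-separable : (X X⁻¹ : Fin k → Carrier) →
        product (λ i → product (λ j → (1ˢ -ˢ const (X j) *ˢ var i) ⁻¹ˢ *ˢ (1ˢ -ˢ const (X⁻¹ j) *ˢ var i)
            ⁻¹ˢ)) ≈ˢ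
        separable (λ _ → ⋆-product (λ j → (X j ^_) ⋆ (X⁻¹ j ^_)))
      kernel-separable X X⁻¹ α = ≈-trans
        (product-separable _ (λ i l → ⋆-product (λ j → axis i (f j) l))
            (λ i → product-separable _ (λ j → axis i (f j))
          (λ j β → ≈-trans
            (*ˢ-separable {φ = axis i (X j ^_)} {axis i (X⁻¹ j ^_)} (geometric-separable (X j) i)
                (geometric-separable (X⁻¹ j) i) β)
            (separable-cong (axis-⋆ i (X j ^_) (X⁻¹ j ^_)) β))) α)
        (separable-cong (λ l a → ≈-trans
          (⋆-product-cong (λ i → axis-product i f l) a) (⋆-product-axis (⋆-product f) l a)) α)
        where
        f : Fin k → ℕ → Carrier
        f j = (X j ^_) ⋆ (X⁻¹ j ^_)

-- Tableaux as chains of shapes: removing the largest letter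

module Fillings where

  open import Data.List.Relation.Binary.Prefix.Heterogeneous using (Prefix; []; _∷_)
  open All using (All; []; _∷_)
  open import Data.List.Relation.Unary.AllPairs using ([]; _∷_)
  open import Data.List.Relation.Unary.Linked as Linked using (Linked; []; [-]; _∷_)
  open import Data.Nat.Base using (ℕ; zero; suc; _∸_; _≤_; _<_; z≤n; s≤s; _≡ᵇ_; _*_; _+_)
  open FiniteSums
  open Interlacing
  open LocalIdentities
  open PieriRules
  open SeparableSeries
  open Enumeration

  module _ {n : ℕ} where

    Rows : ℕ → Set
    Rows = Vec (List (Fin n))

    topRow : ∀ {K} → Rows K → List (Fin n)
    topRow []      = []
    topRow (s ∷ _) = s

    -- Tableaux with entries below m, the top row being number r: c = 0 gives the semistandard tableaux and,
    -- for r = 0, c = 2 the King tableaux.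
    data Filling (c r m : ℕ) : ∀ {K} → Vec ℕ K → Rows K → Set where
      []   : Filling c r m [] []
      cons : ∀ {K l row} {μ : Vec ℕ K} {T : Rows K} → length row ≡ l → Linked Fin._≤_ row →
             All (λ e → toℕ e < m) row → All (λ e → r * c ≤ toℕ e) row → Prefix Fin._>_ (topRow T) row →
             Filling c (suc r) m μ T → Filling c r m (l ∷ μ) (row ∷ T)

    module Letter (e : Fin n) where
      m : ℕ
      m = toℕ e

      Small : List (Fin n) → Set
      Small = All (λ x → toℕ x < m)

      small : List (Fin n) → List (Fin n)
      small = filter (λ x → toℕ x ℕₚ.<? m)

      small-++ : ∀ {r} b → Small r → small (r ++ replicate b e) ≡ r
      small-++ {r} b r< = trans (Listₚ.filter-++ _ r (replicate b e))
        (trans (cong₂ _++_ (Listₚ.filter-all _ r<) (Listₚ.filter-none _ (Allₚ.replicate⁺ b (ℕₚ.n≮n m))))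
            (Listₚ.++-identityʳ r))

      all-e : ∀ {x r} → ¬ (toℕ x < m) → Linked Fin._≤_ (x ∷ r) → All (λ y → toℕ y < suc m) (x ∷ r) →
              x ∷ r ≡ replicate (suc (length r)) e × small (x ∷ r) ≡ []
      all-e {x} {[]} ≮m [-] (<sm ∷ []) =
        cong (_∷ []) (Finₚ.toℕ-injective (ℕₚ.≤-antisym (ℕₚ.≤-pred <sm) (ℕₚ.≮⇒≥ ≮m))) ,
        Listₚ.filter-reject (λ x → toℕ x ℕₚ.<? m) ≮m
      all-e {x} {y ∷ r} ≮m (x≤y ∷ r≤) (<sm ∷ r<) =
        let (r≡ , r∅) = all-e (λ y<m → ≮m (ℕₚ.≤-<-trans x≤y y<m)) r≤ r<
        in cong₂ _∷_ (Finₚ.toℕ-injective (ℕₚ.≤-antisym (ℕₚ.≤-pred <sm) (ℕₚ.≮⇒≥ ≮m))) r≡ ,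
           trans (Listₚ.filter-reject (λ x → toℕ x ℕₚ.<? m) ≮m) r∅

      split : ∀ {r} → Linked Fin._≤_ r → All (λ y → toℕ y < suc m) r →
              small r ++ replicate (length r ∸ length (small r)) e ≡ r
      split {[]}    _  _                = refl
      split {x ∷ r} r≤ r<@(_ ∷ r<′) = go (toℕ x ℕₚ.<? m)
        where
        go : Dec (toℕ x < m) → small (x ∷ r) ++ replicate (length (x ∷ r) ∸ length (small (x ∷ r))) e ≡ x ∷ r
        go (yes x<m) = trans
          (cong (λ s → s ++ replicate (length (x ∷ r) ∸ length s) e)
              (Listₚ.filter-accept (λ y → toℕ y ℕₚ.<? m) x<m))
          (cong (x ∷_) (split (Linked.tail r≤) r<′))
        go (no x≮m) = let (r≡ , r∅) = all-e x≮m r≤ r< in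
          trans (cong (λ s → s ++ replicate (length (x ∷ r) ∸ length s) e) r∅) (sym r≡)

      small-Small : ∀ r → Small (small r)
      small-Small r = Allₚ.all-filter (λ x → toℕ x ℕₚ.<? m) r

      linked-++ : ∀ {r} b → Linked Fin._≤_ r → Small r → Linked Fin._≤_ (r ++ replicate b e)
      linked-++ zero          []        _          = []
      linked-++ (suc zero)    []        _          = [-]
      linked-++ (suc (suc b)) []        _          = ℕₚ.≤-refl ∷ linked-++ (suc b) [] []
      linked-++ zero          [-]       _          = [-]
      linked-++ (suc b)       [-]       (p ∷ [])   = ℕₚ.<⇒≤ p ∷ linked-++ (suc b) [] []
      linked-++ b             (q ∷ r≤)  (p ∷ ps)   = q ∷ linked-++ b r≤ ps

      linked-small : ∀ {r} → Linked Fin._≤_ r → Linked Fin._≤_ (small r)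
      linked-small = LinkedP.filter⁺ (λ x → toℕ x ℕₚ.<? m) ℕₚ.≤-trans
        where import Data.List.Relation.Unary.Linked.Properties as LinkedP

      -- The copies of `e` in the lower row must stand under letters smaller than `e`, hence under
      -- the small part of the upper row. The inequality between lengths is the interlacing
      -- condition between the two rows.
      prefix⁺ : ∀ {s r} b c → Small r → Prefix Fin._>_ s r → length s + b ≤ length r →
                Prefix Fin._>_ (s ++ replicate b e) (r ++ replicate c e)
      prefix⁺         zero    c _        []       _       = []
      prefix⁺ {r = x ∷ r} (suc b) c (p ∷ ps) []       (s≤s q) = p ∷ prefix⁺ b c ps [] q
      prefix⁺         b       c (_ ∷ ps) (q ∷ qs) (s≤s t) = q ∷ prefix⁺ b c ps qs t

      prefix⁻ : ∀ s r b c → Small s → Small r → Prefix Fin._>_ (s ++ replicate b e) (r ++ replicate c e) →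
                Prefix Fin._>_ s r × length s + b ≤ length r
      prefix⁻ []      r       zero    c       _        _        _        = [] , z≤n
      prefix⁻ []      []      (suc b) (suc c) _        _        (q ∷ _)  = ⊥-elim (ℕₚ.n≮n m q)
      prefix⁻ []      (y ∷ r) (suc b) c       _        (_ ∷ ps) (_ ∷ qs) = [] , s≤s
          (proj₂ (prefix⁻ [] r b c [] ps qs))
      prefix⁻ (x ∷ s) []      b       (suc c) (p ∷ _)  _        (q ∷ _)  = ⊥-elim (ℕₚ.<-asym p q)
      prefix⁻ (x ∷ s) (y ∷ r) b       c       (_ ∷ ps) (_ ∷ ps′) (q ∷ qs) =
        let (t , l) = prefix⁻ s r b c ps ps′ qs in q ∷ t , s≤s l

      insert : ∀ {K} → Vec ℕ K → Rows K → Rows K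
      insert []      []        = []
      insert (l ∷ μ) (row ∷ T) = (row ++ replicate (l ∸ length row) e) ∷ insert μ T

      strip : ∀ {K} → Rows K → Rows K
      strip = Vec.map small

      topRow-strip : ∀ {K} (T : Rows K) → topRow (strip T) ≡ small (topRow T)
      topRow-strip []      = refl
      topRow-strip (_ ∷ _) = refl

      -- The last of `K` rows starting with number `r` has number `r + K ∸ 1`; its bound is at most
      -- `m`, so the letter may stand in every row. Adding `c` on both sides avoids the subtraction.
      Fits : ℕ → ℕ → ℕ → Set
      Fits c r K = (r + K) * c ≤ m + c

      private
        fits-suc : ∀ {c r K} → Fits c r (suc K) → Fits c (suc r) K
        fits-suc {c} {r} {K} = subst (λ x → x * c ≤ m + c) (ℕₚ.+-suc r K)

        fits-row : ∀ {c r K} → Fits c r (suc K) → r * c ≤ m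
        fits-row {c} {r} {K} f = ℕₚ.+-cancelʳ-≤ c (r * c) m (ℕₚ.≤-trans
          (ℕₚ.≤-trans (ℕₚ.≤-reflexive (ℕₚ.+-comm (r * c) c))
              (ℕₚ.*-monoˡ-≤ c (ℕₚ.≤-trans (s≤s (ℕₚ.m≤m+n r K)) (ℕₚ.≤-reflexive (sym (ℕₚ.+-suc r K)))))) f)

        topRow-split : ∀ {c r K} {μ : Vec ℕ K} {T} → Filling c r (suc m) μ T →
                       small (topRow T) ++ replicate (length (topRow T) ∸ length (small (topRow T))) e ≡
                           topRow T
        topRow-split []                  = refl
        topRow-split (cons _ lk s _ _ _) = split lk s

        topRow-length : ∀ {c r m K} {μ : Vec ℕ K} {T} → Filling c r m μ T → length (topRow T) ≡ head₀ μ
        topRow-length []                 = refl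
        topRow-length (cons l _ _ _ _ _) = l

      insert-filling : ∀ {c r u K} {κ μ : Vec ℕ K} {T} → Fits c r K → Interlace u κ μ → Filling c r m κ T →
                       Filling c r (suc m) μ (insert μ T)
      insert-filling f [] [] = []
      insert-filling {c} {r} {K = suc K} {μ = l ∷ μ} {row ∷ T} f (cons p q i) (cons refl lk s lo pr F) = cons
        (trans (Listₚ.length-++ row) (trans (cong (length row +_) (Listₚ.length-replicate (l ∸ length row)))
            (ℕₚ.m+[n∸m]≡n p)))
        (linked-++ _ lk s)
        (Allₚ.++⁺ (All.map ℕₚ.m<n⇒m<1+n s) (Allₚ.replicate⁺ (l ∸ length row) (ℕₚ.n<1+n m)))
        (Allₚ.++⁺ lo (Allₚ.replicate⁺ (l ∸ length row) (fits-row {c} {r} {K} f)))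
        (prefix i F pr)
        (insert-filling (fits-suc {c} {r} f) i F)
        where
        prefix : ∀ {K κ} {μ : Vec ℕ K} {T : Rows K} → Interlace (length row) κ μ → Filling c (suc r) m κ T →
                 Prefix Fin._>_ (topRow T) row →
                 Prefix Fin._>_ (topRow (insert μ T)) (row ++ replicate (l ∸ length row) e)
        prefix [] [] pr = []
        prefix {μ = l′ ∷ _} (cons p′ q′ _) (cons refl _ _ _ _ _) pr =
          prefix⁺ _ _ s pr (ℕₚ.≤-trans (ℕₚ.≤-reflexive (ℕₚ.m+[n∸m]≡n p′)) q′)

      strip-filling : ∀ {c r u K} {μ : Vec ℕ K} {T} → head₀ μ ≤ u → Filling c r (suc m) μ T →
                      Interlace u (Vec.map length (strip T)) μ × Filling c r m (Vec.map length (strip T))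
                          (strip T)
      strip-filling ≤u [] = [] , []
      strip-filling {c} {r} {μ = l ∷ μ} {row ∷ T} ≤u (cons refl lk s lo pr F) =
        let (pr′ , len) = prefix⁻ (small (topRow T)) (small row) _ _ (small-Small (topRow T))
                (small-Small row)
                            (subst₂ (Prefix Fin._>_) (sym (topRow-split F)) (sym (split lk s)) pr)
            top≤ = ℕₚ.≤-trans (ℕₚ.≤-reflexive (sym (topRow-length F)))
                     (ℕₚ.≤-trans (ℕₚ.m≤n+m∸n (length (topRow T)) (length (small (topRow T)))) len)
            (i , F′) = strip-filling top≤ F
        in cons (Listₚ.length-filter _ row) ≤u i ,
           cons refl (linked-small lk) (small-Small row) (Allₚ.filter⁺ _ lo)
             (subst (λ s → Prefix Fin._>_ s (small row)) (sym (topRow-strip T)) pr′) F′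

      strip-insert : ∀ {c r K} {κ μ : Vec ℕ K} {T} → Filling c r m κ T → strip (insert μ T) ≡ T
      strip-insert {μ = []}    []                 = refl
      strip-insert {μ = l ∷ μ} (cons _ _ s _ _ F) = cong₂ _∷_ (small-++ _ s) (strip-insert F)

      insert-strip : ∀ {c r K} {μ : Vec ℕ K} {T} → Filling c r (suc m) μ T → insert μ (strip T) ≡ T
      insert-strip []                     = refl
      insert-strip (cons refl lk s _ _ F) = cong₂ _∷_ (split lk s) (insert-strip F)

      filling-shape : ∀ {c r m K} {μ : Vec ℕ K} {T : Rows K} → Filling c r m μ T → Vec.map length T ≡ μ
      filling-shape []                 = refl
      filling-shape (cons l _ _ _ _ F) = cong₂ _∷_ l (filling-shape F)

      -- The cells of the largest letter form a horizontal strip, and every strip arises because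
      -- `Fits` keeps the row bound from interfering.
      insertion : ∀ {c r K} → Fits c r K → (μ : Vec ℕ K) →
                  (λ (κ , T) → κ ≺ μ × Filling c r m κ T) ≅ Filling c r (suc m) μ
      insertion f μ = record
        { to      = λ (κ , T) → insert μ T
        ; from    = λ T → Vec.map length (strip T) , strip T
        ; to-∈    = λ (i , F) → insert-filling f i F
        ; from-∈  = strip-filling ℕₚ.≤-refl
        ; from∘to = λ {(κ , T)} (_ , F) → trans (cong (λ T → Vec.map length T , T) (strip-insert {μ = μ} F))
                                                (cong (_, T) (filling-shape F))
        ; to∘from = insert-strip
        }

    extT : ∀ {K} → Rows K → Rows (suc K)
    extT []        = [] ∷ []
    extT (row ∷ T) = row ∷ extT T

    unextT : ∀ {K} → Rows (suc K) → Rows K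
    unextT (_ ∷ [])          = []
    unextT (row ∷ T@(_ ∷ _)) = row ∷ unextT T

    unextT-extT : ∀ {K} (T : Rows K) → unextT (extT T) ≡ T
    unextT-extT []          = refl
    unextT-extT (_ ∷ [])    = refl
    unextT-extT (s ∷ t ∷ T) = cong (s ∷_) (unextT-extT (t ∷ T))

    extT-filling : ∀ {c r m K} {κ : Vec ℕ K} {T} → Filling c r m κ T → Filling c r m (ext κ) (extT T)
    extT-filling [] = cons refl [] [] [] [] []
    extT-filling (cons l lk s lo pr []) = cons l lk s lo [] (extT-filling [])
    extT-filling (cons l lk s lo pr F@(cons _ _ _ _ _ _)) = cons l lk s lo pr (extT-filling F)

    -- The bottom row has number `r + K`, so an entry there would be at least `(r + K) * c` and yet
    -- below `m`. Hence that row is empty.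
    unextT-filling : ∀ {c r m K} {κ : Vec ℕ (suc K)} {T} → m ≤ (r + K) * c → Filling c r m κ T →
                     (Filling c r m (unext κ) (unextT T) × ext (unext κ) ≡ κ) × extT (unextT T) ≡ T
    unextT-filling {r = r} m≤ (cons {row = []} refl lk s lo pr []) = ([] , refl) , refl
    unextT-filling {c} {r} {K = zero} m≤ (cons {row = x ∷ row} refl lk (s ∷ _) (lo ∷ _) pr []) =
      ⊥-elim (ℕₚ.<⇒≱ s (ℕₚ.≤-trans m≤ (ℕₚ.≤-trans (ℕₚ.≤-reflexive (cong (_* c) (ℕₚ.+-identityʳ r))) lo)))
    unextT-filling {c} {r} {m} {suc K} m≤ (cons {row = row} l lk s lo pr F@(cons _ _ _ _ _ G)) =
      let ((F′ , κ≡) , T≡) = unextT-filling (subst (λ x → m ≤ x * c) (ℕₚ.+-suc r K) m≤) F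
      in (cons l lk s lo (prefix G pr) F′ , cong (_ ∷_) κ≡) , cong (row ∷_) T≡
      where
      prefix : ∀ {K c r m} {s : List (Fin n)} {κ : Vec ℕ K} {T : Rows K} → Filling c r m κ T → Prefix
          Fin._>_ s row →
               Prefix Fin._>_ (topRow (unextT (s ∷ T))) row
      prefix []                 pr = []
      prefix (cons _ _ _ _ _ _) pr = pr

    -- The point where the row bound on entries turns into the loss of a row in the recursion of
    -- `symplectic`.
    emptyBottom : ∀ {c m K} → m ≤ K * c → (ν : Vec ℕ (suc K)) →
                  (λ ((κ , T) : Vec ℕ K × Rows K) → ext κ ≺ ν × Filling c 0 m κ T) ≅
                  (λ ((κ , T) : Vec ℕ (suc K) × Rows (suc K)) → κ ≺ ν × Filling c 0 m κ T)
    emptyBottom m≤ ν = record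
      { to      = λ (κ , T) → ext κ , extT T
      ; from    = λ (κ , T) → unext κ , unextT T
      ; to-∈    = λ (i , F) → i , extT-filling F
      ; from-∈  = λ (i , F) → let ((F′ , κ≡) , _) = unextT-filling m≤ F in subst (_≺ ν) (sym κ≡) i , F′
      ; from∘to = λ {(κ , T)} _ → cong₂ _,_ (unext-ext κ) (unextT-extT T)
      ; to∘from = λ (i , F) → let ((F′ , κ≡) , T≡) = unextT-filling m≤ F in cong₂ _,_ κ≡ T≡
      }

    content : ℕ → List (Fin n) → ℕ
    content l []      = 0
    content l (x ∷ L) = (if toℕ x ≡ᵇ l then 1 else 0) + content l L

    entries : ∀ {K} → Rows K → List (Fin n)
    entries T = concat (Vec.toList T)

    content-++ : ∀ l L L′ → content l (L ++ L′) ≡ content l L + content l L′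
    content-++ l []      L′ = refl
    content-++ l (x ∷ L) L′ = trans (cong (_ +_) (content-++ l L L′))
        (sym (ℕₚ.+-assoc (if toℕ x ≡ᵇ l then 1 else 0) _ _))

    ≡ᵇ-refl : ∀ m → (m ≡ᵇ m) ≡ true
    ≡ᵇ-refl zero    = refl
    ≡ᵇ-refl (suc m) = ≡ᵇ-refl m

    ≡ᵇ-≢ : ∀ {m l} → m ≢ l → (m ≡ᵇ l) ≡ false
    ≡ᵇ-≢ {zero}  {zero}  m≢l = ⊥-elim (m≢l refl)
    ≡ᵇ-≢ {zero}  {suc l} _   = refl
    ≡ᵇ-≢ {suc m} {zero}  _   = refl
    ≡ᵇ-≢ {suc m} {suc l} m≢l = ≡ᵇ-≢ (m≢l ∘ cong suc)

    content-none : ∀ {l L} → All (λ x → toℕ x ≢ l) L → content l L ≡ 0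
    content-none []       = refl
    content-none (p ∷ ps) rewrite ≡ᵇ-≢ p = content-none ps

    content-replicate : ∀ e b → content (toℕ e) (replicate b e) ≡ b
    content-replicate e zero    = refl
    content-replicate e (suc b) rewrite ≡ᵇ-refl (toℕ e) = cong suc (content-replicate e b)

    module _ (e : Fin n) where
      open Letter e

      content-insert-old : ∀ {c r u K} {κ μ : Vec ℕ K} {T} l → l < m → Interlace u κ μ → Filling c r m κ T →
                           content l (entries (insert μ T)) ≡ content l (entries T)
      content-insert-old l l<m [] [] = refl
      content-insert-old {μ = a ∷ μ} {row ∷ T} l l<m (cons _ _ i) (cons _ _ s _ _ F) = begin
        content l ((row ++ replicate b e) ++ entries (insert μ T)) ≡⟨ content-++ l (row ++ replicate b e) _ ⟩
        content l (row ++ replicate b e) + content l (entries (insert μ T))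
          ≡⟨ cong₂ _+_ (trans (content-++ l row _) (trans (cong (content l row +_)
               (content-none (Allₚ.replicate⁺ b (λ m≡l → ℕₚ.<⇒≢ l<m (sym m≡l))))) (ℕₚ.+-identityʳ _)))
               (content-insert-old l l<m i F) ⟩
        content l row + content l (entries T) ≡⟨ content-++ l row _ ⟨
        content l (row ++ entries T) ∎
        where
        open ≡.≡-Reasoning
        b = a ∸ length row

      content-insert-new : ∀ {c r u K} {κ μ : Vec ℕ K} {T} → Interlace u κ μ → Filling c r m κ T →
                           content m (entries (insert μ T)) + ∣ κ ∣ ≡ ∣ μ ∣
      content-insert-new [] [] = refl
      content-insert-new {κ = a′ ∷ κ} {a ∷ μ} {row ∷ T} (cons p _ i) (cons refl _ s _ _ F) = begin
        content m ((row ++ replicate b e) ++ entries (insert μ T)) + (length row + ∣ κ ∣)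
          ≡⟨ cong (_+ (length row + ∣ κ ∣)) (trans (content-++ m (row ++ replicate b e) _) (cong (_+ new)
               (trans (content-++ m row _) (cong₂ _+_ (content-none (All.map ℕₚ.<⇒≢ s))
                   (content-replicate e b))))) ⟩
        b + new + (length row + ∣ κ ∣) ≡⟨ regroup b new (length row) ∣ κ ∣ ⟩
        (b + length row) + (new + ∣ κ ∣) ≡⟨ cong₂ _+_ (ℕₚ.m∸n+n≡m p) (content-insert-new i F) ⟩
        a + ∣ μ ∣ ∎
        where
        open ≡.≡-Reasoning
        open import Data.Nat.Tactic.RingSolver using (solve-∀)
        b = a ∸ length row
        new = content m (entries (insert μ T))
        regroup : ∀ a b c d → a + b + (c + d) ≡ (a + c) + (b + d)
        regroup = solve-∀

      content-insert : ∀ {c r u K} {κ μ : Vec ℕ K} {T} → Interlace u κ μ → Filling c r m κ T →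
                       content m (entries (insert μ T)) ≡ ∣ μ ∣ ∸ ∣ κ ∣
      content-insert {κ = κ} {μ} {T} i F = trans (sym (ℕₚ.m+n∸n≡m _ ∣ κ ∣))
          (cong (_∸ ∣ κ ∣) (content-insert-new i F))

  module Branching (R : CommutativeRing 0ℓ 0ℓ) (w : ℕ → ℕ → CommutativeRing.Carrier R) (n : ℕ) where
    open CommutativeRing R using (Carrier; _≈_; 1#; *-commutativeMonoid; *-cong; *-congˡ; +-identityʳ; setoid)
      renaming (_*_ to _·_; refl to ≈-refl; sym to ≈-sym; trans to ≈-trans; reflexive to ≈-reflexive)
    open Sums R
    open Pieri R
    open TopDown *-commutativeMonoid
    open import Relation.Binary.Reasoning.Setoid setoid

    -- The weight `w` is an arbitrary function of letter and multiplicity. Powers of variables give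
    -- Schur polynomials, and indicators of a prescribed multiplicity extract coefficients.
    contentWeight : ℕ → List (Fin n) → Carrier
    contentWeight m L = topDown (λ l → w l (content l L)) m

    topDown-cong : ∀ {f g : ℕ → Carrier} m → (∀ l → l < m → f l ≈ g l) → topDown f m ≈ topDown g m
    topDown-cong zero    f≈g = ≈-refl
    topDown-cong (suc m) f≈g = *-cong (f≈g m (ℕₚ.n<1+n m))
        (topDown-cong m (λ l l<m → f≈g l (ℕₚ.m<n⇒m<1+n l<m)))

    contentWeight-insert : ∀ (e : Fin n) {c r K} {κ μ : Vec ℕ K} {T} → κ ≺ μ → Filling c r (toℕ e) κ T →
      contentWeight (suc (toℕ e)) (entries (Letter.insert e μ T)) ≈
      w (toℕ e) (∣ μ ∣ ∸ ∣ κ ∣) · contentWeight (toℕ e) (entries T)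
    contentWeight-insert e i F = *-cong (≈-reflexive (cong (w (toℕ e)) (content-insert e i F)))
      (topDown-cong (toℕ e) (λ l l<m → ≈-reflexive (cong (w l) (content-insert-old e l l<m i F))))

    -- The enumeration is packed with its sum because one recursion over the letters produces both.
    Counted : ∀ {K} → ℕ → ℕ → Vec ℕ K → Carrier → Set
    Counted c m μ s = Σ[ E ∈ Enumeration (Filling {n} c 0 m μ) ] ∑ (elements E) (contentWeight m ∘ entries)
        ≈ s

    counted-insert : ∀ {c K} (e : Fin n) → Letter.Fits e c 0 K → (μ : Vec ℕ K) →
      (E : Enumeration (λ (κ , T) → κ ≺ μ × Filling c 0 (toℕ e) κ T)) → ∀ {s} →
      ∑ (elements E) (λ (κ , T) → w (toℕ e) (∣ μ ∣ ∸ ∣ κ ∣) · contentWeight (toℕ e) (entries T)) ≈ s →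
      Counted c (suc (toℕ e)) μ s
    counted-insert e fits μ E ≈s = transport (Letter.insertion e fits μ) E , ≈-trans
      (≈-reflexive (∑-map _ (elements E) _))
      (≈-trans (∑-cong (elements E) (λ κT∈ → let (i , F) = sound E κT∈ in contentWeight-insert e i F)) ≈s)

    ∑-counted : ∀ {K c m} {P : Vec ℕ K → Set} (e : Enumeration P) {s : Vec ℕ K → Carrier}
      (rec : ∀ κ → Counted c m κ (s κ))
      (v : Vec ℕ K → Carrier) →
      ∑ (elements (e ⊗ (proj₁ ∘ rec))) (λ (κ , T) → v κ · contentWeight m (entries T)) ≈ ∑ (elements e)
        (λ κ → v κ · s κ)
    ∑-counted {m = m} e {s} rec v = ≈-trans (∑-⊗ e (proj₁ ∘ rec) _) (∑-cong (elements e) (λ {κ} _ → begin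
      ∑ (elements (proj₁ (rec κ))) (λ T → v κ · contentWeight m (entries T))
        ≈⟨ ∑-*ˡ (elements (proj₁ (rec κ))) (v κ) (contentWeight m ∘ entries) ⟨
      v κ · ∑ (elements (proj₁ (rec κ))) (contentWeight m ∘ entries) ≈⟨ *-congˡ (proj₂ (rec κ)) ⟩
      v κ · s κ ∎))

    counted-chains : ∀ {K} m → m ≤ n → (μ : Vec ℕ K) → Counted 0 m μ (chains w m μ)
    counted-chains zero _ μ with ∣ μ ∣ in eq
    ... | zero = record
          { elements = Vec.replicate _ [] ∷ [] ; unique = [] ∷ [] ; sound = λ { (here refl) → blank μ eq }
          ; complete = λ F → here (blank-unique F) } , +-identityʳ 1#
      where
      blank : ∀ {K r} (μ : Vec ℕ K) → ∣ μ ∣ ≡ 0 → Filling {n} 0 r 0 μ (Vec.replicate K [])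
      blank []             _ = []
      blank (zero ∷ [])    _ = cons refl [] [] [] [] []
      blank (zero ∷ a ∷ μ) p = cons refl [] [] [] [] (blank (a ∷ μ) p)
      blank-unique : ∀ {K r} {μ : Vec ℕ K} {T} → Filling {n} 0 r 0 μ T → T ≡ Vec.replicate K []
      blank-unique []                             = refl
      blank-unique (cons {row = []} _ _ _ _ _ F)  = cong ([] ∷_) (blank-unique F)
      blank-unique (cons {row = _ ∷ _} _ _ (() ∷ _) _ _ _)
    ... | suc s = record { elements = [] ; unique = [] ; sound = λ () ; complete = λ F → ⊥-elim (none F eq)
        } , ≈-refl
      where
      none : ∀ {K r} {μ : Vec ℕ K} {T} → Filling {n} 0 r 0 μ T → ∣ μ ∣ ≡ suc s → ⊥
      none (cons {row = []} refl _ _ _ _ F) eq = none F eq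
      none (cons {row = _ ∷ _} _ _ (() ∷ _) _ _ _)
    counted-chains {K} (suc m) m<n μ = subst (λ m → Counted 0 (suc m) μ (chains w (suc m) μ)) m≡
      (counted-insert {0} e fits μ (below μ ⊗ (proj₁ ∘ rec)) (begin
        ∑ (elements (below μ ⊗ (proj₁ ∘ rec))) (λ (κ , T) → w (toℕ e) (∣ μ ∣ ∸ ∣ κ ∣) · contentWeight
          (toℕ e) (entries T))
          ≈⟨ ∑-counted (below μ) rec (λ κ → w (toℕ e) (∣ μ ∣ ∸ ∣ κ ∣)) ⟩
        chains w (suc (toℕ e)) μ ∎))
      where
      e = fromℕ< m<n
      m≡ : toℕ e ≡ m
      m≡ = Finₚ.toℕ-fromℕ< m<n
      fits : Letter.Fits e 0 0 K
      fits = ℕₚ.≤-trans (ℕₚ.≤-reflexive (ℕₚ.*-zeroʳ K)) z≤n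
      rec : ∀ κ → Counted 0 (toℕ e) κ (chains w (toℕ e) κ)
      rec κ = subst (λ m → Counted 0 m κ (chains w m κ)) (sym m≡) (counted-chains m (ℕₚ.<⇒≤ m<n) κ)

  module KingBranching (R : CommutativeRing 0ℓ 0ℓ) (z : ℕ → CommutativeRing.Carrier R) (n : ℕ) where
    open CommutativeRing R using (Carrier; _≈_; 1#; *-congˡ; *-congʳ; *-comm; *-assoc; +-identityʳ; setoid)
      renaming (_*_ to _·_; refl to ≈-refl; sym to ≈-sym; trans to ≈-trans; reflexive to ≈-reflexive)
    open Sums R
    open Pieri R
    open Branching R (geometric z) n
    open import Relation.Binary.Reasoning.Setoid setoid

    module Z (zz≈1 : ∀ j → z (j * 2) · z (suc (j * 2)) ≈ 1#) where
      open King (z ∘ (_* 2)) (z ∘ suc ∘ (_* 2)) zz≈1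

      entries-extT : ∀ {K} (T : Rows {n} K) → entries (extT T) ≡ entries T
      entries-extT []        = refl
      entries-extT (row ∷ T) = cong (row ++_) (entries-extT T)

      -- `x` and `y` are the unbarred and the barred letter of a pair. Removing `y` keeps all
      -- `suc j` rows in play; after removing `x` only letters below `j * 2` are left, and these
      -- cannot stand in the bottom row.
      counted-step : ∀ j (x y : Fin n) → toℕ x ≡ j * 2 → toℕ y ≡ suc (toℕ x) →
                     (∀ κ → Counted {j} 2 (toℕ x) κ (symplectic j κ)) → (μ : Vec ℕ (suc j)) →
                     Counted 2 (suc (toℕ y)) μ (symplectic (suc j) μ)
      counted-step j x y x≡ y≡ rec μ = counted-insert y fits-y μ (below μ ⊗ (proj₁ ∘ upper)) (begin
        ∑ (elements (below μ ⊗ (proj₁ ∘ upper))) (λ (ν , T) → z (toℕ y) ^ (∣ μ ∣ ∸ ∣ ν ∣) · contentWeight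
          (toℕ y) (entries T))
          ≈⟨ ∑-counted (below μ) upper (λ ν → z (toℕ y) ^ (∣ μ ∣ ∸ ∣ ν ∣)) ⟩
        ∑ (elements (below μ)) (λ ν → z (toℕ y) ^ (∣ μ ∣ ∸ ∣ ν ∣) · s ν)
          ≈⟨ ∑-cong (elements (below μ)) (λ {ν} _ → ≈-trans (∑-*ˡ (elements (belowExt ν)) _ _)
               (∑-cong (elements (belowExt ν)) (λ {κ} _ → begin
                 z (toℕ y) ^ (∣ μ ∣ ∸ ∣ ν ∣) · (z (toℕ x) ^ (∣ ν ∣ ∸ ∣ ext κ ∣) · symplectic j κ) ≈⟨ *-assoc
                     _ _ _ ⟨
                 z (toℕ y) ^ (∣ μ ∣ ∸ ∣ ν ∣) · z (toℕ x) ^ (∣ ν ∣ ∸ ∣ ext κ ∣) · symplectic j κ ≈⟨ *-congʳ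
                     (*-comm _ _) ⟩
                 z (toℕ x) ^ (∣ ν ∣ ∸ ∣ ext κ ∣) · z (toℕ y) ^ (∣ μ ∣ ∸ ∣ ν ∣) · symplectic j κ
                   ≡⟨ cong₂ (λ a b → z a ^ (∣ ν ∣ ∸ ∣ ext κ ∣) · z b ^ (∣ μ ∣ ∸ ∣ ν ∣) · symplectic j κ) x≡
                     (trans y≡ (cong suc x≡)) ⟩
                 z (j * 2) ^ (∣ ν ∣ ∸ ∣ ext κ ∣) · z (suc (j * 2)) ^ (∣ μ ∣ ∸ ∣ ν ∣) · symplectic j κ
                   ≡⟨ cong (λ m → z (j * 2) ^ (∣ ν ∣ ∸ m) · z (suc (j * 2)) ^ (∣ μ ∣ ∸ ∣ ν ∣) · symplectic j
                     κ) (sum-ext κ) ⟩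
                 z (j * 2) ^ (∣ ν ∣ ∸ ∣ κ ∣) · z (suc (j * 2)) ^ (∣ μ ∣ ∸ ∣ ν ∣) · symplectic j κ ∎))) ⟩
        ∑ (elements (below μ)) (λ ν → ∑ (elements (belowExt ν)) (λ κ →
          z (j * 2) ^ (∣ ν ∣ ∸ ∣ κ ∣) · z (suc (j * 2)) ^ (∣ μ ∣ ∸ ∣ ν ∣) · symplectic j κ))
          ≈⟨ ∑-⊗ (below μ) belowExt _ ⟨
        symplectic (suc j) μ ∎)
        where
        -- The last row has number `j` and bound `j * 2`, which the letter `x` just meets.
        fits-x : Letter.Fits x 2 0 (suc j)
        fits-x = ℕₚ.≤-reflexive (trans (ℕₚ.+-comm 2 (j * 2)) (cong (_+ 2) (sym x≡)))
        fits-y : Letter.Fits y 2 0 (suc j)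
        fits-y = ℕₚ.≤-trans fits-x (ℕₚ.+-monoˡ-≤ 2 (ℕₚ.≤-trans (ℕₚ.n≤1+n _) (ℕₚ.≤-reflexive (sym y≡))))
        s : Vec ℕ (suc j) → Carrier
        s ν = ∑ (elements (belowExt ν)) (λ κ → z (toℕ x) ^ (∣ ν ∣ ∸ ∣ ext κ ∣) · symplectic j κ)
        lower : ∀ ν → Enumeration (λ ((κ , T) : Vec ℕ (suc j) × Rows (suc j)) → κ ≺ ν × Filling 2 0 (toℕ x)
            κ T)
        lower ν = transport (emptyBottom (ℕₚ.≤-reflexive x≡) ν) (belowExt ν ⊗ (proj₁ ∘ rec))
        upper : ∀ ν → Counted 2 (toℕ y) ν (s ν)
        upper ν = subst (λ m → Counted 2 m ν (s ν)) (sym y≡) (counted-insert x fits-x ν (lower ν) (begin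
          ∑ (elements (lower ν)) (λ (κ , T) → z (toℕ x) ^ (∣ ν ∣ ∸ ∣ κ ∣) · contentWeight (toℕ x) (entries T))
            ≡⟨ ∑-map _ (elements (belowExt ν ⊗ (proj₁ ∘ rec))) _ ⟩
          ∑ (elements (belowExt ν ⊗ (proj₁ ∘ rec))) (λ (κ , T) →
            z (toℕ x) ^ (∣ ν ∣ ∸ ∣ ext κ ∣) · contentWeight (toℕ x) (entries (extT T)))
            ≈⟨ ∑-cong (elements (belowExt ν ⊗ (proj₁ ∘ rec))) (λ {(κ , T)} _ →
                 *-congˡ (≈-reflexive (cong (contentWeight (toℕ x)) (entries-extT T)))) ⟩
          ∑ (elements (belowExt ν ⊗ (proj₁ ∘ rec))) (λ (κ , T) →
            z (toℕ x) ^ (∣ ν ∣ ∸ ∣ ext κ ∣) · contentWeight (toℕ x) (entries T))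
            ≈⟨ ∑-counted (belowExt ν) rec (λ κ → z (toℕ x) ^ (∣ ν ∣ ∸ ∣ ext κ ∣)) ⟩
          s ν ∎))

      counted-symplectic : ∀ j → j * 2 ≤ n → (μ : Vec ℕ j) → Counted 2 (j * 2) μ (symplectic j μ)
      counted-symplectic zero    _   [] = record
        { elements = [] ∷ [] ; unique = [] ∷ [] ; sound = λ { (here refl) → [] } ; complete =
            λ { [] → here refl } } , +-identityʳ 1#
      counted-symplectic (suc j) j<n μ = subst (λ m → Counted 2 (suc m) μ (symplectic (suc j) μ)) y≡
        (counted-step j (fromℕ< x<n) (fromℕ< j<n) x≡ (trans y≡ (cong suc (sym x≡)))
          (λ κ → subst (λ m → Counted 2 m κ (symplectic j κ)) (sym x≡)
              (counted-symplectic j (ℕₚ.<⇒≤ x<n) κ)) μ)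
        where
        x<n : j * 2 < n
        x<n = ℕₚ.<⇒≤ j<n
        x≡ : toℕ (fromℕ< x<n) ≡ j * 2
        x≡ = Finₚ.toℕ-fromℕ< x<n
        y≡ : toℕ (fromℕ< j<n) ≡ suc (j * 2)
        y≡ = Finₚ.toℕ-fromℕ< j<n

-- Partitions as padded vectors, horizontal strips as interlacing

module Partitions where

  open All using (All; []; _∷_)
  open import Data.List.Relation.Unary.AllPairs using ([]; _∷_)
  open import Data.List.Relation.Unary.Linked as Linked using (Linked; []; [-]; _∷_)
  open import Data.Nat.Base using (ℕ; zero; suc; _∸_; _≤_; _<_; _≥_; z≤n; s≤s; _+_)
  open FiniteSums
  open Interlacing
  open LocalIdentities

  at : List ℕ → ℕ → ℕ
  at []      _       = 0
  at (a ∷ _) zero    = a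
  at (_ ∷ r) (suc i) = at r i

  -- The proof field is irrelevant; decidability gives back a proof that can be used.
  valid : ∀ μ → IsPartition (rows μ)
  valid (mkPartition r p) = recompute (isPartition? r) p

  at-suc : ∀ {r} → Linked _≥_ r → ∀ i → at r (suc i) ≤ at r i
  at-suc []       _       = z≤n
  at-suc [-]      _       = z≤n
  at-suc (p ∷ _)  zero    = p
  at-suc (_ ∷ ps) (suc i) = at-suc ps i

  at-antitone : ∀ {r} → Linked _≥_ r → ∀ {i j} → i ≤ j → at r j ≤ at r i
  at-antitone {r} r≥ {i} {j} i≤j = subst (λ j → at r j ≤ at r i) (ℕₚ.m∸n+n≡m i≤j) (go (j ∸ i))
    where
    go : ∀ d → at r (d + i) ≤ at r i
    go zero    = ℕₚ.≤-refl
    go (suc d) = ℕₚ.≤-trans (at-suc r≥ (d + i)) (go d)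

  at≡0 : ∀ r {i} → length r ≤ i → at r i ≡ 0
  at≡0 []      _       = refl
  at≡0 (_ ∷ r) (s≤s p) = at≡0 r p

  at≡0⁻ : ∀ {r} → All (0 <_) r → ∀ {i} → at r i ≡ 0 → length r ≤ i
  at≡0⁻ []       _                 = z≤n
  at≡0⁻ (p ∷ ps) {zero}  refl with () ← p
  at≡0⁻ (p ∷ ps) {suc i} eq   = s≤s (at≡0⁻ ps eq)

  private
    row : ℕ × ℕ → List Box
    row (i , len) = map (i ,_) (upTo len)

    -- `boxes` numbers the rows by the identity. An arbitrary numbering `f` lets the induction pass
    -- to the tail of the rows.
    boxesOf : (ℕ → ℕ) → List ℕ → List Box
    boxesOf f r = concatMap row (zip (applyUpTo f (length r)) r)

    ∈-boxesOf⁺ : ∀ f r {i c} → c < at r i → (f i , c) ∈ boxesOf f r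
    ∈-boxesOf⁺ f (a ∷ r) {zero}  c< = ∈ₚ.∈-++⁺ˡ (∈ₚ.∈-map⁺ (f 0 ,_) (∈ₚ.∈-upTo⁺ c<))
    ∈-boxesOf⁺ f (a ∷ r) {suc i} c< = ∈ₚ.∈-++⁺ʳ (row (f 0 , a)) (∈-boxesOf⁺ (f ∘ suc) r c<)

    ∈-boxesOf⁻ : ∀ f r {b} → b ∈ boxesOf f r → ∃ λ i → proj₁ b ≡ f i × proj₂ b < at r i
    ∈-boxesOf⁻ f (a ∷ r) b∈ with ∈ₚ.∈-++⁻ (row (f 0 , a)) b∈
    ... | inj₁ b∈a with _ , c∈ , refl ← ∈ₚ.∈-map⁻ (f 0 ,_) b∈a = 0 , refl , ∈ₚ.∈-upTo⁻ c∈
    ... | inj₂ b∈r with i , eq , c< ← ∈-boxesOf⁻ (f ∘ suc) r b∈r = suc i , eq , c<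

    boxesOf-unique : ∀ f r → (∀ {i j} → f i ≡ f j → i ≡ j) → Unique (boxesOf f r)
    boxesOf-unique f []      inj = []
    boxesOf-unique f (a ∷ r) inj = Uniqueₚ.++⁺ (Uniqueₚ.map⁺ (cong proj₂) (Uniqueₚ.upTo⁺ a))
      (boxesOf-unique (f ∘ suc) r (ℕₚ.suc-injective ∘ inj)) disjoint
      where
      disjoint : ∀ {b} → ¬ (b ∈ row (f 0 , a) × b ∈ boxesOf (f ∘ suc) r)
      disjoint (b∈a , b∈r) with _ , _ , refl ← ∈ₚ.∈-map⁻ (f 0 ,_) b∈a | i , eq , _ ← ∈-boxesOf⁻ (f ∘ suc) r
          b∈r
        with () ← inj {0} {suc i} eq

    length-boxesOf : ∀ f r → length (boxesOf f r) ≡ ListSum.sum r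
    length-boxesOf f []      = refl
    length-boxesOf f (a ∷ r) = trans (Listₚ.length-++ (row (f 0 , a)))
      (cong₂ _+_ (trans (Listₚ.length-map (f 0 ,_) (upTo a)) (Listₚ.length-upTo a))
          (length-boxesOf (f ∘ suc) r))

  ∈-boxes⁺ : ∀ μ {i c} → c < at (rows μ) i → (i , c) ∈ boxes μ
  ∈-boxes⁺ μ = ∈-boxesOf⁺ id (rows μ)

  ∈-boxes⁻ : ∀ μ {i c} → (i , c) ∈ boxes μ → c < at (rows μ) i
  ∈-boxes⁻ μ b∈ with i , refl , c< ← ∈-boxesOf⁻ id (rows μ) b∈ = c<

  boxes-unique : ∀ μ → Unique (boxes μ)
  boxes-unique μ = boxesOf-unique id (rows μ) id

  size : Partition → ℕ
  size = ListSum.sum ∘ rows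

  length-boxes : ∀ μ → length (boxes μ) ≡ size μ
  length-boxes μ = length-boxesOf id (rows μ)

  open DecMembership _≟ᵇ_ using (_∈?_)

  length-filter-¬ : ∀ {A : Set} {P : A → Set} (P? : Decidable P) xs →
                    length (filter (¬? ∘ P?) xs) + length (filter P? xs) ≡ length xs
  length-filter-¬ P? []       = refl
  length-filter-¬ P? (x ∷ xs) with P? x
  ... | yes _ = trans (ℕₚ.+-suc _ _) (cong suc (length-filter-¬ P? xs))
  ... | no _  = cong suc (length-filter-¬ P? xs)

  ∈-∖⁺ : ∀ μ ν {b} → b ∈ boxes μ → b ∉ boxes ν → b ∈ μ ∖ ν
  ∈-∖⁺ μ ν b∈ b∉ = ∈ₚ.∈-filter⁺ (λ b → ¬? (b ∈? boxes ν)) b∈ b∉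

  ∈-∖⁻ : ∀ μ ν {b} → b ∈ μ ∖ ν → b ∈ boxes μ × b ∉ boxes ν
  ∈-∖⁻ μ ν = ∈ₚ.∈-filter⁻ (λ b → ¬? (b ∈? boxes ν)) {xs = boxes μ}

  length-∖ : ∀ μ ν → (∀ {b} → b ∈ boxes ν → b ∈ boxes μ) → length (μ ∖ ν) ≡ size μ ∸ size ν
  length-∖ μ ν ν⊆μ = begin
    length (μ ∖ ν)                                    ≡⟨ ℕₚ.m+n∸n≡m _ (length common) ⟨
    length (μ ∖ ν) + length common ∸ length common  ≡⟨ cong₂ _∸_
        (trans (length-filter-¬ (_∈? boxes ν) (boxes μ)) (length-boxes μ))
                                                         (trans (↭ₚ.↭-length common↭) (length-boxes ν)) ⟩
    size μ ∸ size ν                                   ∎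
    where
    open ≡.≡-Reasoning
    common = filter (_∈? boxes ν) (boxes μ)
    common↭ = unique-↭ (Uniqueₚ.filter⁺ (_∈? boxes ν) (boxes-unique μ)) (boxes-unique ν)
      (λ b∈ → proj₂ (∈ₚ.∈-filter⁻ (_∈? boxes ν) {xs = boxes μ} b∈))
          (λ b∈ → ∈ₚ.∈-filter⁺ (_∈? boxes ν) (ν⊆μ b∈) b∈)

  Interlaced : Partition → Partition → Set
  Interlaced μ ν = ∀ i → at (rows ν) i ≤ at (rows μ) i × at (rows μ) (suc i) ≤ at (rows ν) i

  unique-map⁻ : ∀ {A B : Set} (f : A → B) {xs a b} → Unique (map f xs) → a ∈ xs → b ∈ xs → f a ≡ f b → a ≡ b
  unique-map⁻ f (_ ∷ _)   (here refl) (here refl) _  = refl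
  unique-map⁻ f (x∉ ∷ _)  (here refl) (there b∈)  eq = ⊥-elim (All.lookup x∉ (∈ₚ.∈-map⁺ f b∈) eq)
  unique-map⁻ f (x∉ ∷ _)  (there a∈)  (here refl) eq = ⊥-elim (All.lookup x∉ (∈ₚ.∈-map⁺ f a∈) (sym eq))
  unique-map⁻ f (_ ∷ xs!) (there a∈)  (there b∈)  eq = unique-map⁻ f xs! a∈ b∈ eq

  -- If row `suc i` of `μ` were longer than row `i` of `ν`, the boxes of rows `i` and `suc i` in
  -- column `at (rows ν) i` would both lie in the strip.
  strip⇒interlaced : ∀ μ ν → HorizontalStrip μ ν → Interlaced μ ν
  strip⇒interlaced μ ν (ν⊆μ , cols!) i =
    ℕₚ.≮⇒≥ (λ lt → ℕₚ.n≮n _ (∈-boxes⁻ μ (ν⊆μ (∈-boxes⁺ ν lt)))) ,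
    ℕₚ.≮⇒≥ (λ lt → ℕₚ.1+n≢n (sym (cong proj₁ (unique-map⁻ proj₂ cols!
      (∈-∖⁺ μ ν (∈-boxes⁺ μ {i} (ℕₚ.<-≤-trans lt (at-suc μ≥ i))) (ℕₚ.n≮n _ ∘ ∈-boxes⁻ ν))
      (∈-∖⁺ μ ν (∈-boxes⁺ μ {suc i} lt) (λ b∈ → ℕₚ.<⇒≱ (∈-boxes⁻ ν b∈) (at-suc ν≥ i))) refl))))
    where
    μ≥ = proj₁ (valid μ)
    ν≥ = proj₁ (valid ν)

  interlaced⇒strip : ∀ μ ν → Interlaced μ ν → HorizontalStrip μ ν
  interlaced⇒strip μ ν int = ν⊆μ ,
    unique-map proj₂ injective (Uniqueₚ.filter⁺ (λ b → ¬? (b ∈? boxes ν)) (boxes-unique μ))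
    where
    ν⊆μ : ∀ {b} → b ∈ boxes ν → b ∈ boxes μ
    ν⊆μ {i , c} b∈ = ∈-boxes⁺ μ (ℕₚ.<-≤-trans (∈-boxes⁻ ν b∈) (proj₁ (int i)))
    -- The lower box gives that `c` is less than row `j` of `μ`, hence than row `suc i` of `μ`,
    -- hence than row `i` of `ν`. So the upper box belongs to `ν`.
    apart : ∀ {i j c} → i < j → (i , c) ∈ μ ∖ ν → (j , c) ∈ μ ∖ ν → ⊥
    apart {i} {j} i<j a∈ b∈ = proj₂ (∈-∖⁻ μ ν a∈) (∈-boxes⁺ ν (ℕₚ.<-≤-trans (∈-boxes⁻ μ (proj₁ (∈-∖⁻ μ ν b∈)))
      (ℕₚ.≤-trans (at-antitone (proj₁ (valid μ)) i<j) (proj₂ (int i)))))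
    injective : ∀ {a b} → a ∈ μ ∖ ν → b ∈ μ ∖ ν → proj₂ a ≡ proj₂ b → a ≡ b
    injective {i , c} {j , _} a∈ b∈ refl with ℕₚ.<-cmp i j
    ... | tri< i<j _ _  = ⊥-elim (apart i<j a∈ b∈)
    ... | tri≈ _ refl _ = refl
    ... | tri> _ _ j<i  = ⊥-elim (apart j<i b∈ a∈)

  padWith : ∀ {A : Set} → A → ∀ K → List A → Vec A K
  padWith d zero    _       = []
  padWith d (suc K) []      = d ∷ padWith d K []
  padWith d (suc K) (a ∷ r) = a ∷ padWith d K r

  shape : ∀ K → Partition → Vec ℕ K
  shape K μ = padWith 0 K (rows μ)

  unpad : ∀ {K} → Vec ℕ K → List ℕ
  unpad []          = []
  unpad (zero ∷ _)  = []
  unpad (suc a ∷ v) = suc a ∷ unpad v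

  data Decreasing (u : ℕ) : ∀ {K} → Vec ℕ K → Set where
    []  : Decreasing u []
    _∷_ : ∀ {K a} {v : Vec ℕ K} → a ≤ u → Decreasing a v → Decreasing u (a ∷ v)

  decreasing-0 : ∀ {K} {v : Vec ℕ K} → Decreasing 0 v → v ≡ padWith 0 K []
  decreasing-0 []        = refl
  decreasing-0 (z≤n ∷ d) = cong (0 ∷_) (decreasing-0 d)

  pad-unpad : ∀ {u K} {v : Vec ℕ K} → Decreasing u v → padWith 0 K (unpad v) ≡ v
  pad-unpad []                    = refl
  pad-unpad {v = zero ∷ v}  (_ ∷ d) = cong (0 ∷_) (sym (decreasing-0 d))
  pad-unpad {v = suc a ∷ v} (_ ∷ d) = cong (suc a ∷_) (pad-unpad d)

  unpad-pad : ∀ {r} → All (0 <_) r → ∀ {K} → length r ≤ K → unpad (padWith 0 K r) ≡ r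
  unpad-pad []             {zero}  _       = refl
  unpad-pad []             {suc K} _       = refl
  unpad-pad (s≤s z≤n ∷ ps) {suc K} (s≤s l) = cong (_ ∷_) (unpad-pad ps l)

  length-unpad : ∀ {K} (v : Vec ℕ K) → length (unpad v) ≤ K
  length-unpad []          = z≤n
  length-unpad (zero ∷ v)  = z≤n
  length-unpad (suc a ∷ v) = s≤s (length-unpad v)

  unpad-partition : ∀ {u K} {v : Vec ℕ K} → Decreasing u v → IsPartition (unpad v)
  unpad-partition d = linked d , positive _
    where
    linked : ∀ {u K} {v : Vec ℕ K} → Decreasing u v → Linked _≥_ (unpad v)
    linked []                                    = []
    linked {v = zero ∷ _}          (_ ∷ _)       = []
    linked {v = suc _ ∷ []}        (_ ∷ _)       = [-]
    linked {v = suc _ ∷ zero ∷ _}  (_ ∷ _)       = [-]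
    linked {v = suc _ ∷ suc _ ∷ _} (_ ∷ d@(q ∷ _)) = q ∷ linked d
    positive : ∀ {K} (v : Vec ℕ K) → All (0 <_) (unpad v)
    positive []          = []
    positive (zero ∷ _)  = []
    positive (suc a ∷ v) = s≤s z≤n ∷ positive v

  -- The junk value is ∅.
  partition : ∀ {K} → Vec ℕ K → Partition
  partition v with isPartition? (unpad v)
  ... | yes p = mkPartition (unpad v) p
  ... | no _  = ∅

  rows-partition : ∀ {u K} {v : Vec ℕ K} → Decreasing u v → rows (partition v) ≡ unpad v
  rows-partition {v = v} d with isPartition? (unpad v)
  ... | yes _ = refl
  ... | no ¬p = ⊥-elim (¬p (unpad-partition d))

  ≡-rows : ∀ {μ ν} → rows μ ≡ rows ν → μ ≡ ν
  ≡-rows {mkPartition _ _} {mkPartition _ _} refl = refl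

  shape-partition : ∀ {u K} {v : Vec ℕ K} → Decreasing u v → shape K (partition v) ≡ v
  shape-partition {K = K} d = trans (cong (padWith 0 K) (rows-partition d)) (pad-unpad d)

  decreasing-pad : ∀ {r} → Linked _≥_ r → ∀ K {u} → at r 0 ≤ u → Decreasing u (padWith 0 K r)
  decreasing-pad _  zero    _ = []
  decreasing-pad [] (suc K) _ = z≤n ∷ decreasing-pad [] K z≤n
  decreasing-pad r≥ (suc K) {u} p = go r≥ p
    where
    go : ∀ {r} → Linked _≥_ r → at r 0 ≤ u → Decreasing u (padWith 0 (suc K) r)
    go []       p = z≤n ∷ decreasing-pad [] K z≤n
    go [-]      p = p ∷ decreasing-pad [] K z≤n
    go (q ∷ qs) p = p ∷ decreasing-pad qs K q

  decreasing-shape : ∀ K μ → Decreasing (at (rows μ) 0) (shape K μ)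
  decreasing-shape K μ = decreasing-pad (proj₁ (valid μ)) K ℕₚ.≤-refl

  partition-shape : ∀ {K} μ → ℓ μ ≤ K → partition (shape K μ) ≡ μ
  partition-shape {K} μ l = ≡-rows (trans (rows-partition (decreasing-shape K μ))
      (unpad-pad (proj₂ (valid μ)) l))

  ℓ-partition : ∀ {K} (v : Vec ℕ K) → ℓ (partition v) ≤ K
  ℓ-partition v with isPartition? (unpad v)
  ... | yes _ = length-unpad v
  ... | no _  = z≤n

  interlace-decreasingˡ : ∀ {u K} {α γ : Vec ℕ K} → Interlace u α γ → Decreasing u α
  interlace-decreasingˡ []           = []
  interlace-decreasingˡ (cons p q i) = ℕₚ.≤-trans p q ∷ interlace-decreasingˡ i

  interlace-decreasingʳ : ∀ {u K} {α γ : Vec ℕ K} → Interlace u α γ → Decreasing u γ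
  interlace-decreasingʳ []           = []
  interlace-decreasingʳ (cons p q i) = q ∷ relax p (interlace-decreasingʳ i)
    where
    relax : ∀ {u w K} {v : Vec ℕ K} → u ≤ w → Decreasing u v → Decreasing w v
    relax u≤w []      = []
    relax u≤w (p ∷ d) = ℕₚ.≤-trans p u≤w ∷ d

  sum-pad : ∀ {K} r → length r ≤ K → Vec.sum (padWith 0 K r) ≡ ListSum.sum r
  sum-pad {zero}  []      _       = refl
  sum-pad {suc K} []      _       = sum-pad {K} [] z≤n
  sum-pad {suc K} (a ∷ r) (s≤s l) = cong (a +_) (sum-pad r l)

  pad-interlace⁺ : ∀ K {u} r s → (∀ i → at r i ≤ at s i × at s (suc i) ≤ at r i) → at s 0 ≤ u →
                   Interlace u (padWith 0 K r) (padWith 0 K s)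
  pad-interlace⁺ zero    r       s       int s≤ = []
  pad-interlace⁺ (suc K) []      []      int s≤ = cons z≤n z≤n (pad-interlace⁺ K [] [] (λ _ → z≤n , z≤n) z≤n)
  pad-interlace⁺ (suc K) []      (b ∷ s) int s≤ = cons z≤n s≤
      (pad-interlace⁺ K [] s (int ∘ suc) (proj₂ (int 0)))
  pad-interlace⁺ (suc K) (a ∷ r) []      int s≤ =
    cons (proj₁ (int 0)) z≤n (pad-interlace⁺ K r [] (int ∘ suc) z≤n)
  pad-interlace⁺ (suc K) (a ∷ r) (b ∷ s) int s≤ = cons (proj₁ (int 0)) s≤
      (pad-interlace⁺ K r s (int ∘ suc) (proj₂ (int 0)))

  at-0≤ : ∀ K {u} s {α} → length s ≤ K → Interlace u α (padWith 0 K s) → at s 0 ≤ u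
  at-0≤ zero    []      _ _            = z≤n
  at-0≤ (suc K) []      _ _            = z≤n
  at-0≤ (suc K) (_ ∷ _) _ (cons _ q _) = q

  pad-interlace⁻ : ∀ K {u} r s → length r ≤ K → length s ≤ K → Interlace u (padWith 0 K r) (padWith 0 K s) →
                   ∀ i → at r i ≤ at s i × at s (suc i) ≤ at r i
  pad-interlace⁻ zero    []      []      _       _       _            i       = z≤n , z≤n
  pad-interlace⁻ (suc K) []      []      _       _       _            i       = z≤n , z≤n
  pad-interlace⁻ (suc K) []      (b ∷ s) _       (s≤s l) (cons p q j) zero    = z≤n , at-0≤ K s l j
  pad-interlace⁻ (suc K) []      (b ∷ s) _       (s≤s l) (cons p q j) (suc i) = pad-interlace⁻ K [] s z≤n l
      j i
  pad-interlace⁻ (suc K) (a ∷ r) []      (s≤s k) _       (cons p q j) zero    = p , z≤n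
  pad-interlace⁻ (suc K) (a ∷ r) []      (s≤s k) _       (cons p q j) (suc i) = pad-interlace⁻ K r [] k z≤n
      j i
  pad-interlace⁻ (suc K) (a ∷ r) (b ∷ s) (s≤s k) (s≤s l) (cons p q j) zero    = p , at-0≤ K s l j
  pad-interlace⁻ (suc K) (a ∷ r) (b ∷ s) (s≤s k) (s≤s l) (cons p q j) (suc i) = pad-interlace⁻ K r s k l j i

  strip⇒≺ : ∀ K μ ν → HorizontalStrip μ ν → shape K ν ≺ shape K μ
  strip⇒≺ K μ ν h = unbound (pad-interlace⁺ K (rows ν) (rows μ) (strip⇒interlaced μ ν h) ℕₚ.≤-refl)

  ≺⇒strip : ∀ K μ ν → ℓ μ ≤ K → ℓ ν ≤ K → shape K ν ≺ shape K μ → HorizontalStrip μ ν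
  ≺⇒strip K μ ν k l i = interlaced⇒strip μ ν (pad-interlace⁻ K (rows ν) (rows μ) l k i)

  strip-ℓ≤ : ∀ μ ν → HorizontalStrip μ ν → ℓ ν ≤ ℓ μ
  strip-ℓ≤ μ ν h = at≡0⁻ (proj₂ (valid ν)) (ℕₚ.n≤0⇒n≡0 (ℕₚ.≤-trans (proj₁ (strip⇒interlaced μ ν h (ℓ μ)))
    (ℕₚ.≤-reflexive (at≡0 (rows μ) ℕₚ.≤-refl))))

  -- Row `suc (ℓ ν)` of `μ`, counted from 0, is no longer than row `ℓ ν` of `ν`, which is empty.
  -- This is what bounds the rows in an oscillating tableau by its number of steps.
  strip-ℓ≤suc : ∀ μ ν → HorizontalStrip μ ν → ℓ μ ≤ suc (ℓ ν)
  strip-ℓ≤suc μ ν h = at≡0⁻ (proj₂ (valid μ)) (ℕₚ.n≤0⇒n≡0 (ℕₚ.≤-trans (proj₂ (strip⇒interlaced μ ν h (ℓ ν)))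
    (ℕₚ.≤-reflexive (at≡0 (rows ν) ℕₚ.≤-refl))))

  length-strip : ∀ K μ ν → ℓ μ ≤ K → HorizontalStrip μ ν → length (μ ∖ ν) ≡ ∣ shape K μ ∣ ∸ ∣ shape K ν ∣
  length-strip K μ ν l h = trans (length-∖ μ ν (proj₁ h)) (sym (cong₂ _∸_ (sum-pad (rows μ) l)
    (sum-pad (rows ν) (ℕₚ.≤-trans (strip-ℓ≤ μ ν h) l))))

-- Semistandard and King tableaux as fillings of padded shapes

module Tableaux where

  open import Data.List.Relation.Binary.Prefix.Heterogeneous using (Prefix; []; _∷_)
  open All using (All; []; _∷_)
  open import Data.List.Relation.Unary.Linked as Linked using (Linked; []; [-]; _∷_)
  open import Data.Nat.Base using (ℕ; zero; suc; _≤_; _<_; z≤n; s≤s; _≡ᵇ_; _*_; _+_)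
  open import Data.Vec.Relation.Binary.Pointwise.Inductive using (Pointwise; []; _∷_)
  import Data.Vec.Relation.Unary.All as VAll
  open FiniteSums
  open Interlacing
  open LocalIdentities
  open PieriRules
  open SeparableSeries
  open Fillings
  open Partitions
  open Enumeration

  toList-injective : ∀ {A : Set} {n} {v w : Vec A n} → Vec.toList v ≡ Vec.toList w → v ≡ w
  toList-injective {v = []}    {[]}    _  = refl
  toList-injective {v = a ∷ v} {b ∷ w} eq =
    cong₂ _∷_ (Listₚ.∷-injectiveˡ eq) (toList-injective (Listₚ.∷-injectiveʳ eq))

  words-unique : ∀ {A : Set} m {letters : List A} → Unique letters → Unique (words m letters)
  words-unique m letters! = Uniqueₚ.map⁺ toList-injective (choices-unique (all-replicate m letters!))

  ∈-words⁺ : ∀ {A : Set} {letters : List A} w → All (_∈ letters) w → w ∈ words (length w) letters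
  ∈-words⁺ {letters = letters} w w∈ = subst (_∈ words (length w) letters) (toList∘fromList w)
    (∈ₚ.∈-map⁺ Vec.toList (∈-choices⁺ (pointwise w∈)))
    where
    open import Data.Vec.Properties using (toList∘fromList)
    pointwise : ∀ {w} → All (_∈ letters) w → Pointwise _∈_ (Vec.fromList w) (Vec.replicate (length w) letters)
    pointwise []       = []
    pointwise (p ∷ ps) = p ∷ pointwise ps

  ssyts-enum : ∀ n μ → Enumeration (IsSSYT {n} μ)
  ssyts-enum n μ = filterEnum (map Vec.toList (choices fillings))
    (Uniqueₚ.map⁺ toList-injective (choices-unique (unique-fillings (rows μ)))) (isSSYT? μ)
    λ {T} (shape≡ , _) → ∈-fillings (rows μ) T shape≡
    where
    fillings : Vec (List (List (Fin n))) (ℓ μ)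
    fillings = Vec.map (λ m → words m (allFin n)) (Vec.fromList (rows μ))
    unique-fillings : ∀ r → VAll.All Unique (Vec.map (λ m → words m (allFin n)) (Vec.fromList r))
    unique-fillings []      = VAll.[]
    unique-fillings (a ∷ r) = words-unique a (Uniqueₚ.allFin⁺ n) VAll.∷ unique-fillings r
    ∈-fillings : ∀ r T → map length T ≡ r → T ∈ map Vec.toList
        (choices (Vec.map (λ m → words m (allFin n)) (Vec.fromList r)))
    ∈-fillings _ []        refl = here refl
    ∈-fillings _ (row ∷ T) refl with v , v∈ , T≡ ← ∈ₚ.∈-map⁻ Vec.toList (∈-fillings _ T refl) =
      subst (λ T → (row ∷ T) ∈ _) (sym T≡) (∈ₚ.∈-map⁺ Vec.toList (∈ₚ.∈-cartesianProductWith⁺ _∷_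
        (∈-words⁺ row (All.tabulate (λ {e} _ → ∈ₚ.∈-allFin e))) v∈))

  module _ {n : ℕ} where

    -- `c = 2` is the King condition and `c = 0` no condition, so that one bijection serves both
    -- kinds of tableaux.
    LowFrom : ℕ → ℕ → Tableau n → Set
    LowFrom c r []        = ⊤
    LowFrom c r (row ∷ T) = All (λ e → r * c ≤ toℕ e) row × LowFrom c (suc r) T

    low-0 : ∀ r T → LowFrom 0 r T
    low-0 r []        = tt
    low-0 r (row ∷ T) = All.tabulate (λ _ → ℕₚ.≤-trans (ℕₚ.≤-reflexive (ℕₚ.*-zeroʳ r)) z≤n) , low-0 (suc r) T

    king⇒low : ∀ r (T : Tableau n) → KingFrom r T → LowFrom 2 r T
    king⇒low r []        _       = tt
    king⇒low r (row ∷ T) (p , q) = p , king⇒low (suc r) T q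

    low⇒king : ∀ r (T : Tableau n) → LowFrom 2 r T → KingFrom r T
    low⇒king r []        _       = tt
    low⇒king r (row ∷ T) (p , q) = p , low⇒king (suc r) T q

    Columns : List (Fin n) → List (Fin n) → Set
    Columns r s = Prefix Fin._>_ s r

    blank-filling : ∀ {c r m} K → Filling {n} c r m (padWith 0 K []) (padWith [] K [])
    blank-filling zero          = []
    blank-filling (suc zero)    = cons refl [] [] [] [] []
    blank-filling (suc (suc K)) = cons refl [] [] [] [] (blank-filling (suc K))

    pad-filling : ∀ {c r} K T → All (Linked Fin._≤_) T → Linked Columns T → LowFrom c r T → length T ≤ K →
                  Filling c r n (padWith 0 K (map length T)) (padWith [] K T)
    pad-filling K       []        _        _  _          _       = blank-filling K
    pad-filling (suc K) (row ∷ T) (p ∷ ps) qs (low , lo) (s≤s l) =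
      cons refl p (All.tabulate (λ {e} _ → Finₚ.toℕ<n e)) low (columns K T qs)
          (pad-filling K T ps (Linked.tail qs) lo l)
      where
      columns : ∀ K T → Linked Columns (row ∷ T) → Prefix Fin._>_ (topRow (padWith [] K T)) row
      columns zero    _       _       = []
      columns (suc K) []      _       = []
      columns (suc K) (_ ∷ _) (q ∷ _) = q

    unpadRows : ∀ {K} → Rows {n} K → Tableau n
    unpadRows []                = []
    unpadRows ([] ∷ _)          = []
    unpadRows (row@(_ ∷ _) ∷ T) = row ∷ unpadRows T

    unpadRows-pad : ∀ K T → All (0 <_) (map length T) → length T ≤ K → unpadRows (padWith [] K T) ≡ T
    unpadRows-pad zero    []              _        _       = refl
    unpadRows-pad (suc K) []              _        _       = refl
    unpadRows-pad (suc K) ((_ ∷ _) ∷ T) (_ ∷ ps) (s≤s l) = cong (_ ∷_) (unpadRows-pad K T ps l)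

    blank-unique : ∀ {c r m} K {T} → Filling {n} c r m (padWith 0 K []) T → T ≡ padWith [] K []
    blank-unique zero    []                           = refl
    blank-unique (suc K) (cons {row = []} _ _ _ _ _ F) = cong ([] ∷_) (blank-unique K F)

    unpad-filling : ∀ {c r m} K s {T} → All (0 <_) s → length s ≤ K → Filling {n} c r m (padWith 0 K s) T →
      map length (unpadRows T) ≡ s × All (Linked Fin._≤_) (unpadRows T) × Linked Columns (unpadRows T) ×
      LowFrom c r (unpadRows T) × padWith [] K (unpadRows T) ≡ T
    unpad-filling zero    [] _ _ [] = refl , [] , [] , tt , refl
    unpad-filling (suc K) [] _ _ F@(cons {row = []} _ _ _ _ _ _) = refl , [] , [] , tt , sym
        (blank-unique (suc K) F)
    unpad-filling (suc K) (suc a ∷ s) (_ ∷ ps) (s≤s l) (cons {row = row@(_ ∷ _)} {T = T} eq lk _ lo pr F) =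
      let (lens , lks , cols , lows , pad≡) = unpad-filling K s ps l F
      in cong₂ _∷_ eq lens , lk ∷ lks , columns T pr cols , (lo , lows) , cong (row ∷_) pad≡
      where
      columns : ∀ {K} (T : Rows K) → Prefix Fin._>_ (topRow T) row → Linked Columns (unpadRows T) → Linked
          Columns (row ∷ unpadRows T)
      columns []              _  _    = [-]
      columns ([] ∷ _)        _  _    = [-]
      columns ((_ ∷ _) ∷ _) pr cols = pr ∷ cols

    -- The parts of a partition are positive, so the padding consists exactly of the empty rows of a
    -- filling and can be undone.
    tableaux≅fillings : ∀ c K μ → ℓ μ ≤ K → (λ T → IsSSYT {n} μ T × LowFrom c 0 T) ≅ Filling c 0 n (shape K μ)
    tableaux≅fillings c K μ l = record
      { to      = padWith [] K
      ; from    = unpadRows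
      ; to-∈    = λ {T} → λ { ((s≡ , p , q) , lo) →
          subst (λ r → Filling c 0 n (padWith 0 K r) (padWith [] K T)) s≡
              (pad-filling K T p q lo (length≤ T s≡)) }
      ; from-∈  = λ F → let (s≡ , p , q , lo , _) = unpad-filling K (rows μ) (proj₂ (valid μ)) l F in
          (s≡ , p , q) , lo
      ; from∘to = λ {T} → λ { ((s≡ , _) , _) → unpadRows-pad K T
          (subst (All (0 <_)) (sym s≡) (proj₂ (valid μ))) (length≤ T s≡) }
      ; to∘from = λ F → let (_ , _ , _ , _ , pad≡) = unpad-filling K (rows μ) (proj₂ (valid μ)) l F in pad≡
      }
      where
      length≤ : ∀ T → map length T ≡ rows μ → length T ≤ K
      length≤ T s≡ = ℕₚ.≤-trans (ℕₚ.≤-reflexive (trans (sym (Listₚ.length-map length T)) (cong length s≡))) l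

    entries-pad : ∀ K (T : Tableau n) → length T ≤ K → entries (padWith [] K T) ≡ concat T
    entries-pad zero    []        _       = refl
    entries-pad (suc K) []        _       = entries-pad K [] z≤n
    entries-pad (suc K) (row ∷ T) (s≤s l) = cong (row ++_) (entries-pad K T l)

  module Content (R : CommutativeRing 0ℓ 0ℓ) where
    open CommutativeRing R using (Carrier; _≈_; 1#; *-commutativeMonoid; *-monoid; *-cong; *-congˡ; *-congʳ;
        *-identityˡ; *-identityʳ;
        *-commutativeSemigroup; setoid)
      renaming (_*_ to _·_; refl to ≈-refl; sym to ≈-sym; trans to ≈-trans; reflexive to ≈-reflexive)
    open Sums R
    open Pieri R
    open TopDown *-commutativeMonoid
    open Separable R
    open import Algebra.Properties.CommutativeSemigroup *-commutativeSemigroup using (interchange)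
    open import Relation.Binary.Reasoning.Setoid setoid

    -- Extended by 1 beyond the n given variables.
    extend : ∀ {n} → (Fin n → Carrier) → ℕ → Carrier
    extend {zero}  z _       = 1#
    extend {suc n} z zero    = z Fin.zero
    extend {suc n} z (suc l) = extend (z ∘ Fin.suc) l

    extend-toℕ : ∀ {n} (z : Fin n → Carrier) e → extend z (toℕ e) ≡ z e
    extend-toℕ z Fin.zero    = refl
    extend-toℕ z (Fin.suc e) = extend-toℕ (z ∘ Fin.suc) e

    topDown-∙ : ∀ f g m → topDown (λ l → f l · g l) m ≈ topDown f m · topDown g m
    topDown-∙ f g zero    = ≈-sym (*-identityˡ 1#)
    topDown-∙ f g (suc m) = ≈-trans (*-congˡ (topDown-∙ f g m)) (interchange _ _ _ _)

    topDown-1 : ∀ f m → (∀ l → l < m → f l ≈ 1#) → topDown f m ≈ 1#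
    topDown-1 f zero    f≈1 = ≈-refl
    topDown-1 f (suc m) f≈1 = ≈-trans
      (*-cong (f≈1 m (ℕₚ.n<1+n m)) (topDown-1 f m (λ l l<m → f≈1 l (ℕₚ.m<n⇒m<1+n l<m)))) (*-identityˡ 1#)

    topDown-single : ∀ f m l → l < m → (∀ i → i ≢ l → f i ≈ 1#) → topDown f m ≈ f l
    topDown-single f (suc m) l l<m f≈1 with m ℕₚ.≟ l
    ... | yes refl = ≈-trans (*-congˡ (topDown-1 f m (λ i i<m → f≈1 i (ℕₚ.<⇒≢ i<m)))) (*-identityʳ _)
    ... | no m≢l   = ≈-trans (*-cong (f≈1 m m≢l) (topDown-single f m l
        (ℕₚ.≤∧≢⇒< (ℕₚ.≤-pred l<m) (m≢l ∘ sym)) f≈1)) (*-identityˡ _)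

    module _ {n : ℕ} where
      open import Algebra.Properties.Monoid.Mult *-monoid using () renaming (×-homo-+ to ^-homo-*)

      -- Regroups the product by letters: prepending `x` affects only the factor of the letter `x`.
      ∏-content : ∀ (z : Fin n → Carrier) L → ∏ L z ≈ Branching.contentWeight R (geometric (extend z)) n n L
      ∏-content z []      = ≈-sym (topDown-1 _ n (λ _ _ → ≈-refl))
      ∏-content z (x ∷ L) = ≈-sym (begin
        topDown (λ l → extend z l ^ content l (x ∷ L)) n
          ≈⟨ Branching.topDown-cong R (geometric (extend z)) n n
            (λ l _ → ^-homo-* (extend z l) (if toℕ x ≡ᵇ l then 1 else 0) (content l L)) ⟩
        topDown (λ l → extend z l ^ (if toℕ x ≡ᵇ l then 1 else 0) · extend z l ^ content l L) n
          ≈⟨ topDown-∙ (λ l → extend z l ^ (if toℕ x ≡ᵇ l then 1 else 0)) (λ l → extend z l ^ content l L) n ⟩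
        topDown (λ l → extend z l ^ (if toℕ x ≡ᵇ l then 1 else 0)) n · topDown
            (λ l → extend z l ^ content l L) n
          ≈⟨ *-cong (topDown-single _ n (toℕ x) (Finₚ.toℕ<n x)
               (λ i i≢ → ≈-reflexive (cong (λ b → extend z i ^ (if b then 1 else 0)) (≡ᵇ-≢ {n} (i≢ ∘ sym)))))
               (≈-sym (∏-content z L)) ⟩
        extend z (toℕ x) ^ (if toℕ x ≡ᵇ toℕ x then 1 else 0) · ∏ L z
          ≡⟨ cong (λ b → extend z (toℕ x) ^ (if b then 1 else 0) · ∏ L z) (≡ᵇ-refl {n} (toℕ x)) ⟩
        extend z (toℕ x) · 1# · ∏ L z ≈⟨ *-congʳ (≈-trans (*-identityʳ _) (≈-reflexive (extend-toℕ z x))) ⟩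
        z x · ∏ L z ∎)

      schur-chains : ∀ (z : Fin n → Carrier) {K} μ → ℓ μ ≤ K →
                     schur (CommutativeRing.rawRing R) z μ ≈ chains (geometric (extend z)) n (shape K μ)
      schur-chains z {K} μ l = let (E , E≈) = counted-chains n ℕₚ.≤-refl (shape K μ) in begin
        ∑ (ssyts n μ) (λ T → ∏ (concat T) z)
          ≈⟨ ∑-≅ (≅-trans (⇔⇒≅ (λ p → p , low-0 0 _) proj₁) (tableaux≅fillings 0 K μ l)) (ssyts-enum n μ) E
               (λ {T} (s≡ , _) → ≈-trans (∏-content z (concat T)) (≈-reflexive (cong (contentWeight n)
                 (sym (entries-pad K T (ℕₚ.≤-trans (ℕₚ.≤-reflexive
                     (trans (sym (Listₚ.length-map length T)) (cong length s≡))) l)))))) ⟩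
        ∑ (elements E) (contentWeight n ∘ entries) ≈⟨ E≈ ⟩
        chains (geometric (extend z)) n (shape K μ) ∎
        where open Branching R (geometric (extend z)) n

-- The Cauchy sum by iterated Pieri rules, and King tableaux in pairs of variables

module CauchyIdentity where

  open import Data.Nat.Base using (ℕ; zero; suc; _∸_; _≤_; _<_; z≤n; s≤s; _≡ᵇ_; _*_; _+_)
  open FiniteSums
  open Interlacing
  open LocalIdentities
  open PieriRules
  open SeparableSeries
  open Fillings
  open Partitions
  open Tableaux
  open Enumeration

  nth : ∀ {n} → Vec ℕ n → ℕ → ℕ
  nth []      _       = 0
  nth (a ∷ _) zero    = a
  nth (_ ∷ v) (suc i) = nth v i

  nth-bottom : ∀ {n} (v : Vec ℕ (suc n)) → nth v n ≡ bottom v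
  nth-bottom (a ∷ [])        = refl
  nth-bottom (a ∷ v@(_ ∷ _)) = nth-bottom v

  nth≤sum : ∀ {n} (v : Vec ℕ n) i → nth v i ≤ ∣ v ∣
  nth≤sum []      i       = z≤n
  nth≤sum (a ∷ v) zero    = ℕₚ.m≤m+n a _
  nth≤sum (a ∷ v) (suc i) = ℕₚ.≤-trans (nth≤sum v i) (ℕₚ.m≤n+m _ a)

  interlace-nth : ∀ {u n} {α γ : Vec ℕ n} → Interlace u α γ → ∀ i → nth γ (suc i) ≤ nth α i
  interlace-nth []                        i       = z≤n
  interlace-nth (cons _ _ [])             zero    = z≤n
  interlace-nth (cons _ _ (cons _ q _))   zero    = q
  interlace-nth (cons _ _ j)              (suc i) = interlace-nth j i

  IsShape : ∀ {n} → Vec ℕ n → Set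
  IsShape v = Decreasing (head₀ v) v

  decreasing? : ∀ u {n} (v : Vec ℕ n) → Dec (Decreasing u v)
  decreasing? u []      = yes []
  decreasing? u (a ∷ v) = map′ (λ (p , d) → p ∷ d) (λ { (p ∷ d) → p , d }) (a ℕₚ.≤? u ×-dec decreasing? a v)

  isShape : ∀ {u n} {v : Vec ℕ n} → Decreasing u v → IsShape v
  isShape []      = []
  isShape (_ ∷ d) = ℕₚ.≤-refl ∷ d

  shapes : ∀ {n} s → Enumeration (λ (v : Vec ℕ n) → IsShape v × ∣ v ∣ ≡ s)
  shapes s = boundedSum (λ v → decreasing? (head₀ v) v ×-dec (∣ v ∣ ℕₚ.≟ s)) s (ℕₚ.≤-reflexive ∘ proj₂)

  module Cauchy (R : CommutativeRing 0ℓ 0ℓ) where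
    open CommutativeRing R using (Carrier; _≈_; 1#; 0#; *-commutativeMonoid; *-cong; *-congˡ; *-congʳ;
        *-identityˡ; *-assoc;
        zeroˡ; zeroʳ; +-identityʳ; +-cong; setoid)
      renaming (_*_ to _·_; _+_ to _⊞_; refl to ≈-refl; sym to ≈-sym; trans to ≈-trans; reflexive to
          ≈-reflexive)
    open Sums R
    open Pieri R
    open TopDown *-commutativeMonoid
    open Separable R
    open Content R
    open import Relation.Binary.Reasoning.Setoid setoid

    -- Each step of a chain opens at most one row, so `m` steps do not reach row `i`.
    chains-vanish : ∀ w m {n} (μ : Vec ℕ n) i → m ≤ i → 0 < nth μ i → chains w m μ ≈ 0#
    chains-vanish w zero μ i _ 0<nth = ≈-reflexive (δ≡0 (ℕₚ.<-≤-trans 0<nth (nth≤sum μ i)))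
      where
      δ≡0 : ∀ {s} → 0 < s → δ s ≡ 0#
      δ≡0 (s≤s _) = refl
    chains-vanish w (suc m) μ (suc i) (s≤s m≤i) 0<nth = ∑-zero (elements (below μ)) λ {κ} κ∈ →
      ≈-trans (*-congˡ (chains-vanish w m κ i m≤i (ℕₚ.<-≤-trans 0<nth
          (interlace-nth (sound (below μ) κ∈) i)))) (zeroʳ _)

    chains-∅ : ∀ w m {n} (μ : Vec ℕ n) → (∀ l → w l 0 ≈ 1#) → ∣ μ ∣ ≡ 0 → chains w m μ ≈ 1#
    chains-∅ w zero    μ w₀ eq = ≈-reflexive (cong δ eq)
    chains-∅ w (suc m) μ w₀ eq = begin
      chains w (suc m) μ ≈⟨ ∑-single (λ κ → w m (∣ μ ∣ ∸ ∣ κ ∣) · chains w m κ) (unique (below μ))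
          (complete (below μ) (≺-refl eq))
                              (λ {κ} κ∈ κ≢μ → ⊥-elim (κ≢μ (sum≡0-unique
                                (ℕₚ.n≤0⇒n≡0 (ℕₚ.≤-trans (interlace-sum (sound (below μ) κ∈))
                                    (ℕₚ.≤-reflexive eq))) eq))) ⟩
      w m (∣ μ ∣ ∸ ∣ μ ∣) · chains w m μ ≈⟨ *-cong (≈-trans (≈-reflexive (cong (w m) (ℕₚ.n∸n≡0 ∣ μ ∣)))
          (w₀ m)) (chains-∅ w m μ w₀ eq) ⟩
      1# · 1# ≈⟨ *-identityˡ 1# ⟩
      1# ∎

    -- Selects the chains whose l-th step has size α l.
    steps : (ℕ → ℕ) → ℕ → ℕ → Carrier
    steps α l s = spike 1# s (α l)

    total : (ℕ → ℕ) → ℕ → ℕ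
    total α zero    = 0
    total α (suc m) = α m + total α m

    chains-steps-total : ∀ α m {n} (μ : Vec ℕ n) → ∣ μ ∣ ≢ total α m → chains (steps α) m μ ≈ 0#
    chains-steps-total α zero μ ≢0 = ≈-trans (δ≋spike ∣ μ ∣) (spike-≢ 1# (≢0 ∘ sym))
    chains-steps-total α (suc m) μ ≢total = ∑-zero (elements (below μ))
        (λ {κ} κ∈ → vanish κ (sound (below μ) κ∈) (∣ μ ∣ ∸ ∣ κ ∣ ℕₚ.≟ α m))
      where
      vanish : ∀ κ → κ ≺ μ → Dec (∣ μ ∣ ∸ ∣ κ ∣ ≡ α m) → spike 1# (∣ μ ∣ ∸ ∣ κ ∣) (α m) · chains (steps α) m
          κ ≈ 0#
      vanish κ i (no ≢α)  = ≈-trans (*-congʳ (spike-≢ 1# ≢α)) (zeroˡ _)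
      vanish κ i (yes ≡α) = ≈-trans (*-congˡ (chains-steps-total α m κ (λ κ≡ → ≢total
        (trans (sym (ℕₚ.m∸n+n≡m (interlace-sum i))) (cong₂ _+_ ≡α κ≡))))) (zeroʳ _)

    module _ (z : ℕ → Carrier) (M : ℕ) (α : ℕ → ℕ) {n : ℕ} where

      private
        s : Vec ℕ (suc n) → Carrier
        s = chains (geometric z) M

      -- The last step of the `y`-chain goes from some `κ` to `μ` by a strip of size `α m`. Summing
      -- over `μ` with `κ` fixed is the expanded side of `pieri`, which pulls out one complete
      -- homogeneous factor.
      cauchy : ∀ m → m ≤ suc n →
        ∑ (elements (shapes {suc n} (total α m))) (λ μ → s μ · chains (steps α) m μ) ≈ topDown
          (λ l → hom z M (α l)) m
      cauchy zero _ = begin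
        ∑ (elements (shapes 0)) (λ μ → s μ · δ ∣ μ ∣)
          ≈⟨ ∑-single (λ μ → s μ · δ ∣ μ ∣) (unique (shapes 0))
            (complete (shapes 0) (isShape (decreasing-pad Linked.[] (suc n) {0} z≤n) , sum-pad {suc n} []
                z≤n))
               (λ {μ} μ∈ μ≢ → ⊥-elim (μ≢ (sum≡0-unique (proj₂ (sound (shapes 0) μ∈))
                   (sum-pad {suc n} [] z≤n)))) ⟩
        s ∅′ · δ ∣ ∅′ ∣ ≈⟨ *-cong (chains-∅ (geometric z) M ∅′ (λ _ → ≈-refl) (sum-pad {suc n} [] z≤n))
            (≈-reflexive (cong δ (sum-pad {suc n} [] z≤n))) ⟩
        1# · 1# ≈⟨ *-identityˡ 1# ⟩
        1# ∎
        where
        import Data.List.Relation.Unary.Linked as Linked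
        ∅′ : Vec ℕ (suc n)
        ∅′ = padWith 0 (suc n) []
      cauchy (suc m) (s≤s m≤n) = begin
        ∑ (elements (shapes (α m + total α m))) (λ μ → s μ · chains (steps α) (suc m) μ)
          ≈⟨ ∑-cong (elements (shapes (α m + total α m)))
            (λ {μ} _ → ≈-trans (∑-*ˡ (elements (below μ)) (s μ) _) (select μ)) ⟩
        ∑ (elements (shapes (α m + total α m))) (λ μ → ∑ (elements (restrict (below μ) (step? μ)))
          (λ κ → s μ · g κ))
          ≈⟨ ∑-⊗ (shapes (α m + total α m)) (λ μ → restrict (below μ) (step? μ)) (λ (μ , κ) → s μ · g κ) ⟨
        ∑ (elements (shapes (α m + total α m) ⊗ λ μ → restrict (below μ) (step? μ))) (λ (μ , κ) → s μ · g κ)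
          ≈⟨ ∑-≅ swap (shapes (α m + total α m) ⊗ λ μ → restrict (below μ) (step? μ))
            (shapes (total α m) ⊗ above (α m)) (λ _ → ≈-refl) ⟩
        ∑ (elements (shapes (total α m) ⊗ above (α m))) (λ (κ , μ) → s μ · g κ)
          ≈⟨ ∑-⊗ (shapes (total α m)) (above (α m)) (λ (κ , μ) → s μ · g κ) ⟩
        ∑ (elements (shapes (total α m))) (λ κ → ∑ (elements (above (α m) κ)) (λ μ → s μ · g κ))
          ≈⟨ ∑-cong (elements (shapes (total α m))) (λ {κ} _ → ≈-trans
            (≈-sym (∑-*ʳ (elements (above (α m) κ)) (g κ) s)) (apply κ (bottom κ ℕₚ.≟ 0))) ⟩
        ∑ (elements (shapes (total α m))) (λ κ → hom z M (α m) · (s κ · g κ)) ≈⟨ ∑-*ˡ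
          (elements (shapes (total α m))) (hom z M (α m)) (λ κ → s κ · g κ) ⟨
        hom z M (α m) · ∑ (elements (shapes (total α m))) (λ κ → s κ · g κ) ≈⟨ *-congˡ
            (cauchy m (ℕₚ.m≤n⇒m≤1+n m≤n)) ⟩
        topDown (λ l → hom z M (α l)) (suc m) ∎
        where
        g : Vec ℕ (suc n) → Carrier
        g = chains (steps α) m
        step? : ∀ (μ κ : Vec ℕ (suc n)) → Dec (∣ μ ∣ ∸ ∣ κ ∣ ≡ α m)
        step? μ κ = ∣ μ ∣ ∸ ∣ κ ∣ ℕₚ.≟ α m
        select : ∀ μ → ∑ (elements (below μ)) (λ κ → s μ · (spike 1# (∣ μ ∣ ∸ ∣ κ ∣) (α m) · g κ)) ≈
                       ∑ (elements (restrict (below μ) (step? μ))) (λ κ → s μ · g κ)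
        select μ = begin
          ∑ (elements (below μ)) f ≈⟨ ∑-filter (step? μ) (elements (below μ)) f ⟩
          ∑ (elements (restrict (below μ) (step? μ))) f ⊞ ∑ (elements (restrict (below μ) (¬? ∘ step? μ))) f
            ≈⟨ +-cong (∑-cong (elements (restrict (below μ) (step? μ))) (λ {κ} κ∈ → *-congˡ (≈-trans (*-congʳ
                  (≈-trans (≈-reflexive (cong (spike 1# (∣ μ ∣ ∸ ∣ κ ∣))
                      (sym (proj₂ (sound (restrict (below μ) (step? μ)) κ∈))))) (spike-≡ 1# (∣ μ ∣ ∸ ∣ κ ∣))))
                  (*-identityˡ (g κ)))))
                (∑-zero (elements (restrict (below μ) (¬? ∘ step? μ))) (λ {κ} κ∈ → ≈-trans (*-congˡ
                  (≈-trans (*-congʳ (spike-≢ 1# (proj₂ (sound (restrict (below μ) (¬? ∘ step? μ)) κ∈))))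
                      (zeroˡ _))) (zeroʳ _))) ⟩
          ∑ (elements (restrict (below μ) (step? μ))) (λ κ → s μ · g κ) ⊞ 0# ≈⟨ +-identityʳ _ ⟩
          ∑ (elements (restrict (below μ) (step? μ))) (λ κ → s μ · g κ) ∎
          where
          f : Vec ℕ (suc n) → Carrier
          f κ = s μ · (spike 1# (∣ μ ∣ ∸ ∣ κ ∣) (α m) · g κ)
        swap : (λ ((μ , κ) : Vec ℕ (suc n) × Vec ℕ (suc n)) → (IsShape μ × ∣ μ ∣ ≡ α m + total α m) ×
            (κ ≺ μ × ∣ μ ∣ ∸ ∣ κ ∣ ≡ α m)) ≅
               (λ ((κ , μ) : Vec ℕ (suc n) × Vec ℕ (suc n)) → (IsShape κ × ∣ κ ∣ ≡ total α m) ×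
                   (κ ≺ μ × ∣ μ ∣ ∸ ∣ κ ∣ ≡ α m))
        swap = record
          { to      = λ (μ , κ) → κ , μ
          ; from    = λ (κ , μ) → μ , κ
          ; to-∈    = λ {(μ , κ)} ((_ , μ≡) , i , d) →
              (isShape (interlace-decreasingˡ i) ,
               ℕₚ.+-cancelˡ-≡ (α m) _ _ (trans (trans (cong (_+ ∣ κ ∣) (sym d))
                   (ℕₚ.m∸n+n≡m (interlace-sum i))) μ≡)) , i , d
          ; from-∈  = λ {(κ , μ)} ((_ , κ≡) , i , d) →
              (isShape (interlace-decreasingʳ i) , trans (sym (ℕₚ.m∸n+n≡m (interlace-sum i)))
                  (cong₂ _+_ d κ≡)) , i , d
          ; from∘to = λ _ → refl
          ; to∘from = λ _ → refl
          }
        -- `pieri` needs an empty bottom row. If that of `κ` is occupied, `m ≤ n` steps cannot reach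
        -- `κ`, so both sides vanish with `g κ`.
        apply : ∀ κ → Dec (bottom κ ≡ 0) → ∑ (elements (above (α m) κ)) s · g κ ≈ hom z M (α m) · (s κ · g κ)
        apply κ (yes κ₀) = ≈-trans (*-congʳ (≈-sym (pieri z M (α m) κ κ₀))) (*-assoc _ _ _)
        apply κ (no κ≢0) = ≈-trans (≈-trans (*-congˡ g≈0) (zeroʳ _))
          (≈-sym (≈-trans (*-congˡ (≈-trans (*-congˡ g≈0) (zeroʳ _))) (zeroʳ _)))
          where
          g≈0 : g κ ≈ 0#
          g≈0 = chains-vanish (steps α) m κ n m≤n (subst (0 <_) (sym (nth-bottom κ)) (ℕₚ.n≢0⇒n>0 κ≢0))

    separable≈topDown : ∀ {k} (ψ : ℕ → ℕ → Carrier) (α : Vec ℕ k) → separable (ψ ∘ toℕ) α ≈ topDown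
        (λ l → ψ l (nth α l)) k
    separable≈topDown ψ []      = ≈-refl
    separable≈topDown {suc k} ψ (a ∷ α) = ≈-trans (*-congˡ (separable≈topDown (ψ ∘ suc) α))
      (≈-sym (topDown-suc (λ l → ψ l (nth (a ∷ α) l)) k))

    module _ (k : ℕ) where
      open PowerSeries (CommutativeRing.rawRing R) k using (Series; var) renaming (ring to seriesRing)
      private module S = ListOps seriesRing

      ∑ˢ-coefficient : ∀ {A : Set} (xs : List A) (F : A → Series) α → S.∑ xs F α ≡ ∑ xs (λ a → F a α)
      ∑ˢ-coefficient []       F α = refl
      ∑ˢ-coefficient (x ∷ xs) F α = cong (F x α ⊞_) (∑ˢ-coefficient xs F α)

      axis-spike : ∀ {n} (x j : Fin n) → axis x (spike 1# 1) j ≋ spike 1# (if toℕ x ≡ᵇ toℕ j then 1 else 0)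
      axis-spike Fin.zero    Fin.zero    _ = ≈-refl
      axis-spike Fin.zero    (Fin.suc j)   = δ≋spike
      axis-spike (Fin.suc x) Fin.zero      = δ≋spike
      axis-spike (Fin.suc x) (Fin.suc j)   = axis-spike x j

      ∏-var : ∀ (L : List (Fin k)) α → S.∏ L var α ≈ separable (λ j → spike 1# (content (toℕ j) L)) α
      ∏-var []      α = ≈-trans (one-separable k α) (separable-cong (λ _ → δ≋spike) α)
      ∏-var (x ∷ L) α = ≈-trans
        (*ˢ-separable k {φ = axis x (spike 1# 1)} {λ j → spike 1# (content (toℕ j) L)} (var-separable k x)
            (∏-var L) α)
        (separable-cong (λ j a → ≈-trans (⋆-cong (axis-spike x j) (λ _ → ≈-refl) a)
          (≈-trans (spike-⋆ 1# (if toℕ x ≡ᵇ toℕ j then 1 else 0) 1# (content (toℕ j) L) a)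
            (spike-cong (content (toℕ j) (x ∷ L)) (*-identityˡ 1#) a))) α)

      -- Extracting a coefficient is itself a chain weight: a tableau has content `α` exactly when
      -- the strip of each letter has the prescribed size.
      schur-y : ∀ μ {K} → ℓ μ ≤ K → ∀ α → schur seriesRing var μ α ≈ chains (steps (nth α)) k (shape K μ)
      schur-y μ {K} l α = let (E , E≈) = counted-chains k ℕₚ.≤-refl (shape K μ) in begin
        schur seriesRing var μ α ≡⟨ ∑ˢ-coefficient (ssyts k μ) _ α ⟩
        ∑ (ssyts k μ) (λ T → S.∏ (concat T) var α)
          ≈⟨ ∑-≅ (≅-trans (⇔⇒≅ (λ p → p , low-0 0 _) proj₁) (tableaux≅fillings 0 K μ l)) (ssyts-enum k μ) E
               (λ {T} (s≡ , _) → ≈-trans (∏-var (concat T) α)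
                   (≈-trans (separable≈topDown (λ l → spike 1# (content l (concat T))) α)
                 (≈-reflexive (cong (contentWeight k)
                   (sym (entries-pad K T (ℕₚ.≤-trans (ℕₚ.≤-reflexive
                       (trans (sym (Listₚ.length-map length T)) (cong length s≡))) l))))))) ⟩
        ∑ (elements E) (contentWeight k ∘ entries) ≈⟨ E≈ ⟩
        chains (steps (nth α)) k (shape K μ) ∎
        where open Branching R (steps (nth α)) k

    module KingTableaux {k : ℕ} (z : Fin (k * 2) → Carrier)
      (zz≈1 : ∀ j → extend z (j * 2) · extend z (suc (j * 2)) ≈ 1#) where
      open King (extend z ∘ (_* 2)) (extend z ∘ suc ∘ (_* 2)) zz≈1 public
      open KingBranching.Z R (extend z) (k * 2) zz≈1
      open Branching R (geometric (extend z)) (k * 2)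

      king-symplectic : ∀ μ → ℓ μ ≤ k → ∑ (kingTableaux k μ) (λ T → ∏ (concat T) z) ≈ symplectic k (shape k μ)
      king-symplectic μ l = let (E , E≈) = counted-symplectic k ℕₚ.≤-refl (shape k μ) in begin
        ∑ (kingTableaux k μ) (λ T → ∏ (concat T) z)
          ≈⟨ ∑-≅ (≅-trans (⇔⇒≅ (λ {T} (p , q) → p , king⇒low 0 T q) (λ {T} (p , q) → p , low⇒king 0 T q))
            (tableaux≅fillings 2 k μ l))
               (restrict (ssyts-enum (k * 2) μ) (kingFrom? 0)) E
               (λ {T} ((s≡ , _) , _) → ≈-trans (∏-content z (concat T))
                   (≈-reflexive (cong (contentWeight (k * 2))
                 (sym (entries-pad k T (ℕₚ.≤-trans (ℕₚ.≤-reflexive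
                     (trans (sym (Listₚ.length-map length T)) (cong length s≡))) l)))))) ⟩
        ∑ (elements E) (contentWeight (k * 2) ∘ entries) ≈⟨ E≈ ⟩
        symplectic k (shape k μ) ∎

      private module T = TopDown ⋆-commutativeMonoid
      open CommutativeMonoid ⋆-commutativeMonoid using () renaming (sym to ≋-sym; trans to ≋-trans)

      hom±≡topDown : ∀ j → hom± j ≡ T.topDown (λ l → geometric (extend z) (l * 2) ⋆ geometric (extend z)
          (suc (l * 2))) j
      hom±≡topDown zero    = refl
      hom±≡topDown (suc j) = cong (_⋆_ _) (hom±≡topDown j)

      -- The same polynomials, with the variables added singly for `pieri` and in pairs for
      -- `pieri±`.
      hom≋hom± : ∀ j → hom (extend z) (j * 2) ≋ hom± j
      hom≋hom± zero    _ = ≈-refl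
      hom≋hom± (suc j) = ≋-trans {k = hom± (suc j)} (≋-sym (⋆-assoc Y X (hom (extend z) (j * 2))))
        (⋆-cong (⋆-comm Y X) (hom≋hom± j))
        where
        X = geometric (extend z) (j * 2)
        Y = geometric (extend z) (suc (j * 2))

-- Oscillating tableaux as walks on shapes

module OscillatingTableaux where

  open All using (All; []; _∷_)
  open import Data.List.Relation.Unary.AllPairs using ([]; _∷_)
  open import Data.Nat.Base using (ℕ; zero; suc; _∸_; _≤_; _<_; z≤n; s≤s; _*_; _+_)
  open import Data.Vec.Relation.Binary.Pointwise.Inductive using (Pointwise; []; _∷_)
  open FiniteSums
  open Interlacing
  open LocalIdentities
  open PieriRules
  open SeparableSeries
  open Partitions
  open Tableaux using (words-unique; ∈-words⁺)
  open Enumeration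

  private
    -- The function toPartition is local to partitionsIn and hence not in scope; unification finds it once the
    -- empty partition is split off the list.
    localToPartition : ∀ N → Σ[ f ∈ (List ℕ → Maybe Partition) ]
      partitionsIn N ≡ ∅ ∷ mapMaybe f (concatMap (λ m → words m (upTo (suc N))) (applyUpTo suc N))
    localToPartition N = _ , refl

    toPartition : ℕ → List ℕ → Maybe Partition
    toPartition N = proj₁ (localToPartition N)

    toPartition-rows : ∀ N r {μ} → toPartition N r ≡ just μ → rows μ ≡ r
    toPartition-rows N r eq with isPartition? r
    toPartition-rows N r refl | yes p = refl

    toPartition-just : ∀ N μ → toPartition N (rows μ) ≡ just μ
    toPartition-just N μ with isPartition? (rows μ)
    ... | yes p = refl
    ... | no ¬p = ⊥-elim (¬p (valid μ))

  ∈-mapMaybe⁺ : ∀ {A B : Set} (f : A → Maybe B) {xs a b} → a ∈ xs → f a ≡ just b → b ∈ mapMaybe f xs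
  ∈-mapMaybe⁺ f {x ∷ xs} (here refl) eq rewrite eq = here refl
  ∈-mapMaybe⁺ f {x ∷ xs} (there a∈)  eq with f x
  ... | just _  = there (∈-mapMaybe⁺ f a∈ eq)
  ... | nothing = ∈-mapMaybe⁺ f a∈ eq

  ∈-mapMaybe⁻ : ∀ {A B : Set} (f : A → Maybe B) xs {b} → b ∈ mapMaybe f xs → ∃ λ a → a ∈ xs × f a ≡ just b
  ∈-mapMaybe⁻ f (x ∷ xs) b∈ with f x in eq
  ∈-mapMaybe⁻ f (x ∷ xs) (here refl) | just _  = x , here refl , eq
  ∈-mapMaybe⁻ f (x ∷ xs) (there b∈)  | just _  = let (a , a∈ , eq′) = ∈-mapMaybe⁻ f xs b∈ in a , there a∈ ,
      eq′
  ∈-mapMaybe⁻ f (x ∷ xs) b∈          | nothing = let (a , a∈ , eq′) = ∈-mapMaybe⁻ f xs b∈ in a , there a∈ ,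
      eq′

  unique-mapMaybe : ∀ {A B : Set} (f : A → Maybe B) {xs} →
      (∀ {a a′ b} → f a ≡ just b → f a′ ≡ just b → a ≡ a′) →
                    Unique xs → Unique (mapMaybe f xs)
  unique-mapMaybe f inj [] = []
  unique-mapMaybe f {x ∷ xs} inj (x∉ ∷ xs!) with f x in eq
  ... | just b  = All.tabulate (λ { b∈ refl → let (a , a∈ , eq′) = ∈-mapMaybe⁻ f xs b∈ in All.lookup x∉ a∈
      (inj eq eq′) })
                  ∷ unique-mapMaybe f inj xs!
  ... | nothing = unique-mapMaybe f inj xs!

  length-∈-words : ∀ {A : Set} m {letters : List A} {w} → w ∈ words m letters → length w ≡ m
  length-∈-words m w∈ with v , _ , refl ← ∈ₚ.∈-map⁻ Vec.toList w∈ = Vecₚ.length-toList v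

  partitionsIn-unique : ∀ N → Unique (partitionsIn N)
  partitionsIn-unique N = subst Unique (sym (proj₂ (localToPartition N)))
    (All.tabulate (λ { μ∈ refl → ∅∉ μ∈ }) ∷ unique-mapMaybe (toPartition N) (λ {a} {a′} p q →
       trans (sym (toPartition-rows N a p)) (toPartition-rows N a′ q)) nonempty-unique)
    where
    nonempty = concatMap (λ m → words m (upTo (suc N))) (applyUpTo suc N)
    nonempty-unique : Unique nonempty
    nonempty-unique = unique-concatMap (λ m → words m (upTo (suc N)))
      (Uniqueₚ.applyUpTo⁺₁ suc N (λ i<j _ → ℕₚ.<⇒≢ (s≤s i<j))) (λ m → words-unique m (Uniqueₚ.upTo⁺ (suc N)))
      (λ {m} {m′} w∈ w∈′ → trans (sym (length-∈-words m w∈)) (length-∈-words m′ w∈′))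
    ∅∉ : ¬ (∅ ∈ mapMaybe (toPartition N) nonempty)
    ∅∉ ∅∈ with r , r∈ , eq ← ∈-mapMaybe⁻ (toPartition N) nonempty ∅∈
      with m , m∈ , r∈m ← find (∈ₚ.∈-concatMap⁻ (λ m → words m (upTo (suc N))) {applyUpTo suc N} r∈)
      with i , _ , refl ← ∈ₚ.∈-applyUpTo⁻ suc m∈
      with () ← trans (cong length (toPartition-rows N r eq)) (length-∈-words (suc i) r∈m)

  ∈-partitionsIn : ∀ N μ → size μ ≤ N → μ ∈ partitionsIn N
  ∈-partitionsIn N μ ≤N = subst (μ ∈_) (sym (proj₂ (localToPartition N))) (split (rows μ) refl)
    where
    length≤sum : ∀ {r} → All (0 <_) r → length r ≤ ListSum.sum r
    length≤sum []       = z≤n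
    length≤sum (p ∷ ps) = ℕₚ.+-mono-≤ p (length≤sum ps)
    bounded : ∀ r → ListSum.sum r ≤ N → All (_∈ upTo (suc N)) r
    bounded []      _ = []
    bounded (a ∷ r) p = ∈ₚ.∈-upTo⁺ (s≤s (ℕₚ.≤-trans (ℕₚ.m≤m+n a _) p)) ∷ bounded r
        (ℕₚ.≤-trans (ℕₚ.m≤n+m _ a) p)
    split : ∀ r → rows μ ≡ r → μ ∈ ∅ ∷ mapMaybe (toPartition N)
        (concatMap (λ m → words m (upTo (suc N))) (applyUpTo suc N))
    split []      eq = here (≡-rows eq)
    split (a ∷ r) eq = there (∈-mapMaybe⁺ (toPartition N)
      (∈ₚ.∈-concatMap⁺ (λ m → words m (upTo (suc N))) (lose
        (subst (λ r → length r ∈ applyUpTo suc N) (sym eq) (∈ₚ.∈-applyUpTo⁺ suc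
          (ℕₚ.≤-trans (subst (λ r → length r ≤ N) eq (ℕₚ.≤-trans (length≤sum (proj₂ (valid μ))) ≤N))
              ℕₚ.≤-refl)))
        (∈-words⁺ (rows μ) (bounded (rows μ) ≤N))))
      (toPartition-just N μ))

  final : ∀ {m} → Partition → Steps m → Partition
  final μ []            = μ
  final μ ((_ , ρ) ∷ S) = final ρ S

  stepsFrom-final : ∀ {m} μ (S : Steps m) {ϕ} → StepsFrom μ S ϕ → final μ S ≡ ϕ
  stepsFrom-final μ []            eq          = eq
  stepsFrom-final μ ((_ , ρ) ∷ S) (_ , _ , s) = stepsFrom-final ρ S s

  size-strip : ∀ μ ν → HorizontalStrip μ ν → size ν + length (μ ∖ ν) ≡ size μ
  size-strip μ ν h = trans (cong (size ν +_) (length-∖ μ ν (proj₁ h)))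
    (ℕₚ.m+[n∸m]≡n (subst₂ _≤_ (sum-pad (rows ν) (strip-ℓ≤ μ ν h)) (sum-pad (rows μ) ℕₚ.≤-refl)
        (interlace-sum (strip⇒≺ (ℓ μ) μ ν h))))

  size-step : ∀ μ ν ρ → HorizontalStrip μ ν → HorizontalStrip ρ ν → size ρ ≤ size μ
      + (length (μ ∖ ν) + length (ρ ∖ ν))
  size-step μ ν ρ h h′ = begin
    size ρ                                              ≡⟨ size-strip ρ ν h′ ⟨
    size ν + length (ρ ∖ ν)                             ≤⟨ ℕₚ.+-mono-≤ (size-ν)
        (ℕₚ.m≤n+m _ (length (μ ∖ ν))) ⟩
    size μ + (length (μ ∖ ν) + length (ρ ∖ ν))          ∎
    where
    open ℕₚ.≤-Reasoning
    size-ν : size ν ≤ size μ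
    size-ν = ℕₚ.≤-trans (ℕₚ.m≤m+n _ _) (ℕₚ.≤-reflexive (size-strip μ ν h))

  size-final : ∀ {m} μ (S : Steps m) {ϕ} → StepsFrom μ S ϕ → size ϕ ≤ size μ + Vec.sum (weightFrom μ S)
  size-final μ []            refl        = ℕₚ.m≤m+n _ 0
  size-final μ ((ν , ρ) ∷ S) (h , h′ , s) = ℕₚ.≤-trans (size-final ρ S s)
    (ℕₚ.≤-trans (ℕₚ.+-monoˡ-≤ _ (size-step μ ν ρ h h′)) (ℕₚ.≤-reflexive (ℕₚ.+-assoc (size μ) _ _)))

  -- The size of the current shape plus the remaining weight never increases along a tableau, so it
  -- bounds every shape still to come.
  ∈-steps : ∀ {m} N μ (S : Steps m) {ϕ} → StepsFrom μ S ϕ → size μ + Vec.sum (weightFrom μ S) ≤ N →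
            Pointwise _∈_ S (Vec.replicate m (cartesianProduct (partitionsIn N) (partitionsIn N)))
  ∈-steps N μ []            _            _  = []
  ∈-steps N μ ((ν , ρ) ∷ S) (h , h′ , s) ≤N =
    ∈ₚ.∈-cartesianProduct⁺ (∈-partitionsIn N ν ν≤) (∈-partitionsIn N ρ (ℕₚ.≤-trans (ℕₚ.m≤m+n _ _) ρ≤)) ∷
        ∈-steps N ρ S s ρ≤
    where
    ν≤ : size ν ≤ N
    ν≤ = ℕₚ.≤-trans (ℕₚ.≤-trans (ℕₚ.m≤m+n _ _) (ℕₚ.≤-reflexive (size-strip μ ν h)))
        (ℕₚ.≤-trans (ℕₚ.m≤m+n _ _) ≤N)
    ρ≤ : size ρ + Vec.sum (weightFrom ρ S) ≤ N
    ρ≤ = ℕₚ.≤-trans (ℕₚ.+-monoˡ-≤ _ (size-step μ ν ρ h h′))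
        (ℕₚ.≤-trans (ℕₚ.≤-reflexive (ℕₚ.+-assoc (size μ) _ _)) ≤N)

  ssots : ∀ {k} (α : Vec ℕ k) μ → Enumeration (λ S → IsSSOT {k} μ S × weight S ≡ α)
  ssots {k} α μ = record
    { elements = List.filter weight? (ssotsIn k N μ)
    ; unique   = Uniqueₚ.filter⁺ weight? (Uniqueₚ.filter⁺ (λ S → stepsFrom? ∅ S μ)
        (choices-unique (all-replicate k
                   (Uniqueₚ.cartesianProduct⁺ (partitionsIn-unique N) (partitionsIn-unique N)))))
    ; sound    = λ S∈ → let (S∈′ , w) = ∈ₚ.∈-filter⁻ weight? {xs = ssotsIn k N μ} S∈ in
                   proj₂ (∈ₚ.∈-filter⁻ (λ S → stepsFrom? ∅ S μ) {xs = steps} S∈′) , w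
    ; complete = λ {S} → λ { (s , refl) → ∈ₚ.∈-filter⁺ weight? (∈ₚ.∈-filter⁺ (λ S → stepsFrom? ∅ S μ)
                   (∈-choices⁺ (∈-steps N ∅ S s ℕₚ.≤-refl)) s) refl }
    }
    where
    N = Vec.sum α
    weight? = λ (S : Steps k) → Vecₚ.≡-dec ℕₚ._≟_ (weight S) α
    steps = choices (Vec.replicate k (cartesianProduct (partitionsIn N) (partitionsIn N)))

  module _ (k : ℕ) where

    Step : Partition → ℕ → Partition × Partition → Set
    Step μ a (ν , ρ) = HorizontalStrip μ ν × HorizontalStrip ρ ν × length (μ ∖ ν) + length (ρ ∖ ν) ≡ a

    -- An oscillating tableau of weight `α` from `μ` with free final shape, whose shapes stay within
    -- the `k` rows that the vectors provide.
    Walk : ∀ {m} → Partition → Vec ℕ m → Steps m → Set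
    Walk μ []      []      = ℓ μ ≤ k
    Walk μ (a ∷ α) ((ν , ρ) ∷ S) = ℓ μ ≤ k × Step μ a (ν , ρ) × Walk ρ α S

    walk-ℓ : ∀ {m} μ (α : Vec ℕ m) S → Walk μ α S → ℓ μ ≤ k
    walk-ℓ μ []      []      l       = l
    walk-ℓ μ (_ ∷ _) (_ ∷ _) (l , _) = l

    walk-final-ℓ : ∀ {m} μ (α : Vec ℕ m) S → Walk μ α S → ℓ (final μ S) ≤ k
    walk-final-ℓ μ []      []            l           = l
    walk-final-ℓ μ (_ ∷ α) ((_ , ρ) ∷ S) (_ , _ , w) = walk-final-ℓ ρ α S w

    walk⇒steps : ∀ {m} μ (α : Vec ℕ m) S → Walk μ α S → StepsFrom μ S (final μ S) × weightFrom μ S ≡ α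
    walk⇒steps μ []      []            _                        = refl , refl
    walk⇒steps μ (_ ∷ α) ((ν , ρ) ∷ S) (_ , (h , h′ , refl) , w) =
      let (s , w≡) = walk⇒steps ρ α S w in (h , h′ , s) , cong (_ ∷_) w≡

    -- A step opens at most one row, so the hypothesis reserves one row for each remaining step. For
    -- `k` steps from `∅` it holds with equality.
    steps⇒walk : ∀ {m} μ (S : Steps m) {ϕ} → ℓ μ + m ≤ k → StepsFrom μ S ϕ → Walk μ (weightFrom μ S) S
    steps⇒walk {zero}  μ []            l _            = ℕₚ.≤-trans (ℕₚ.≤-reflexive (sym (ℕₚ.+-identityʳ _))) l
    steps⇒walk {suc m} μ ((ν , ρ) ∷ S) l (h , h′ , s) =
      ℕₚ.≤-trans (ℕₚ.m≤m+n _ _) l , (h , h′ , refl) , steps⇒walk ρ S (ℕₚ.≤-trans (ℕₚ.+-monoˡ-≤ m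
        (ℕₚ.≤-trans (strip-ℓ≤suc ρ ν h′) (s≤s (strip-ℓ≤ μ ν h))))
            (ℕₚ.≤-trans (ℕₚ.≤-reflexive (sym (ℕₚ.+-suc (ℓ μ) m))) l)) s

    downUp≅step : ∀ a μ → ℓ μ ≤ k →
      (λ ((v , w) : Vec ℕ k × Vec ℕ k) → v ≺ shape k μ × v ≺ w × (∣ shape k μ ∣ ∸ ∣ v ∣) + (∣ w ∣ ∸ ∣ v ∣) ≡
          a) ≅
      (λ (ν , ρ) → Step μ a (ν , ρ) × ℓ ρ ≤ k)
    downUp≅step a μ l = record
      { to      = λ (v , w) → partition v , partition w
      ; from    = λ (ν , ρ) → shape k ν , shape k ρ
      ; to-∈    = λ {(v , w)} (i , j , eq) →
          let v≡ = shape-partition (interlace-decreasingˡ i)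
              w≡ = shape-partition (interlace-decreasingʳ j)
              h  = ≺⇒strip k μ (partition v) l (ℓ-partition v) (subst (_≺ shape k μ) (sym v≡) i)
              h′ = ≺⇒strip k (partition w) (partition v) (ℓ-partition w) (ℓ-partition v)
                  (subst₂ _≺_ (sym v≡) (sym w≡) j)
          in (h , h′ , trans (cong₂ _+_ (trans (length-strip k μ (partition v) l h)
                  (cong (λ v → ∣ shape k μ ∣ ∸ ∣ v ∣) v≡))
                (trans (length-strip k (partition w) (partition v) (ℓ-partition w) h′)
                    (cong₂ (λ w v → ∣ w ∣ ∸ ∣ v ∣) w≡ v≡))) eq) ,
             ℓ-partition w
      ; from-∈  = λ {(ν , ρ)} ((h , h′ , eq) , l′) → strip⇒≺ k μ ν h , strip⇒≺ k ρ ν h′ ,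
          trans (sym (cong₂ _+_ (length-strip k μ ν l h) (length-strip k ρ ν l′ h′))) eq
      ; from∘to = λ {(v , w)} (i , j , _) →
          cong₂ _,_ (shape-partition (interlace-decreasingˡ i)) (shape-partition (interlace-decreasingʳ j))
      ; to∘from = λ {(ν , ρ)} ((h , _ , _) , l′) →
          cong₂ _,_ (partition-shape ν (ℕₚ.≤-trans (strip-ℓ≤ μ ν h) l)) (partition-shape ρ l′)
      }

    module Walks (R : CommutativeRing 0ℓ 0ℓ) (X X⁻¹ : ℕ → CommutativeRing.Carrier R)
      (XX⁻¹≈1 : ∀ j → CommutativeRing._≈_ R (CommutativeRing._*_ R (X j) (X⁻¹ j)) (CommutativeRing.1# R))
          where
      open CommutativeRing R using (Carrier; _≈_; *-congˡ; *-identityˡ; +-identityʳ; setoid)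
        renaming (_*_ to _·_; sym to ≈-sym; trans to ≈-trans; reflexive to ≈-reflexive)
      open Sums R
      open Pieri R
      open King X X⁻¹ XX⁻¹≈1
      open Separable R using (separable)
      open import Algebra.Properties.CommutativeSemigroup (CommutativeRing.*-commutativeSemigroup R) using
          (x∙yz≈yx∙z)
      open import Relation.Binary.Reasoning.Setoid setoid

      weightOfFinal : ∀ {m} → Partition → Steps m → Carrier
      weightOfFinal μ S = symplectic k (shape k (final μ S))

      -- By `pieri±`, summing `symplectic` over the outcomes of a step of size `a` from `μ`
      -- multiplies its value at `μ` by `hom± k a`. The enumeration is provided for every `μ`, as
      -- `_⊗_` requires, and the row bound is a hypothesis of the sum alone.
      walks : ∀ {m} (α : Vec ℕ m) μ → Σ[ E ∈ Enumeration (Walk μ α) ]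
        (ℓ μ ≤ k → ∑ (elements E) (weightOfFinal μ) ≈ separable (λ _ → hom± k) α · symplectic k (shape k μ))
      walks α μ with ℓ μ ℕₚ.≤? k
      walks α μ | no ≰k = record { elements = [] ; unique = [] ; sound = λ () ; complete = λ {S} w → ⊥-elim
          (≰k (walk-ℓ μ α S w)) } ,
        λ l → ⊥-elim (≰k l)
      walks [] μ | yes l = record { elements = [] ∷ [] ; unique = [] ∷ [] ; sound = λ { (here refl) → l }
        ; complete = λ { {[]} _ → here refl } } , λ _ → ≈-trans (+-identityʳ _) (≈-sym (*-identityˡ _))
      walks (a ∷ α) μ | yes l = transport cons≅ (steps ⊗ rest) , λ _ → begin
        ∑ (elements (transport cons≅ (steps ⊗ rest))) (weightOfFinal μ) ≡⟨ ∑-map _ (elements (steps ⊗ rest))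
          _ ⟩
        ∑ (elements (steps ⊗ rest)) (λ ((ν , ρ) , S) → weightOfFinal ρ S) ≈⟨ ∑-⊗ steps rest _ ⟩
        ∑ (elements steps) (λ (ν , ρ) → ∑ (elements (proj₁ (walks α ρ))) (weightOfFinal ρ))
          ≈⟨ ∑-cong (elements steps) (λ {(ν , ρ)} νρ∈ → proj₂ (walks α ρ) (proj₂ (sound steps νρ∈))) ⟩
        ∑ (elements steps) (λ (ν , ρ) → H α · symplectic k (shape k ρ))
          ≈⟨ ∑-≅ (downUp≅step a μ l) (downUp a (shape k μ)) steps (λ (i , j , _) →
               *-congˡ (≈-reflexive (cong (symplectic k) (sym
                   (shape-partition (interlace-decreasingʳ j)))))) ⟨
        ∑ (elements (downUp a (shape k μ))) (λ (v , w) → H α · symplectic k w) ≈⟨ ∑-*ˡ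
          (elements (downUp a (shape k μ))) (H α) _ ⟨
        H α · ∑ (elements (downUp a (shape k μ))) (symplectic k ∘ proj₂) ≈⟨ *-congˡ (pieri± k a (shape k μ)) ⟨
        H α · (hom± k a · symplectic k (shape k μ)) ≈⟨ x∙yz≈yx∙z _ _ _ ⟩
        hom± k a · H α · symplectic k (shape k μ) ∎
        where
        H : ∀ {m} → Vec ℕ m → Carrier
        H = separable (λ _ → hom± k)
        steps = transport (downUp≅step a μ l) (downUp a (shape k μ))
        rest = λ (νρ : Partition × Partition) → proj₁ (walks α (proj₂ νρ))
        cons≅ : (λ (νρ , S) → (Step μ a νρ × ℓ (proj₂ νρ) ≤ k) × Walk (proj₂ νρ) α S) ≅ Walk μ (a ∷ α)
        cons≅ = record
          { to      = λ (νρ , S) → νρ ∷ S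
          ; from    = λ { (νρ ∷ S) → νρ , S }
          ; to-∈    = λ ((s , _) , w) → l , s , w
          ; from-∈  = λ { {(ν , ρ) ∷ S} (_ , s , w) → (s , walk-ℓ ρ α S w) , w }
          ; from∘to = λ _ → refl
          ; to∘from = λ { {_ ∷ _} _ → refl }
          }

-- Summation over all partitions with at most `k` rows

module Summation where

  open import Data.List.Relation.Unary.Linked using ([])
  open import Data.Nat.Base using (ℕ; zero; suc; _∸_; _≤_; z≤n; s≤s; _*_; _+_)
  open FiniteSums
  open Interlacing
  open LocalIdentities
  open PieriRules
  open LaurentPolynomials
  open SeparableSeries
  open Partitions
  open Tableaux
  open CauchyIdentity
  open OscillatingTableaux
  open Enumeration

  -- The Laurent variables enter only as mutually inverse elements of a commutative ring; `z` lists
  -- them in the order of the barred alphabet.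
  module Expansions (R : CommutativeRing 0ℓ 0ℓ) (k′ : ℕ)
    (X X⁻¹ : Fin (suc k′) → CommutativeRing.Carrier R)
    (XX⁻¹≈1 : ∀ i → CommutativeRing._≈_ R (CommutativeRing._*_ R (X i) (X⁻¹ i)) (CommutativeRing.1# R))
    (z : Fin (suc k′ * 2) → CommutativeRing.Carrier R)
    (z-even : ∀ i → z (combine i Fin.zero) ≡ X i)
    (z-odd : ∀ i → z (combine i (Fin.suc Fin.zero)) ≡ X⁻¹ i) where

    private
      k : ℕ
      k = suc k′

    open PowerSeries (CommutativeRing.rawRing R) k using (HasSum; Series; const; var; product; monomial)
        renaming (ring to seriesRing; _*_ to _*ˢ_; _-_ to _-ˢ_; 1# to 1ˢ; _⁻¹ to _⁻¹ˢ)
    open CommutativeRing R using (Carrier; _≈_; 1#; 0#; *-cong; *-congˡ; *-identityˡ; *-identityʳ; zeroʳ;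
        +-identityʳ; +-cong; setoid; *-commutativeMonoid)
      renaming (_*_ to _·_; _+_ to _⊞_; refl to ≈-refl; sym to ≈-sym; trans to ≈-trans; reflexive to
          ≈-reflexive)
    open Sums R
    open Pieri R
    open Separable R
    open Content R
    open Cauchy R
    open TopDown *-commutativeMonoid
    open import Relation.Binary.Reasoning.Setoid setoid

    AtMostRows : Set
    AtMostRows = Σ Partition (λ μ → ℓ μ ≤ k)

    schur± : Partition → Carrier
    schur± = schur (CommutativeRing.rawRing R) z

    schurʸ : Partition → Series
    schurʸ = schur seriesRing var

    king± : Partition → Carrier
    king± μ = ∑ (kingTableaux k μ) (λ T → ∏ (concat T) z)

    oscillatingʸ : Partition → Series
    oscillatingʸ μ α = ∑ (ssotsIn k (Vec.sum α) μ) (λ S → monomial 1# (weight S) α)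

    extend-x : ∀ (i : Fin k) → extend z (toℕ i * 2) ≡ X i
    extend-x i = trans (cong (extend z) (sym (trans (Finₚ.toℕ-combine {k} {2} i Fin.zero)
        (trans (ℕₚ.+-identityʳ _) (ℕₚ.*-comm 2 (toℕ i))))))
      (trans (extend-toℕ z (combine i Fin.zero)) (z-even i))

    extend-x⁻¹ : ∀ (i : Fin k) → extend z (suc (toℕ i * 2)) ≡ X⁻¹ i
    extend-x⁻¹ i = trans (cong (extend z) (sym (trans (Finₚ.toℕ-combine {k} {2} i (Fin.suc Fin.zero))
        (trans (ℕₚ.+-comm _ 1) (cong suc (ℕₚ.*-comm 2 (toℕ i)))))))
      (trans (extend-toℕ z (combine i (Fin.suc Fin.zero))) (z-odd i))

    extend-≥ : ∀ {n} (v : Fin n → Carrier) l → n ≤ l → extend v l ≡ 1#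
    extend-≥ {zero}  v l       _       = refl
    extend-≥ {suc n} v (suc l) (s≤s p) = extend-≥ (v ∘ Fin.suc) l p

    zz≈1 : ∀ j → extend z (j * 2) · extend z (suc (j * 2)) ≈ 1#
    zz≈1 j with j ℕₚ.<? k
    ... | yes j<k = begin
      extend z (j * 2) · extend z (suc (j * 2))
        ≡⟨ cong (λ j → extend z (j * 2) · extend z (suc (j * 2))) (sym (Finₚ.toℕ-fromℕ< j<k)) ⟩
      extend z (toℕ i * 2) · extend z (suc (toℕ i * 2)) ≡⟨ cong₂ _·_ (extend-x i) (extend-x⁻¹ i) ⟩
      X i · X⁻¹ i ≈⟨ XX⁻¹≈1 i ⟩
      1# ∎
      where
      i = fromℕ< j<k
    -- Beyond the `k` pairs both letters are extended by 1, so the relation persists for all `j`.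
    ... | no j≮k = ≈-trans (≈-reflexive (cong₂ _·_ (extend-≥ z (j * 2) k*2≤)
        (extend-≥ z (suc (j * 2)) (ℕₚ.m≤n⇒m≤1+n k*2≤)))) (*-identityˡ 1#)
      where
      k*2≤ : k * 2 ≤ j * 2
      k*2≤ = ℕₚ.*-monoˡ-≤ 2 (ℕₚ.≮⇒≥ j≮k)

    open KingTableaux {k} z zz≈1

    ⋆-product : ∀ {n} → (Fin n → ℕ → Carrier) → ℕ → Carrier
    ⋆-product {n} = sum {n}
      where open import Algebra.Definitions.RawMonoid (CommutativeMonoid.rawMonoid ⋆-commutativeMonoid)
              using (sum)

    ⋆-product≋hom± : ⋆-product {k} (λ j → (X j ^_) ⋆ (X⁻¹ j ^_)) ≋ hom± k
    ⋆-product≋hom± n = begin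
      ⋆-product {k} (λ j → (X j ^_) ⋆ (X⁻¹ j ^_)) n
        ≈⟨ ⋆-product-cong k {φ = λ j → (X j ^_) ⋆ (X⁻¹ j ^_)} {f ∘ toℕ}
          (λ j a → ≈-reflexive (sym (cong₂ (λ u v → ((u ^_) ⋆ (v ^_)) a) (extend-x j) (extend-x⁻¹ j)))) n ⟩
      ⋆-product {k} (f ∘ toℕ) n ≈⟨ T.sum≈topDown k f n ⟩
      T.topDown f k n ≡⟨ cong (_$ n) (hom±≡topDown k) ⟨
      hom± k n ∎
      where
      module T = TopDown ⋆-commutativeMonoid
      f : ℕ → ℕ → Carrier
      f l = geometric (extend z) (l * 2) ⋆ geometric (extend z) (suc (l * 2))

    kernel : Series
    kernel = product (λ i → product (λ j → (1ˢ -ˢ const (X j) *ˢ var i) ⁻¹ˢ *ˢ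
        (1ˢ -ˢ const (X⁻¹ j) *ˢ var i) ⁻¹ˢ))

    kernel≈ : ∀ α → kernel α ≈ separable (λ _ → hom± k) α
    kernel≈ α = ≈-trans (kernel-separable k X X⁻¹ α) (separable-cong (λ _ → ⋆-product≋hom±) α)

    ∅-shape : Vec ℕ k
    ∅-shape = shape k ∅

    sized : (Q : ℕ → Set) → Decidable Q → ∀ N → (∀ {s} → Q s → s ≤ N) → Enumeration
        (λ (v : Vec ℕ k) → IsShape v × Q ∣ v ∣)
    sized Q Q? N Q≤N = boundedSum (λ v → decreasing? (head₀ v) v ×-dec Q? ∣ v ∣) N (Q≤N ∘ proj₂)

    -- `Q` fixes the size for the Schur expansion, and only bounds it for oscillating tableaux,
    -- whose final shape may have lost boxes.
    shapes≅partitions : (Q : ℕ → Set) → (λ (v : Vec ℕ k) → IsShape v × Q ∣ v ∣) ≅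
        (λ ((μ , _) : AtMostRows) → Q (size μ))
    shapes≅partitions Q = record
      { to      = λ v → partition v , ℓ-partition v
      ; from    = λ (μ , _) → shape k μ
      ; to-∈    = λ {v} (d , q) → subst Q (sym (size-partition d)) q
      ; from-∈  = λ {(μ , l)} q → isShape (decreasing-shape k μ) , subst Q (sym (sum-pad (rows μ) l)) q
      ; from∘to = λ (d , _) → shape-partition d
      ; to∘from = λ {(μ , l)} _ → ≡-AtMostRows (partition-shape μ l)
      }
      where
      size-partition : ∀ {v : Vec ℕ k} → IsShape v → size (partition v) ≡ ∣ v ∣
      size-partition {v} d = trans (sym (sum-pad (rows (partition v)) (ℓ-partition v)))
          (cong ∣_∣ (shape-partition d))
      ≡-AtMostRows : ∀ {μ ν : AtMostRows} → proj₁ μ ≡ proj₁ ν → μ ≡ ν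
      ≡-AtMostRows {μ , l} {_ , m} refl = cong (μ ,_) (ℕₚ.≤-irrelevant l m)

    schur-term : ∀ μ → ℓ μ ≤ k → ∀ α → (const (schur± μ) *ˢ schurʸ μ) α ≈
                 chains (geometric (extend z)) (k * 2) (shape k μ) · chains (steps (nth α)) k (shape k μ)
    schur-term μ l α = ≈-trans (const-*ˢ k (schur± μ) (schurʸ μ) α)
        (*-cong (schur-chains z μ l) (schur-y k μ l α))

    -- The step sizes of a chain add up to the size of its last shape, so only partitions whose size
    -- is the total degree of `α` contribute.
    schur-sum : HasSum {I = AtMostRows} (λ (μ , _) → const (schur± μ) *ˢ schurʸ μ) kernel
    schur-sum α = elements E , unique E , outside , (begin
      ∑ (elements E) (λ (μ , _) → (const (schur± μ) *ˢ schurʸ μ) α)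
        ≈⟨ ∑-cong (elements E) (λ {(μ , l)} _ → schur-term μ l α) ⟩
      ∑ (elements E) (λ (μ , _) → F (shape k μ))
        ≈⟨ ∑-≅ (shapes≅partitions (_≡ N)) (shapes N) E
          (λ (d , _) → ≈-reflexive (cong F (sym (shape-partition d)))) ⟨
      ∑ (elements (shapes N)) F ≈⟨ cauchy (extend z) (k * 2) (nth α) k ℕₚ.≤-refl ⟩
      topDown (λ l → hom (extend z) (k * 2) (nth α l)) k ≈⟨ separable≈topDown (λ _ → hom (extend z) (k * 2))
          α ⟨
      separable (λ _ → hom (extend z) (k * 2)) α ≈⟨ separable-cong (λ _ → hom≋hom± k) α ⟩
      separable (λ _ → hom± k) α ≈⟨ kernel≈ α ⟨
      kernel α ∎)
      where
      N = total (nth α) k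
      F : Vec ℕ k → Carrier
      F v = chains (geometric (extend z)) (k * 2) v · chains (steps (nth α)) k v
      E : Enumeration (λ ((μ , _) : AtMostRows) → size μ ≡ N)
      E = transport (shapes≅partitions (_≡ N)) (shapes N)
      outside : ∀ i → i ∉ elements E → (const (schur± (proj₁ i)) *ˢ schurʸ (proj₁ i)) α ≈ 0#
      outside (μ , l) ∉E = ≈-trans (schur-term μ l α)
          (≈-trans (*-congˡ (chains-steps-total (nth α) k (shape k μ)
        (λ eq → ∉E (complete E (trans (sym (sum-pad (rows μ) l)) eq))))) (zeroʳ _))

    ss-count : ∀ μ α → oscillatingʸ μ α ≈ ∑ (elements (ssots α μ)) (λ _ → 1#)
    ss-count μ α = begin
      ∑ (ssotsIn k N μ) f ≈⟨ ∑-filter weight? (ssotsIn k N μ) f ⟩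
      ∑ (filter weight? (ssotsIn k N μ)) f ⊞ ∑ (filter (¬? ∘ weight?) (ssotsIn k N μ)) f
        ≈⟨ +-cong (∑-cong (filter weight? (ssotsIn k N μ)) (λ {S} S∈ → ≈-reflexive (cong (if_then 1# else 0#)
               (dec-true (weight? S) (proj₂ (∈ₚ.∈-filter⁻ weight? {xs = ssotsIn k N μ} S∈))))))
             (∑-zero (filter (¬? ∘ weight?) (ssotsIn k N μ))
                 (λ {S} S∈ → ≈-reflexive (cong (if_then 1# else 0#)
               (dec-false (weight? S) (proj₂ (∈ₚ.∈-filter⁻ (¬? ∘ weight?) {xs = ssotsIn k N μ} S∈)))))) ⟩
      ∑ (elements (ssots α μ)) (λ _ → 1#) ⊞ 0# ≈⟨ +-identityʳ _ ⟩
      ∑ (elements (ssots α μ)) (λ _ → 1#) ∎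
      where
      N = Vec.sum α
      weight? = λ (S : Steps k) → Vecₚ.≡-dec ℕₚ._≟_ (weight S) α
      f : Steps k → Carrier
      f S = if does (weight? S) then 1# else 0#

    symplectic-∅ : ∀ j (μ : Vec ℕ j) → ∣ μ ∣ ≡ 0 → symplectic j μ ≈ 1#
    symplectic-∅ zero    μ eq = ≈-refl
    symplectic-∅ (suc j) μ eq = begin
      ∑ (elements (branches μ)) f ≈⟨ ∑-single f (unique (branches μ))
        (complete (branches μ) {μ , κ} (≺-refl eq , subst (_≺ μ) (sym κ≡) (≺-refl eq))) others ⟩
      f (μ , κ) ≡⟨ cong₂ (λ a b → extend z (j * 2) ^ a · extend z (suc (j * 2)) ^ b · symplectic j κ)
                     (trans (cong (_∸ ∣ κ ∣) eq) (ℕₚ.0∸n≡0 ∣ κ ∣)) (ℕₚ.n∸n≡0 ∣ μ ∣) ⟩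
      1# · 1# · symplectic j κ ≈⟨ *-cong (*-identityˡ 1#)
          (symplectic-∅ j κ (trans (sym (sum-ext κ)) (trans (cong ∣_∣ κ≡) eq))) ⟩
      1# · 1# ≈⟨ *-identityˡ 1# ⟩
      1# ∎
      where
      f : Vec ℕ (suc j) × Vec ℕ j → Carrier
      f (ν , κ) = extend z (j * 2) ^ (∣ ν ∣ ∸ ∣ κ ∣) · extend z (suc (j * 2)) ^ (∣ μ ∣ ∸ ∣ ν ∣) · symplectic
          j κ
      κ = unext μ
      κ≡ : ext κ ≡ μ
      κ≡ = ext-unext μ (ℕₚ.n≤0⇒n≡0 (ℕₚ.≤-trans (ℕₚ.≤-reflexive (sym (nth-bottom μ)))
          (ℕₚ.≤-trans (nth≤sum μ j) (ℕₚ.≤-reflexive eq))))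
      others : ∀ {b} → b ∈ elements (branches μ) → b ≢ (μ , κ) → f b ≈ 0#
      others {ν , κ′} b∈ b≢ = ⊥-elim (b≢ (cong₂ _,_ ν≡
          (trans (sym (unext-ext κ′)) (cong unext (sum≡0-unique κ′₀ eq)))))
        where
        i = sound (branches μ) b∈
        ν₀ = ℕₚ.n≤0⇒n≡0 (ℕₚ.≤-trans (interlace-sum (proj₁ i)) (ℕₚ.≤-reflexive eq))
        κ′₀ = ℕₚ.n≤0⇒n≡0 (ℕₚ.≤-trans (interlace-sum (proj₂ i)) (ℕₚ.≤-reflexive ν₀))
        ν≡ = sum≡0-unique ν₀ eq

    open Walks k R (extend z ∘ (_* 2)) (extend z ∘ suc ∘ (_* 2)) zz≈1

    king-term : ∀ μ → ℓ μ ≤ k → ∀ α → (const (king± μ) *ˢ oscillatingʸ μ) α ≈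
                ∑ (elements (ssots α μ)) (λ _ → symplectic k (shape k μ))
    king-term μ l α = begin
      (const (king± μ) *ˢ oscillatingʸ μ) α ≈⟨ const-*ˢ k (king± μ) (oscillatingʸ μ) α ⟩
      king± μ · oscillatingʸ μ α ≈⟨ *-cong (king-symplectic μ l) (ss-count μ α) ⟩
      symplectic k (shape k μ) · ∑ (elements (ssots α μ)) (λ _ → 1#) ≈⟨ ∑-*ˡ (elements (ssots α μ)) _ _ ⟩
      ∑ (elements (ssots α μ)) (λ _ → symplectic k (shape k μ) · 1#)
        ≈⟨ ∑-cong (elements (ssots α μ)) (λ _ → *-identityʳ _) ⟩
      ∑ (elements (ssots α μ)) (λ _ → symplectic k (shape k μ)) ∎

    -- The junk value is ∅.
    atMostRows : Partition → AtMostRows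
    atMostRows μ with ℓ μ ℕₚ.≤? k
    ... | yes l = μ , l
    ... | no _  = ∅ , z≤n

    atMostRows-≡ : ∀ μ (l : ℓ μ ≤ k) → atMostRows μ ≡ (μ , l)
    atMostRows-≡ μ l with ℓ μ ℕₚ.≤? k
    ... | yes l′ = cong (μ ,_) (ℕₚ.≤-irrelevant l′ l)
    ... | no ≰k  = ⊥-elim (≰k l)

    -- The walk determines its final shape, so summing over all final shapes forgets that
    -- coordinate.
    ssots≅walks : ∀ α → (λ (((μ , _) , S) : AtMostRows × Steps k) → size μ ≤ Vec.sum α ×
        (IsSSOT μ S × weight S ≡ α)) ≅ Walk k ∅ α
    ssots≅walks α = record
      { to      = proj₂
      ; from    = λ S → atMostRows (final ∅ S) , S
      ; to-∈    = λ { {((μ , l) , S)} (_ , s , refl) → steps⇒walk k ∅ S ℕₚ.≤-refl s }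
      ; from-∈  = λ {S} w → let (s , w≡) = walk⇒steps k ∅ α S w
                                eq = atMostRows-≡ (final ∅ S) (walk-final-ℓ k ∅ α S w)
          in subst (λ (μ : AtMostRows) → size (proj₁ μ) ≤ Vec.sum α × (IsSSOT (proj₁ μ) S × weight S ≡ α))
                  (sym eq)
               (subst (λ α → size (final ∅ S) ≤ Vec.sum α) w≡ (size-final ∅ S s) , s , w≡)
      ; from∘to = λ { {((μ , l) , S)} (_ , s , _) → cong (_, S)
          (trans (cong atMostRows (stepsFrom-final ∅ S s)) (atMostRows-≡ μ l)) }
      ; to∘from = λ _ → refl
      }

    -- The sum over final shapes merges the oscillating tableaux of weight `α` into the walks from
    -- `∅`. One Pieri rule per step evaluates these as the kernel coefficient times the symplectic
    -- function of `∅`, which is 1.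
    king-sum : HasSum {I = AtMostRows} (λ (μ , _) → const (king± μ) *ˢ oscillatingʸ μ) kernel
    king-sum α = elements E , unique E , outside , (begin
      ∑ (elements E) (λ (μ , _) → (const (king± μ) *ˢ oscillatingʸ μ) α)
        ≈⟨ ∑-cong (elements E) (λ {(μ , l)} _ → king-term μ l α) ⟩
      ∑ (elements E) (λ (μ , _) → ∑ (elements (ssots α μ)) (λ _ → symplectic k (shape k μ)))
        ≈⟨ ∑-⊗ E (ssots α ∘ proj₁) (λ ((μ , _) , _) → symplectic k (shape k μ)) ⟨
      ∑ (elements (E ⊗ (ssots α ∘ proj₁))) (λ ((μ , _) , _) → symplectic k (shape k μ))
        ≈⟨ ∑-≅ (ssots≅walks α) (E ⊗ (ssots α ∘ proj₁)) W (λ { {((μ , _) , S)} (_ , s , _) →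
             ≈-reflexive (cong (symplectic k ∘ shape k) (sym (stepsFrom-final ∅ S s))) }) ⟩
      ∑ (elements W) (λ S → symplectic k (shape k (final ∅ S))) ≈⟨ proj₂ (walks α ∅) z≤n ⟩
      separable (λ _ → hom± k) α · symplectic k ∅-shape
        ≈⟨ *-congˡ (symplectic-∅ k ∅-shape (sum-pad {k} [] z≤n)) ⟩
      separable (λ _ → hom± k) α · 1# ≈⟨ *-identityʳ _ ⟩
      separable (λ _ → hom± k) α ≈⟨ kernel≈ α ⟨
      kernel α ∎)
      where
      N = Vec.sum α
      E : Enumeration (λ ((μ , _) : AtMostRows) → size μ ≤ N)
      E = transport (shapes≅partitions (_≤ N)) (sized (_≤ N) (ℕₚ._≤? N) N id)
      W = proj₁ (walks α ∅)
      outside : ∀ i → i ∉ elements E → (const (king± (proj₁ i)) *ˢ oscillatingʸ (proj₁ i)) α ≈ 0#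
      outside (μ , l) ∉E = ≈-trans (king-term μ l α) (∑-zero (elements (ssots α μ)) λ {S} S∈ →
        let (s , w) = sound (ssots α μ) S∈ in
        ⊥-elim (∉E (complete E (subst (λ α → size μ ≤ Vec.sum α) w (size-final ∅ S s)))))

  x±-combine : ∀ {k} (i : Fin k) → x± (combine i Fin.zero) ≡ x i × x± (combine i (Fin.suc Fin.zero)) ≡ x⁻¹ i
  x±-combine {k} i rewrite Finₚ.remQuot-combine {k} {2} i Fin.zero | Finₚ.remQuot-combine {k} {2} i
      (Fin.suc Fin.zero) = refl , refl

  xx⁻¹≈1 : ∀ {k} (i : Fin k) → RawRing._≈_ (Laurent k) (RawRing._*_ (Laurent k) (x i) (x⁻¹ i))
      (RawRing.1# (Laurent k))
  xx⁻¹≈1 i e = cong (λ p → coeff p e) (x*x⁻¹ i)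

  module LaurentExpansions (k′ : ℕ) =
    Expansions laurentRing k′ x x⁻¹ xx⁻¹≈1 x± (proj₁ ∘ x±-combine) (proj₂ ∘ x±-combine)

corollary4p23 : (k : ℕ) → .{{_ : NonZero k}} → let open Functions k in
    let kernel = product (λ i → product (λ j →
                   (1# - const (x j) * y i) ⁻¹ * (1# - const (x⁻¹ j) * y i) ⁻¹)) in
    HasSum {I = AtMostRows} (λ (μ , _) → const (s[x±] μ) * s[y] μ) kernel
    × HasSum {I = AtMostRows} (λ (μ , _) → const (sp[x±] μ) * ss[y] μ) kernel
corollary4p23 (suc k) = schur-sum , king-sum
  where open Summation.LaurentExpansions k
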